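{- Let $r\ge 4$ be an integer, let $G$ be a graph with $\chi_{\mathrm f}(G)=t\ge 2$, and let $0<p<1$. Suppose that for some $R\ge 1$, $$\mathbb P\bigl(\rho_{<r}(G_p)\le R\bigr)>\frac1{2t}.$$ Then $$h_r^{\mathrm f}(G)\ge \frac{t}{R\bigl(8\log_{1/(1-p)}(2et)+4\bigr)}.$$ In particular, if $0<p\le 1/2$, then $$h_r^{\mathrm f}(G)\ge c\,\frac{pt}{R\log(2et)}$$ for an absolute constant $c>0$.
   Context: All graphs are finite and simple; subgraphs need not be induced. $\chi_{\mathrm f}$ is the fractional chromatic number; $e$ in $2et$ is Euler's number; $\log$ is natural unless a base is displayed. The girth of a forest is $\infty$. $G_p$ is the random spanning subgraph of $G$ obtained by retaining each edge independently with probability $p$. $h_r^{\mathrm f}(G)=\max\{\chi_{\mathrm f}(H):H\subseteq G,\ \operatorname{girth}(H)\ge r\}$. For a graph $X$, the fractional short-cycle cost is $$\rho_{<r}(X)=\min\{\chi_{\mathrm f}((V(X),F)): F\subseteq E(X),\ X-F\text{ has girth at least }r\},$$ where $(V(X),F)$ is the graph with vertex set $V(X)$ and edge set $F$, and $X-F$ is obtained by deleting the edges in $F$. -}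

module Defs where

open import Data.Bool.Base using (Bool; if_then_else_; T)
open import Data.Fin.Base using (Fin; zero; suc; inject₁; fromℕ)
import Data.Fin.Properties as Fin
open import Data.Fin.Subset using (Subset; inside; outside; _∈_; _⊆_)
open import Data.Fin.Subset.Properties using (_∈?_)
open import Data.Integer.Base using (+_)
open import Data.List.Base using (List; []; _∷_; _++_; map; foldr; filter; allFin; cartesianProduct; length; lookup)
open import Data.Nat.Base as ℕ using (ℕ; zero; suc)
open import Data.Product using (Σ; ∃-syntax; _×_; _,_)
import Data.Product.Properties as Product
open import Data.Rational.Base using (ℚ; 0ℚ; 1ℚ; _+_; _-_; _*_; _≤_; _<_; _/_; ∣_∣; 1/_; ≢-nonZero)
import Data.Rational.Properties as ℚ
open import Data.Sum.Base using (_⊎_; swap)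
open import Data.Vec.Base using ([]; _∷_)
open import Function.Definitions using (Injective)
open import Level using (Level; 0ℓ)
open import Relation.Binary.Core using (Rel)
open import Relation.Binary.Definitions using (Decidable; Symmetric)
open import Relation.Binary.PropositionalEquality using (_≡_; _≢_)
open import Relation.Nullary using (¬_; yes; no)
open import Relation.Nullary.Decidable using (_×-dec_; _⊎-dec_; ¬?)

private
  variable
    a : Level
    N : ℕ

-- A real number is presented by a Cauchy sequence of rationals.  The
-- arithmetic operations and relations are defined on arbitrary sequences;
-- they represent those of ℝ whenever the sequences involved are Cauchy
-- (and, for division, the divisor is a nonzero real).

Seq : Set
Seq = ℕ → ℚ

IsCauchy : Seq → Set
IsCauchy x = ∀ ε → 0ℚ < ε → ∃[ K ] ∀ m n → K ℕ.≤ m → K ℕ.≤ n → ∣ x m - x n ∣ ≤ ε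

record ℝ : Set where
  field
    seq      : Seq
    isCauchy : IsCauchy seq

open ℝ public

infix  4 _≈ˢ_ _≤ˢ_ _<ˢ_
infixl 6 _+ˢ_ _-ˢ_
infixl 7 _*ˢ_ _/ˢ_

_≈ˢ_ _≤ˢ_ _<ˢ_ : Seq → Seq → Set
x ≈ˢ y = ∀ ε → 0ℚ < ε → ∃[ K ] ∀ n → K ℕ.≤ n → ∣ x n - y n ∣ ≤ ε
x ≤ˢ y = ∀ ε → 0ℚ < ε → ∃[ K ] ∀ n → K ℕ.≤ n → x n ≤ y n + ε
x <ˢ y = ∃[ ε ] (0ℚ < ε × ∃[ K ] ∀ n → K ℕ.≤ n → x n + ε ≤ y n)

-- A sequence presenting a nonzero real is eventually nonzero, so the value
-- chosen at 0 does not affect quotients by it.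
recip : ℚ → ℚ
recip q with q ℚ.≟ 0ℚ
... | yes _   = 0ℚ
... | no  q≢0 = 1/_ q {{≢-nonZero q≢0}}

fromℚ : ℚ → Seq
fromℚ q _ = q

fromℕˢ : ℕ → Seq
fromℕˢ k = fromℚ (+ k / 1)

_+ˢ_ _-ˢ_ _*ˢ_ _/ˢ_ : Seq → Seq → Seq
(x +ˢ y) n = x n + y n
(x -ˢ y) n = x n - y n
(x *ˢ y) n = x n * y n
(x /ˢ y) n = x n * recip (y n)

expTerm : ℚ → ℕ → ℚ
expTerm q zero    = 1ℚ
expTerm q (suc k) = expTerm q k * q * (+ 1 / suc k)

expSum : ℚ → ℕ → ℚ
expSum q zero    = expTerm q zero
expSum q (suc k) = expSum q k + expTerm q (suc k)

-- The partial sums converge uniformly on bounded sets, so the diagonal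
-- sequence  n ↦ Σ_{k ≤ n} (x n)^k / k!  presents the exponential of x.
exp : Seq → Seq
exp x n = expSum (x n) n

e : Seq
e = exp (fromℕˢ 1)

IsLn : Seq → ℝ → Set
IsLn x ℓ = exp (seq ℓ) ≈ˢ x

IsLog : (base x : Seq) → ℝ → Set
IsLog b x L = ∃[ ℓb ] ∃[ ℓx ] (IsLn b ℓb × IsLn x ℓx × seq L ≈ˢ seq ℓx /ˢ seq ℓb)

IsMin IsMax : (ℚ → Set a) → ℚ → Set a
IsMin P m = P m × (∀ q → P q → m ≤ q)
IsMax P m = P m × (∀ q → P q → q ≤ m)

sumℚ : List ℚ → ℚ
sumℚ = foldr _+_ 0ℚ

subsets : ∀ n → List (Subset n)
subsets zero    = [] ∷ []
subsets (suc n) = map (outside ∷_) (subsets n) ++ map (inside ∷_) (subsets n)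

-- The vertex set is an arbitrary subset of Fin N, so that subgraphs of a
-- graph, spanning or not, are again graphs over the same Fin N.
record Graph (N : ℕ) : Set₁ where
  field
    V          : Subset N
    Adj        : Rel (Fin N) 0ℓ
    adj?       : Decidable Adj
    adj-sym    : Symmetric Adj
    adj-irrefl : ∀ {i} → ¬ Adj i i
    adj-V      : ∀ {i j} → Adj i j → i ∈ V

open Graph public

infix 4 _⊆ᴳ_
_⊆ᴳ_ : Graph N → Graph N → Set
H ⊆ᴳ G = V H ⊆ V G × (∀ {i j} → Adj H i j → Adj G i j)

IsSpanningSubgraph : Graph N → Graph N → Set
IsSpanningSubgraph H G = V H ≡ V G × H ⊆ᴳ G

infixl 6 _∖E_
_∖E_ : Graph N → Graph N → Graph N
X ∖E F = record
  { V          = V X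
  ; Adj        = λ i j → Adj X i j × ¬ Adj F i j
  ; adj?       = λ i j → adj? X i j ×-dec ¬? (adj? F i j)
  ; adj-sym    = λ (x , ¬f) → adj-sym X x , λ f → ¬f (adj-sym F f)
  ; adj-irrefl = λ (x , _) → adj-irrefl X x
  ; adj-V      = λ (x , _) → adj-V X x
  }

record Cycle (G : Graph N) : Set where
  field
    pred-len : ℕ
  len : ℕ
  len = suc pred-len
  field
    3≤len    : 3 ℕ.≤ len
    vertex   : Fin len → Fin N
    distinct : Injective _≡_ _≡_ vertex
    step     : ∀ (i : Fin pred-len) → Adj G (vertex (inject₁ i)) (vertex (suc i))
    close    : Adj G (vertex (fromℕ pred-len)) (vertex zero)

-- Vacuously true for forests, matching girth ∞.
Girth≥ : ℕ → Graph N → Set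
Girth≥ r G = ∀ (C : Cycle G) → r ℕ.≤ Cycle.len C

Independent : Graph N → Subset N → Set
Independent G S = S ⊆ V G × (∀ {i j} → i ∈ S → j ∈ S → ¬ Adj G i j)

total : (Subset N → ℚ) → ℚ
total {N} w = sumℚ (map w (subsets N))

cover : (Subset N → ℚ) → Fin N → ℚ
cover {N} w v = sumℚ (map w (filter (v ∈?_) (subsets N)))

record IsFractionalColouring (G : Graph N) (w : Subset N → ℚ) : Set where
  field
    nonneg  : ∀ S → 0ℚ ≤ w S
    support : ∀ S → w S ≢ 0ℚ → Independent G S
    covers  : ∀ v → v ∈ V G → 1ℚ ≤ cover w v

-- This linear program has rational data, so its minimum over real weights
-- is attained at rational ones.
Isχf : Graph N → ℚ → Set
Isχf G = IsMin λ q → ∃[ w ] (IsFractionalColouring G w × total w ≡ q)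

Ishf : ℕ → Graph N → ℚ → Set₁
Ishf {N} r G = IsMax λ q → Σ (Graph N) λ H → H ⊆ᴳ G × Girth≥ r H × Isχf H q

-- A set F of edges of X is given as the graph (V(X), F).
Isρ : ℕ → Graph N → ℚ → Set₁
Isρ {N} r X = IsMin λ q → Σ (Graph N) λ F →
  IsSpanningSubgraph F X × Girth≥ r (X ∖E F) × Isχf F q

ρ≤ : ℕ → Graph N → ℝ → Set₁
ρ≤ r X R = ∃[ q ] (Isρ r X q × fromℚ q ≤ˢ seq R)

-- Each edge is listed once, as the pair (i , j) with i < j.
edges : Graph N → List (Fin N × Fin N)
edges {N} G =
  filter (λ (i , j) → (i Fin.<? j) ×-dec adj? G i j)
         (cartesianProduct (allFin N) (allFin N))

-- An outcome is the set of (indices of) retained edges.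
Outcome : Graph N → Set
Outcome G = Subset (length (edges G))

Joins : (G : Graph N) → Fin (length (edges G)) → Rel (Fin N) 0ℓ
Joins G k i j = lookup (edges G) k ≡ (i , j) ⊎ lookup (edges G) k ≡ (j , i)

joins? : (G : Graph N) (k : Fin (length (edges G))) → Decidable (Joins G k)
joins? G k i j = (lookup (edges G) k ≟ₑ (i , j)) ⊎-dec (lookup (edges G) k ≟ₑ (j , i))
  where _≟ₑ_ = Product.≡-dec Fin._≟_ Fin._≟_

retain : (G : Graph N) → Outcome G → Graph N
retain G ω = record
  { V          = V G
  ; Adj        = λ i j → Adj G i j × ∃[ k ] (k ∈ ω × Joins G k i j)
  ; adj?       = λ i j → adj? G i j ×-dec Fin.any? λ k → (k ∈? ω) ×-dec joins? G k i j
  ; adj-sym    = λ (x , k , k∈ω , js) → adj-sym G x , k , k∈ω , swap js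
  ; adj-irrefl = λ (x , _) → adj-irrefl G x
  ; adj-V      = λ (x , _) → adj-V G x
  }

bernoulli : ∀ {m} → ℚ → Subset m → ℚ
bernoulli p []            = 1ℚ
bernoulli p (inside  ∷ ω) = p * bernoulli p ω
bernoulli p (outside ∷ ω) = (1ℚ - p) * bernoulli p ω

-- The probability of the event with indicator D, under independent
-- retention with probability p.
prob : ∀ {m} → Seq → (Subset m → Bool) → Seq
prob {m} p D n = sumℚ (map (λ ω → if D ω then bernoulli (p n) ω else 0ℚ) (subsets m))

-- ℙ>[ G , p ] E q  means  ℙ(G_p satisfies E) > q.  Since E may involve
-- comparing reals it need not be decidable, so we ask for a decidable event
-- contained in E with probability above q; classically E itself serves.
ℙ>[_,_] : (G : Graph N) → Seq → (Graph N → Set a) → Seq → Set a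
ℙ>[ G , p ] E q =
  Σ (Outcome G → Bool) λ D → (∀ ω → T (D ω) → E (retain G ω)) × q <ˢ prob p D

{-# OPTIONS --safe #-}

-- Let y be an optimal dual solution of the linear program for χ_f(G) = t: it has total
-- weight t, and independent sets of G weigh at most 1.  Let T = ⌈t⌉ and let d be about
-- 2 log_{1/(1-p)}(2et), so that 24 t² (1-p)^d ≤ 1.  If a set I independent in G_p weighs
-- more than 2d + 1, delete from it, as long as possible, vertices of degree below 2d in G[I]
-- and vertices outside the |I| T heaviest ones.  The deleted vertices weigh at most 2d
-- (they are 2d-colourable) plus t/T ≤ 1, so a nonempty J remains, among the |J| T heaviest
-- vertices and spanning at least d |J| edges of G, all of them missing from G_p.  There are
-- at most (4T)^m candidates J of size m, and a union bound shows that such a J exists with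
-- probability at most 8 T (1-p)^d ≤ 1/(2t).  Hence some outcome X = G_p satisfies the
-- hypothesis ρ(X) ≤ R while its independent sets weigh at most 2d + 1, and
-- t ≤ (2d + 1) χ_f(X - F) χ_f(F) ≤ (2d + 1) h R, where F is an optimal set of deleted edges.

module Submission where

open import Defs
open import Data.Nat.Base as ℕ using (ℕ; zero; suc; s≤s; z≤n)
import Data.Nat.Properties as ℕₚ
open import Data.Integer.Base as ℤ using (+_)
import Data.Integer.Properties as ℤ
open import Data.Rational.Base as ℚ using (ℚ; 0ℚ; 1ℚ; _+_; _-_; _*_; -_; _≤_; _<_; _/_; ∣_∣; nonNegative; positive; ≢-nonZero; toℚᵘ)
import Data.Rational.Properties as ℚ
open import Algebra.Bundles using (CommutativeRing)
open import Algebra.Properties.Semiring.Sum (CommutativeRing.semiring ℚ.+-*-commutativeRing)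
  using (∑-distrib-+; ∑-comm; *-distribˡ-sum; *-distribʳ-sum) renaming (sum to ∑; sum-cong-≗ to ∑-cong)
import Data.Rational.Unnormalised.Base as ℚᵘ
import Data.Rational.Unnormalised.Properties as ℚᵘ
open import Data.Product using (Σ; ∃-syntax; _×_; _,_; proj₁; proj₂)
open import Data.Sum.Base using (_⊎_; inj₁; inj₂; [_,_]′)
open import Data.Empty using (⊥-elim)
open import Data.List.Base as List using (List; []; _∷_)
open import Data.List.Membership.Propositional using () renaming (_∈_ to _∈ₗ_)
open import Data.List.Membership.Propositional.Properties using (∈-map⁺; ∈-map⁻; ∈-filter⁺; ∈-filter⁻; ∈-++⁺ˡ; ∈-++⁺ʳ; ∈-++⁻; ∈-tabulate⁺; ∈-tabulate⁻; ∈-allFin; ∈-lookup; ∈-cartesianProductWith⁺; ∈-cartesianProductWith⁻)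
open import Data.List.Relation.Unary.Any using (here; there; any?)
open import Data.List.Relation.Unary.Linked as Linked using (Linked)
open import Data.List.Relation.Binary.Permutation.Propositional as ↭ using (_↭_; ↭-sym)
open import Data.List.Relation.Binary.Permutation.Propositional.Properties using (∈-resp-↭)
import Data.List.Sort as Sort
import Relation.Binary.Construct.On as On
open import Relation.Binary.Bundles using (DecTotalOrder)
open import Data.Fin.Base as Fin using (Fin; zero; suc; _↑ˡ_; _↑ʳ_; splitAt)
import Data.Fin.Properties as Fin
open import Data.Fin.Subset as Subset using (Subset; inside; outside; _∈_; _∉_; _⊆_; _∩_; ⁅_⁆)
open import Data.Fin.Subset.Properties as Subsetₚ using (_∈?_; _⊆?_; x∈⁅x⁆; x∈⁅y⁆⇒x≡y; x∈p∩q⁺; x∈p∩q⁻)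
open import Data.Bool.Base using (Bool; true; false; if_then_else_; T)
import Data.Vec.Base as Vec
import Data.Vec.Properties as Vec
import Data.List.Properties as List
open import Relation.Binary.PropositionalEquality using (_≡_; _≢_; refl; sym; trans; cong; cong₂; subst; subst₂)
open import Relation.Nullary using (¬_; Dec; yes; no; contradiction)
open import Relation.Nullary.Decidable using (dec⇒maybe; map′; ¬?; _×-dec_; _⊎-dec_; _→-dec_; does; decidable-stable)
open import Function.Base using (_∘_; id; case_of_)
open import Level using (0ℓ)
open import Tactic.RingSolver using (solve; solve-∀)
open import Tactic.RingSolver.Core.AlmostCommutativeRing using (AlmostCommutativeRing; fromCommutativeRing)

-- A union bound over all vertex sets would bring in a factor growing with the number of vertices.
-- Confining a core of size m to the m T heaviest vertices replaces it by a factor depending on t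
-- alone, small enough to be paid for by d of order log(2et).
--
-- The combinatorics is run at a single rational approximation of p. The event `D` is a fixed finite
-- set of outcomes and t, h are rational, so the bound t ≤ (2d + 1) h q obtained there does not
-- mention p and can be compared with the given real sequences at all later indices.
--
-- The exponential of a real is a diagonal of partial sums E_n, and E_n(x + y) differs from E_n(x)
-- E_n(y). What is wanted is only the chain 25 t² ≤ E_m(x)² ≤ E_2m(2x) ≤ E_n(dβ) ≤ E_n(β)^d, where x
-- is near log(2et) and β near log(1/(1-p)), and each link is an inequality between partial sums
-- with nonnegative terms. Since 2e > 5, the chain starts at 25 t² where 24 t² is required; this
-- difference absorbs the error in E_n(β) (1-p) ≤ 1.

private
  variable
    N : ℕ

-- Ordered arithmetic over ℚ

ℚ-ring : AlmostCommutativeRing 0ℓ 0ℓ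
ℚ-ring = fromCommutativeRing ℚ.+-*-commutativeRing (λ x → dec⇒maybe (0ℚ ℚ.≟ x))

-- Inequalities are proved by exhibiting the difference of the two sides as a
-- nonnegative combination of differences of known inequalities.

infixl 6 _⊕_
infixl 7 _⊗_

_⊕_ : ∀ {x y} → 0ℚ ≤ x → 0ℚ ≤ y → 0ℚ ≤ x + y
_⊕_ = ℚ.+-mono-≤

*-monoˡ : ∀ {x y z} → 0ℚ ≤ z → x ≤ y → z * x ≤ z * y
*-monoˡ {z = z} 0≤z = ℚ.*-monoˡ-≤-nonNeg z {{nonNegative 0≤z}}

*-monoʳ : ∀ {x y z} → 0ℚ ≤ z → x ≤ y → x * z ≤ y * z
*-monoʳ {z = z} 0≤z = ℚ.*-monoʳ-≤-nonNeg z {{nonNegative 0≤z}}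

_⊗_ : ∀ {x y} → 0ℚ ≤ x → 0ℚ ≤ y → 0ℚ ≤ x * y
_⊗_ {x} 0≤x 0≤y = ℚ.≤-trans (ℚ.≤-reflexive (sym (ℚ.*-zeroʳ x))) (*-monoˡ 0≤x 0≤y)

*-mono : ∀ {x y z w} → 0ℚ ≤ x → 0ℚ ≤ w → x ≤ y → z ≤ w → x * z ≤ y * w
*-mono 0≤x 0≤w x≤y z≤w = ℚ.≤-trans (*-monoˡ 0≤x z≤w) (*-monoʳ 0≤w x≤y)

diff : ∀ {x y} → x ≤ y → 0ℚ ≤ y - x
diff {x} {y} x≤y = ℚ.≤-trans (ℚ.≤-reflexive (sym (ℚ.+-inverseʳ x))) (ℚ.+-monoˡ-≤ (- x) x≤y)

by : ∀ {x y s} → 0ℚ ≤ s → y ≡ x + s → x ≤ y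
by {x} {y} {s} 0≤s eq = ℚ.≤-trans (ℚ.≤-reflexive (sym (ℚ.+-identityʳ x)))
  (ℚ.≤-trans (ℚ.+-monoʳ-≤ x 0≤s) (ℚ.≤-reflexive (sym eq)))

<⇒≱ : ∀ {x y} → x < y → ¬ (y ≤ x)
<⇒≱ x<y y≤x = ℚ.<-irrefl refl (ℚ.<-≤-trans x<y y≤x)

0≤1 : 0ℚ ≤ 1ℚ
0≤1 = ℚ.nonNegative⁻¹ 1ℚ

cancelˡ : ∀ {x y z} → 0ℚ < z → z * x ≤ z * y → x ≤ y
cancelˡ {z = z} 0<z = ℚ.*-cancelˡ-≤-pos z {{positive 0<z}}

*-pos : ∀ {x y} → 0ℚ < x → 0ℚ < y → 0ℚ < x * y
*-pos {x} {y} 0<x 0<y = ℚ.positive⁻¹ _ {{ℚ.pos*pos⇒pos x {{positive 0<x}} y {{positive 0<y}}}}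

-- Natural numbers as rationals, reciprocals and powers

infix 9 ι_
ι_ : ℕ → ℚ
ι k = + k / 1

ᵘ/ : ∀ i d → toℚᵘ (i / suc d) ℚᵘ.≃ ℚᵘ.mkℚᵘ i d
ᵘ/ i d = ℚ.toℚᵘ-fromℚᵘ (ℚᵘ.mkℚᵘ i d)

ι-+ : ∀ m n → ι (m ℕ.+ n) ≡ ι m + ι n
ι-+ m n = ℚ.toℚᵘ-injective (ℚᵘ.≃-trans (ᵘ/ (+ (m ℕ.+ n)) 0)
  (ℚᵘ.≃-trans (ℚᵘ.*≡* (cong (ℤ._* + 1) (sym (trans (cong₂ ℤ._+_ (ℤ.*-identityʳ (+ m)) (ℤ.*-identityʳ (+ n))) refl))))
  (ℚᵘ.≃-sym (ℚᵘ.≃-trans (ℚ.toℚᵘ-homo-+ (ι m) (ι n)) (ℚᵘ.+-cong (ᵘ/ (+ m) 0) (ᵘ/ (+ n) 0))))))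

ι-* : ∀ m n → ι (m ℕ.* n) ≡ ι m * ι n
ι-* m n = ℚ.toℚᵘ-injective (ℚᵘ.≃-trans (ᵘ/ (+ (m ℕ.* n)) 0)
  (ℚᵘ.≃-trans (ℚᵘ.*≡* (cong (ℤ._* + 1) (ℤ.pos-* m n)))
  (ℚᵘ.≃-sym (ℚᵘ.≃-trans (ℚ.toℚᵘ-homo-* (ι m) (ι n)) (ℚᵘ.*-cong (ᵘ/ (+ m) 0) (ᵘ/ (+ n) 0))))))

ι-suc : ∀ k → ι (suc k) ≡ 1ℚ + ι k
ι-suc = ι-+ 1

0≤/ : ∀ k d → 0ℚ ≤ + k / suc d
0≤/ k d = ℚ.nonNegative⁻¹ _ {{ℚ.normalize-nonNeg k (suc d)}}

0≤ι : ∀ k → 0ℚ ≤ ι k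
0≤ι k = 0≤/ k 0

ι-mono : ∀ {m n} → m ℕ.≤ n → ι m ≤ ι n
ι-mono {m} {n} m≤n = by (0≤ι (n ℕ.∸ m)) (trans (cong ι_ (sym (ℕₚ.m+[n∸m]≡n m≤n))) (ι-+ m (n ℕ.∸ m)))

ι-inverse : ∀ k → ι (suc k) * (+ 1 / suc k) ≡ 1ℚ
ι-inverse k = ℚ.toℚᵘ-injective (ℚᵘ.≃-trans (ℚ.toℚᵘ-homo-* (ι (suc k)) (+ 1 / suc k))
  (ℚᵘ.≃-trans (ℚᵘ.*-cong (ᵘ/ (+ suc k) 0) (ᵘ/ (+ 1) k))
  (ℚᵘ.*≡* (trans (ℤ.*-identityʳ _) (trans (ℤ.*-comm (+ suc k) (+ 1)) (cong (λ j → + 1 ℤ.* + suc j) (sym (ℕₚ.+-identityʳ k))))))))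

0<1+ι : ∀ k → 0ℚ < ι (suc k)
0<1+ι k = ℚ.positive⁻¹ _ {{ℚ.normalize-pos (suc k) 1}}

recip-inverse : ∀ {q} → 0ℚ < q → q * recip q ≡ 1ℚ
recip-inverse {q} 0<q with q ℚ.≟ 0ℚ
... | yes q≡0 = contradiction (sym q≡0) (ℚ.<⇒≢ 0<q)
... | no  q≢0 = ℚ.*-inverseʳ q {{≢-nonZero q≢0}}

0≤recip : ∀ {q} → 0ℚ < q → 0ℚ ≤ recip q
0≤recip {q} 0<q = cancelˡ 0<q (ℚ.≤-trans (ℚ.≤-reflexive (ℚ.*-zeroʳ q))
  (ℚ.≤-trans 0≤1 (ℚ.≤-reflexive (sym (recip-inverse 0<q)))))

infixr 8 _^_
_^_ : ℚ → ℕ → ℚ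
x ^ zero  = 1ℚ
x ^ suc n = x * x ^ n

0≤^ : ∀ {x} → 0ℚ ≤ x → ∀ n → 0ℚ ≤ x ^ n
0≤^ 0≤x zero    = 0≤1
0≤^ 0≤x (suc n) = 0≤x ⊗ 0≤^ 0≤x n

^-mono : ∀ {x y} → 0ℚ ≤ x → x ≤ y → ∀ n → x ^ n ≤ y ^ n
^-mono 0≤x x≤y zero    = ℚ.≤-refl
^-mono 0≤x x≤y (suc n) = *-mono 0≤x (0≤^ (ℚ.≤-trans 0≤x x≤y) n) x≤y (^-mono 0≤x x≤y n)

^-distrib-* : ∀ x y n → (x * y) ^ n ≡ x ^ n * y ^ n
^-distrib-* x y zero    = refl
^-distrib-* x y (suc n) rewrite ^-distrib-* x y n = eq x y (x ^ n) (y ^ n)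
  where
  eq : ∀ x y p q → x * y * (p * q) ≡ x * p * (y * q)
  eq = solve-∀ ℚ-ring

^-+ : ∀ x m n → x ^ (m ℕ.+ n) ≡ x ^ m * x ^ n
^-+ x zero    n = sym (ℚ.*-identityˡ _)
^-+ x (suc m) n rewrite ^-+ x m n = sym (ℚ.*-assoc x (x ^ m) (x ^ n))

^-* : ∀ x m n → x ^ (m ℕ.* n) ≡ (x ^ n) ^ m
^-* x zero    n = refl
^-* x (suc m) n rewrite ^-+ x n (m ℕ.* n) | ^-* x m n = refl

-- Bounds (1 + ε)^n from above without a division; the induction step loses (1 + ε)^n ε² (1 + n). It
-- serves for the accumulated error (1 + ε)^d and for (1 + 1/(2T))^T ≤ 2.
bernoulli-≤ : ∀ {ε} → 0ℚ ≤ ε → ∀ n → (1ℚ + ε) ^ n * (1ℚ - ι n * ε) ≤ 1ℚ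
bernoulli-≤ {ε} 0≤ε zero    = by ℚ.≤-refl (eq₀ ε)
  where
  eq₀ : ∀ ε → 1ℚ ≡ 1ℚ * (1ℚ - 0ℚ * ε) + 0ℚ
  eq₀ = solve-∀ ℚ-ring
bernoulli-≤ {ε} 0≤ε (suc n) = ℚ.≤-trans
  (by (0≤^ (0≤1 ⊕ 0≤ε) n ⊗ (0≤ε ⊗ 0≤ε ⊗ (0≤1 ⊕ 0≤ι n))) (eq ((1ℚ + ε) ^ n) (ι n) (ι (suc n)) (ι-suc n)))
  (bernoulli-≤ 0≤ε n)
  where
  eq : ∀ P k k' → k' ≡ 1ℚ + k → P * (1ℚ - k * ε) ≡ (1ℚ + ε) * P * (1ℚ - k' * ε) + P * (ε * ε * (1ℚ + k))
  eq P k k' refl = solve (P ∷ k ∷ ε ∷ []) ℚ-ring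

-- Partial sums of the exponential series

0≤expTerm : ∀ {x} → 0ℚ ≤ x → ∀ k → 0ℚ ≤ expTerm x k
0≤expTerm 0≤x zero    = 0≤1
0≤expTerm 0≤x (suc k) = 0≤expTerm 0≤x k ⊗ 0≤x ⊗ 0≤/ 1 k

expTerm-suc : ∀ x k → ι (suc k) * expTerm x (suc k) ≡ x * expTerm x k
expTerm-suc x k = trans (eq (ι (suc k)) (expTerm x k) x (+ 1 / suc k))
  (trans (cong (x * expTerm x k *_) (ι-inverse k)) (ℚ.*-identityʳ _))
  where
  eq : ∀ c a x r → c * (a * x * r) ≡ x * a * (c * r)
  eq = solve-∀ ℚ-ring

expSum-mono-index : ∀ {x} → 0ℚ ≤ x → ∀ {m n} → m ℕ.≤ n → expSum x m ≤ expSum x n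
expSum-mono-index {x} 0≤x m≤n = go (ℕₚ.≤⇒≤′ m≤n)
  where
  go : ∀ {m n} → m ℕ.≤′ n → expSum x m ≤ expSum x n
  go (ℕ.≤′-reflexive refl) = ℚ.≤-refl
  go {m} (ℕ.≤′-step {n} m≤n) = by (diff (go m≤n) ⊕ 0≤expTerm 0≤x (suc n)) (eq (expSum x m) (expSum x n) (expTerm x (suc n)))
    where
    eq : ∀ a b t → b + t ≡ a + ((b - a) + t)
    eq = solve-∀ ℚ-ring

1≤expSum : ∀ {x} → 0ℚ ≤ x → ∀ n → 1ℚ ≤ expSum x n
1≤expSum 0≤x n = expSum-mono-index 0≤x {0} {n} z≤n

expTerm-mono : ∀ {x y} → 0ℚ ≤ x → x ≤ y → ∀ k → expTerm x k ≤ expTerm y k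
expTerm-mono 0≤x x≤y zero    = ℚ.≤-refl
expTerm-mono 0≤x x≤y (suc k) = *-monoʳ (0≤/ 1 k)
  (*-mono (0≤expTerm 0≤x k) (ℚ.≤-trans 0≤x x≤y) (expTerm-mono 0≤x x≤y k) x≤y)

expSum-mono : ∀ {x y} → 0ℚ ≤ x → x ≤ y → ∀ n → expSum x n ≤ expSum y n
expSum-mono 0≤x x≤y zero    = ℚ.≤-refl
expSum-mono 0≤x x≤y (suc n) = ℚ.+-mono-≤ (expSum-mono 0≤x x≤y n) (expTerm-mono 0≤x x≤y (suc n))

infixl 7 _⋆_
-- The Cauchy product Σ f i g (n - i). Recursion by shifting f avoids truncated subtraction of
-- indices.
_⋆_ : (ℕ → ℚ) → (ℕ → ℚ) → ℕ → ℚ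
(f ⋆ g) zero    = f 0 * g 0
(f ⋆ g) (suc n) = f 0 * g (suc n) + (f ∘ suc ⋆ g) n

⋆-cong : ∀ {f f' g g'} → (∀ k → f k ≡ f' k) → (∀ k → g k ≡ g' k) → ∀ n → (f ⋆ g) n ≡ (f' ⋆ g') n
⋆-cong f≗ g≗ zero    = cong₂ _*_ (f≗ 0) (g≗ 0)
⋆-cong f≗ g≗ (suc n) = cong₂ _+_ (cong₂ _*_ (f≗ 0) (g≗ (suc n))) (⋆-cong (f≗ ∘ suc) g≗ n)

⋆-mono : ∀ {f g} h → (∀ k → 0ℚ ≤ h k) → ∀ n → (∀ k → k ℕ.≤ n → f k ≤ g k) → (h ⋆ f) n ≤ (h ⋆ g) n
⋆-mono h 0≤h zero    f≤g = *-monoˡ (0≤h 0) (f≤g 0 z≤n)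
⋆-mono h 0≤h (suc n) f≤g = ℚ.+-mono-≤ (*-monoˡ (0≤h 0) (f≤g (suc n) ℕₚ.≤-refl))
  (⋆-mono (h ∘ suc) (0≤h ∘ suc) n (λ k k≤n → f≤g k (ℕₚ.m≤n⇒m≤1+n k≤n)))

⋆-last : ∀ f g n → (f ⋆ g) (suc n) ≡ (f ⋆ (g ∘ suc)) n + f (suc n) * g 0
⋆-last f g zero    = refl
⋆-last f g (suc n) = trans (cong (λ z → f 0 * g (suc (suc n)) + z) (⋆-last (f ∘ suc) g n)) (sym (ℚ.+-assoc (f 0 * g (suc (suc n))) _ _))

⋆-scaleˡ : ∀ c f g n → ((λ k → c * f k) ⋆ g) n ≡ c * (f ⋆ g) n
⋆-scaleˡ c f g zero    = ℚ.*-assoc c (f 0) (g 0)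
⋆-scaleˡ c f g (suc n) rewrite ⋆-scaleˡ c (f ∘ suc) g n = eq c (f 0) (g (suc n)) ((f ∘ suc ⋆ g) n)
  where
  eq : ∀ c f g z → c * f * g + c * z ≡ c * (f * g + z)
  eq = solve-∀ ℚ-ring

⋆-scaleʳ : ∀ c f g n → (f ⋆ (λ k → c * g k)) n ≡ c * (f ⋆ g) n
⋆-scaleʳ c f g zero    = eq c (f 0) (g 0)
  where
  eq : ∀ c f g → f * (c * g) ≡ c * (f * g)
  eq = solve-∀ ℚ-ring
⋆-scaleʳ c f g (suc n) rewrite ⋆-scaleʳ c (f ∘ suc) g n = eq c (f 0) (g (suc n)) ((f ∘ suc ⋆ g) n)
  where
  eq : ∀ c f g z → f * (c * g) + c * z ≡ c * (f * g + z)
  eq = solve-∀ ℚ-ring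

-- The Leibniz rule for the derivation θ f k = k f k, generalised by a shift s of
-- the first index.
⋆-leibniz : ∀ f g s n → (ι n + s) * (f ⋆ g) n ≡ ((λ k → (ι k + s) * f k) ⋆ g) n + (f ⋆ (λ k → ι k * g k)) n
⋆-leibniz f g s zero    = eq s (f 0) (g 0)
  where
  eq : ∀ s f g → (0ℚ + s) * (f * g) ≡ (0ℚ + s) * f * g + f * (0ℚ * g)
  eq = solve-∀ ℚ-ring
⋆-leibniz f g s (suc n) = trans (cong (λ k → (k + s) * (f ⋆ g) (suc n)) (ι-suc n))
  (eq (ι n) (ι (suc n)) s (f 0) (g (suc n)) _ _ _ _ (ι-suc n)
    (⋆-leibniz (f ∘ suc) g (1ℚ + s) n)
    (⋆-cong (λ k → cong (_* f (suc k)) (trans (assoc (ι k) s) (cong (_+ s) (sym (ι-suc k))))) (λ _ → refl) n))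
  where
  assoc : ∀ k s → k + (1ℚ + s) ≡ 1ℚ + k + s
  assoc = solve-∀ ℚ-ring
  eq : ∀ k k' s f g c l l' r → k' ≡ 1ℚ + k → (k + (1ℚ + s)) * c ≡ l + r → l ≡ l' →
       (1ℚ + k + s) * (f * g + c) ≡ ((0ℚ + s) * f * g + l') + (f * (k' * g) + r)
  eq k _ s f g c l _ r refl h refl = trans (eq₁ k s f g c)
    (trans (cong (λ z → (s * f * g + f * ((1ℚ + k) * g)) + z) h) (eq₂ k s f g l r))
    where
    eq₁ : ∀ k s f g c → (1ℚ + k + s) * (f * g + c) ≡ (s * f * g + f * ((1ℚ + k) * g)) + (k + (1ℚ + s)) * c
    eq₁ = solve-∀ ℚ-ring
    eq₂ : ∀ k s f g l r → (s * f * g + f * ((1ℚ + k) * g)) + (l + r) ≡ ((0ℚ + s) * f * g + l) + (f * ((1ℚ + k) * g) + r)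
    eq₂ = solve-∀ ℚ-ring

-- The binomial theorem without binomial coefficients: both sides satisfy (n + 1) c (n + 1) = (x +
-- y) c n. For the product this is the Leibniz rule, because k x^k/k! = x · x^(k-1)/(k-1)!.
⋆-expTerm : ∀ x y n → (expTerm x ⋆ expTerm y) n ≡ expTerm (x + y) n
⋆-expTerm x y zero    = refl
⋆-expTerm x y (suc n) = cancel (trans (step) (sym (expTerm-suc (x + y) n)))
  where
  f = expTerm x
  g = expTerm y
  cancel : ∀ {p q} → ι (suc n) * p ≡ ι (suc n) * q → p ≡ q
  cancel eq = ℚ.≤-antisym (cancelˡ (0<1+ι n) (ℚ.≤-reflexive eq)) (cancelˡ (0<1+ι n) (ℚ.≤-reflexive (sym eq)))
  zeroˡ : ∀ g → (0ℚ + 0ℚ) * 1ℚ * g ≡ 0ℚ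
  zeroˡ = solve-∀ ℚ-ring
  zeroʳ : ∀ f → f * (0ℚ * 1ℚ) ≡ 0ℚ
  zeroʳ = solve-∀ ℚ-ring
  left : ((λ k → (ι k + 0ℚ) * f k) ⋆ g) (suc n) ≡ x * (f ⋆ g) n
  left = trans (cong₂ _+_ (zeroˡ (g (suc n)))
      (trans (⋆-cong (λ k → trans (cong (_* f (suc k)) (ℚ.+-identityʳ (ι (suc k)))) (expTerm-suc x k)) (λ _ → refl) n) (⋆-scaleˡ x f g n)))
    (ℚ.+-identityˡ _)
  right : (f ⋆ (λ k → ι k * g k)) (suc n) ≡ y * (f ⋆ g) n
  right = trans (⋆-last f (λ k → ι k * g k) n) (trans (cong₂ _+_
      (trans (⋆-cong {f = f} (λ _ → refl) (expTerm-suc y) n) (⋆-scaleʳ y f g n))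
      (zeroʳ (f (suc n))))
    (ℚ.+-identityʳ _))
  step : ι (suc n) * (f ⋆ g) (suc n) ≡ (x + y) * expTerm (x + y) n
  step = trans (cong (_* (f ⋆ g) (suc n)) (sym (ℚ.+-identityʳ (ι (suc n))))) (trans (⋆-leibniz f g 0ℚ (suc n)) (trans (cong₂ _+_ left right)
    (trans (sym (ℚ.*-distribʳ-+ ((f ⋆ g) n) x y)) (cong ((x + y) *_) (⋆-expTerm x y n)))))

⋆-expSum-step : ∀ f y n → (f ⋆ expSum y) (suc n) ≡ (f ⋆ expSum y) n + (f ⋆ expTerm y) (suc n)
⋆-expSum-step f y zero    = eq (f 0) (f 1) (expTerm y 1)
  where
  eq : ∀ a b t → a * (1ℚ + t) + b * 1ℚ ≡ a * 1ℚ + (a * t + b * 1ℚ)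
  eq = solve-∀ ℚ-ring
⋆-expSum-step f y (suc n) rewrite ⋆-expSum-step (f ∘ suc) y n = eq (f 0) (expSum y (suc n)) (expTerm y (suc (suc n))) ((f ∘ suc ⋆ expSum y) n) ((f ∘ suc ⋆ expTerm y) (suc n))
  where
  eq : ∀ a s t p q → a * (s + t) + (p + q) ≡ (a * s + p) + (a * t + q)
  eq = solve-∀ ℚ-ring

⋆-expSum : ∀ x y n → (expTerm x ⋆ expSum y) n ≡ expSum (x + y) n
⋆-expSum x y zero    = refl
⋆-expSum x y (suc n) = trans (⋆-expSum-step (expTerm x) y n) (cong₂ _+_ (⋆-expSum x y n) (⋆-expTerm x y (suc n)))

⋆-const : ∀ x c n → (expTerm x ⋆ (λ _ → c)) n ≡ c * expSum x n
⋆-const x c zero = trans (ℚ.*-identityˡ c) (sym (ℚ.*-identityʳ c))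
⋆-const x c (suc n) = trans (⋆-last (expTerm x) (λ _ → c) n)
  (trans (cong (_+ expTerm x (suc n) * c) (⋆-const x c n)) (eq c (expSum x n) (expTerm x (suc n))))
  where
  eq : ∀ c s t → c * s + t * c ≡ c * (s + t)
  eq = solve-∀ ℚ-ring

-- E_n(x + y) is a sum of nonnegative terms over the triangle i + j ≤ n, the product one over the
-- square i, j ≤ n.
expSum-+-≤ : ∀ {x y} → 0ℚ ≤ x → 0ℚ ≤ y → ∀ n → expSum (x + y) n ≤ expSum x n * expSum y n
expSum-+-≤ {x} {y} 0≤x 0≤y n = ℚ.≤-trans (ℚ.≤-reflexive (sym (⋆-expSum x y n)))
  (ℚ.≤-trans (⋆-mono (expTerm x) (0≤expTerm 0≤x) n (λ k k≤n → expSum-mono-index 0≤y k≤n))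
  (ℚ.≤-reflexive (trans (⋆-const x (expSum y n) n) (ℚ.*-comm (expSum y n) (expSum x n)))))

-- The left side consists of the summands of the right side in which the index of f is at most n.
⋆-drop : ∀ {f g} → (∀ k → 0ℚ ≤ f k) → (∀ k → 0ℚ ≤ g k) → ∀ m n → (f ⋆ (g ∘ (m ℕ.+_))) n ≤ (f ⋆ g) (m ℕ.+ n)
⋆-drop {f} {g} 0≤f 0≤g zero    n = ℚ.≤-refl
⋆-drop {f} {g} 0≤f 0≤g (suc m) n = ℚ.≤-trans (⋆-drop {f} {g ∘ suc} 0≤f (0≤g ∘ suc) m n)
  (by (0≤f (suc (m ℕ.+ n)) ⊗ 0≤g 0) (⋆-last f g (m ℕ.+ n)))

-- The square i, j ≤ n is contained in the triangle i + j ≤ 2n.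
expSum-double : ∀ {x} → 0ℚ ≤ x → ∀ n → expSum x n * expSum x n ≤ expSum (x + x) (n ℕ.+ n)
expSum-double {x} 0≤x n = ℚ.≤-trans (ℚ.≤-reflexive (sym (⋆-const x (expSum x n) n)))
  (ℚ.≤-trans (⋆-mono (expTerm x) (0≤expTerm 0≤x) n (λ k _ → expSum-mono-index 0≤x (ℕₚ.m≤m+n n k)))
  (ℚ.≤-trans (⋆-drop (0≤expTerm 0≤x) (λ k → ℚ.≤-trans 0≤1 (1≤expSum 0≤x k)) n n) (ℚ.≤-reflexive (⋆-expSum x x (n ℕ.+ n)))))

expSum-0 : ∀ n → expSum 0ℚ n ≡ 1ℚ
expSum-0 zero    = refl
expSum-0 (suc n) = trans (cong₂ _+_ (expSum-0 n) (eq (expTerm 0ℚ n) (+ 1 / suc n))) refl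
  where
  eq : ∀ a b → a * 0ℚ * b ≡ 0ℚ
  eq = solve-∀ ℚ-ring

expSum-*-≤ : ∀ {x} → 0ℚ ≤ x → ∀ d n → expSum (ι d * x) n ≤ expSum x n ^ d
expSum-*-≤ {x} 0≤x zero    n = ℚ.≤-reflexive (trans (cong (λ z → expSum z n) (ℚ.*-zeroˡ x)) (expSum-0 n))
expSum-*-≤ {x} 0≤x (suc d) n = ℚ.≤-trans
  (ℚ.≤-reflexive (cong (λ z → expSum z n) (trans (cong (_* x) (ι-suc d)) (eq (ι d) x))))
  (ℚ.≤-trans (expSum-+-≤ 0≤x (0≤ι d ⊗ 0≤x) n)
  (*-monoˡ (ℚ.≤-trans 0≤1 (1≤expSum 0≤x n)) (expSum-*-≤ 0≤x d n)))
  where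
  eq : ∀ d x → (1ℚ + d) * x ≡ x + d * x
  eq = solve-∀ ℚ-ring

-- Together the two bounds say that the terms at -y are dominated in absolute value by those at y.
-- They are proved jointly because each further factor -y exchanges them.
expTerm-neg : ∀ {y} → 0ℚ ≤ y → ∀ k → expTerm (- y) k ≤ expTerm y k × - expTerm y k ≤ expTerm (- y) k
expTerm-neg {y} 0≤y zero    = ℚ.≤-refl , by (0≤1 ⊕ 0≤1) refl
expTerm-neg {y} 0≤y (suc k) = let (u , l) = expTerm-neg 0≤y k; w = 0≤y ⊗ 0≤/ 1 k in
  by (w ⊗ diff l) (eq₁ (expTerm y k) (expTerm (- y) k) y (+ 1 / suc k)) ,
  by (w ⊗ diff u) (eq₂ (expTerm y k) (expTerm (- y) k) y (+ 1 / suc k))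
  where
  eq₁ : ∀ a b y r → a * y * r ≡ b * (- y) * r + y * r * (b - (- a))
  eq₁ = solve-∀ ℚ-ring
  eq₂ : ∀ a b y r → b * (- y) * r ≡ - (a * y * r) + y * r * (a - b)
  eq₂ = solve-∀ ℚ-ring

expSum-neg-tail : ∀ {y} → 0ℚ ≤ y → ∀ {m n} → m ℕ.≤ n → expSum (- y) n - expSum (- y) m ≤ expSum y n - expSum y m
expSum-neg-tail {y} 0≤y m≤n = go (ℕₚ.≤⇒≤′ m≤n)
  where
  go : ∀ {m n} → m ℕ.≤′ n → expSum (- y) n - expSum (- y) m ≤ expSum y n - expSum y m
  go {m} (ℕ.≤′-reflexive refl) = ℚ.≤-reflexive (trans (ℚ.+-inverseʳ (expSum (- y) m)) (sym (ℚ.+-inverseʳ (expSum y m))))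
  go {m} (ℕ.≤′-step {n} m≤n) = by (diff (go m≤n) ⊕ diff (proj₁ (expTerm-neg 0≤y (suc n)))) (eq (expSum (- y) n) (expSum (- y) m) (expSum y n) (expSum y m) (expTerm (- y) (suc n)) (expTerm y (suc n)))
    where
    eq : ∀ a b a' b' t t' → (a' + t') - b' ≡ ((a + t) - b) + (((a' - b') - (a - b)) + (t' - t))
    eq = solve-∀ ℚ-ring

-- Compare 1 = Σᵢ aᵢ(y) Eₙ₋ᵢ(-y) with Eₙ(y) Eₙ(-y) and Eₙ(2y) = Σᵢ aᵢ(y) Eₙ₋ᵢ(y)
-- with Eₙ(y)²: the terms of the first difference are dominated by those of the second.
expSum-neg-* : ∀ {y} → 0ℚ ≤ y → ∀ n → expSum (- y) n * expSum y n ≤ 1ℚ + (expSum y n * expSum y n - expSum (y + y) n)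
expSum-neg-* {y} 0≤y n = by (diff (⋆-mono (expTerm y) (0≤expTerm 0≤y) n (λ k k≤n → tail k k≤n)))
  (eq _ _ (e₋ * e₊) (e₊ * e₊) (expSum (y + y) n) lhs rhs)
  where
  e₊ = expSum y n
  e₋ = expSum (- y) n
  tail : ∀ k → k ℕ.≤ n → e₋ + (- 1ℚ) * expSum (- y) k ≤ e₊ + (- 1ℚ) * expSum y k
  tail k k≤n = by (diff (expSum-neg-tail 0≤y k≤n)) (eq' e₋ e₊ (expSum (- y) k) (expSum y k))
    where
    eq' : ∀ a b c d → b + (- 1ℚ) * d ≡ a + (- 1ℚ) * c + (b - d - (a - c))
    eq' = solve-∀ ℚ-ring
  ⋆-add : ∀ f g h n → (f ⋆ (λ k → g k + h k)) n ≡ (f ⋆ g) n + (f ⋆ h) n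
  ⋆-add f g h zero = ℚ.*-distribˡ-+ (f 0) (g 0) (h 0)
  ⋆-add f g h (suc n) rewrite ⋆-add (f ∘ suc) g h n = eq'' (f 0) (g (suc n)) (h (suc n)) ((f ∘ suc ⋆ g) n) ((f ∘ suc ⋆ h) n)
    where
    eq'' : ∀ f g h a b → f * (g + h) + (a + b) ≡ f * g + a + (f * h + b)
    eq'' = solve-∀ ℚ-ring
  expand : ∀ c z → (expTerm y ⋆ (λ k → c + (- 1ℚ) * expSum z k)) n ≡ c * e₊ - expSum (y + z) n
  expand c z = trans (⋆-add (expTerm y) (λ _ → c) _ n) (cong₂ _+_ (⋆-const y c n)
    (trans (⋆-scaleʳ (- 1ℚ) (expTerm y) (expSum z) n) (trans (sym (ℚ.neg-distribˡ-* 1ℚ ((expTerm y ⋆ expSum z) n))) (cong -_ (trans (ℚ.*-identityˡ ((expTerm y ⋆ expSum z) n)) (⋆-expSum y z n))))))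
  lhs : (expTerm y ⋆ (λ k → e₋ + (- 1ℚ) * expSum (- y) k)) n ≡ e₋ * e₊ - 1ℚ
  lhs = trans (expand e₋ (- y)) (cong (λ z → e₋ * e₊ - z) (trans (cong (λ z → expSum z n) (ℚ.+-inverseʳ y)) (expSum-0 n)))
  rhs : (expTerm y ⋆ (λ k → e₊ + (- 1ℚ) * expSum y k)) n ≡ e₊ * e₊ - expSum (y + y) n
  rhs = expand e₊ y
  eq : ∀ A B p q r → A ≡ p - 1ℚ → B ≡ q - r → 1ℚ + (q - r) ≡ p + (B - A)
  eq _ _ p q r refl refl = solve (p ∷ q ∷ r ∷ []) ℚ-ring

-- The Archimedean property and uniform tails of the exponential series

archimedean : ∀ x → ∃[ n ] x ≤ ι n
archimedean x@(ℚ.mkℚ i d _) = ℤ.∣ i ∣ , ℚ.toℚᵘ-cancel-≤ (ℚᵘ.≤-respʳ-≃ (ℚᵘ.≃-sym (ᵘ/ (+ ℤ.∣ i ∣) 0))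
  (ℚᵘ.*≤* (ℤ.≤-trans (ℤ.≤-reflexive (ℤ.*-identityʳ i)) (ℤ.≤-trans (i≤∣i∣ i)
    (ℤ.≤-trans (ℤ.+≤+ (ℕₚ.m≤m*n ℤ.∣ i ∣ (suc d))) (ℤ.≤-reflexive (ℤ.pos-* ℤ.∣ i ∣ (suc d))))))))
  where
  i≤∣i∣ : ∀ i → i ℤ.≤ + ℤ.∣ i ∣
  i≤∣i∣ (+ n)        = ℤ.≤-refl
  i≤∣i∣ (ℤ.-[1+ n ]) = ℤ.-≤+

archimedean-* : ∀ {ε} → 0ℚ < ε → ∀ x → ∃[ n ] x ≤ ε * ι n
archimedean-* {ε} 0<ε x = let (n , h) = archimedean (x * recip ε) in
  n , ℚ.≤-trans (ℚ.≤-reflexive (sym (trans (eq ε x (recip ε)) (trans (cong (_* x) (recip-inverse 0<ε)) (ℚ.*-identityˡ x)))))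
    (*-monoˡ (ℚ.<⇒≤ 0<ε) h)
  where
  eq : ∀ e x r → e * (x * r) ≡ e * r * x
  eq = solve-∀ ℚ-ring

ceiling : ∀ {x} → 0ℚ ≤ x → ∃[ n ] (x ≤ ι n × ι n ≤ x + 1ℚ)
ceiling {x} 0≤x = let (n , h) = archimedean x in go n h
  where
  go : ∀ n → x ≤ ι n → ∃[ n ] (x ≤ ι n × ι n ≤ x + 1ℚ)
  go zero    h = 0 , h , 0≤x ⊕ 0≤1
  go (suc n) h with x ℚ.≤? ι n
  ... | yes x≤n = go n x≤n
  ... | no  x≰n = suc n , h , by (diff (ℚ.<⇒≤ (ℚ.≰⇒> x≰n))) (trans (eq x (ι n)) (cong (_+ (x - ι n)) (sym (ι-suc n))))
    where
    eq : ∀ x k → x + 1ℚ ≡ (1ℚ + k) + (x - k)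
    eq = solve-∀ ℚ-ring

1/suc≤1 : ∀ k → + 1 / suc k ≤ 1ℚ
1/suc≤1 k = by (0≤ι k ⊗ 0≤/ 1 k) (trans (sym (ι-inverse k)) (trans (cong (_* (+ 1 / suc k)) (ι-suc k)) (eq (ι k) (+ 1 / suc k))))
  where
  eq : ∀ k r → (1ℚ + k) * r ≡ r + k * r
  eq = solve-∀ ℚ-ring

-- From x^k/k! ≤ x^k and the geometric series: this is e^x ≤ 1/(1-x), valid for every partial sum.
-- At x = p it later allows p to stand in for log(1/(1-p)).
expSum-geometric : ∀ {x} → 0ℚ ≤ x → x ≤ 1ℚ → ∀ n → expSum x n * (1ℚ - x) ≤ 1ℚ
expSum-geometric {x} 0≤x x≤1 n = ℚ.≤-trans (go n) (by (0≤^ 0≤x (suc n)) (eq₁ (x ^ suc n)))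
  where
  eq₁ : ∀ p → 1ℚ ≡ 1ℚ - p + p
  eq₁ = solve-∀ ℚ-ring
  term : ∀ k → expTerm x k ≤ x ^ k
  term zero    = ℚ.≤-refl
  term (suc k) = ℚ.≤-trans (*-mono (0≤expTerm 0≤x k ⊗ 0≤x) 0≤1 (*-monoʳ 0≤x (term k)) (1/suc≤1 k))
    (ℚ.≤-reflexive (trans (ℚ.*-identityʳ _) (ℚ.*-comm (x ^ k) x)))
  go : ∀ n → expSum x n * (1ℚ - x) ≤ 1ℚ - x ^ suc n
  go zero    = ℚ.≤-reflexive (eq x)
    where
    eq : ∀ x → 1ℚ * (1ℚ - x) ≡ 1ℚ - x * 1ℚ
    eq = solve-∀ ℚ-ring
  go (suc n) = by (diff (go n) ⊕ diff (*-monoʳ (diff x≤1) (term (suc n))))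
    (eq (expSum x n) (expTerm x (suc n)) x (x ^ suc n))
    where
    eq : ∀ s t x p → 1ℚ - x * p ≡ (s + t) * (1ℚ - x) + (1ℚ - p - s * (1ℚ - x) + (p * (1ℚ - x) - t * (1ℚ - x)))
    eq = solve-∀ ℚ-ring

module _ (b : ℕ) where
  private
    c = suc b
    -- From index 2c on, consecutive terms at u ≤ c have ratio at most c/(2c) = 1/2.
    k₀ = c ℕ.+ c

    halving : ∀ {u} → 0ℚ ≤ u → u ≤ ι c → ∀ k → k₀ ℕ.≤ suc k → expTerm u (suc k) + expTerm u (suc k) ≤ expTerm u k
    halving {u} 0≤u u≤c k k₀≤ = cancelˡ (0<1+ι b) (ℚ.≤-trans (ℚ.≤-reflexive eq₁)
      (ℚ.≤-trans (*-monoʳ (0≤expTerm 0≤u (suc k)) (ι-mono k₀≤))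
      (ℚ.≤-trans (ℚ.≤-reflexive (expTerm-suc u k)) (*-monoʳ (0≤expTerm 0≤u k) u≤c))))
      where
      eq : ∀ c a → c * (a + a) ≡ (c + c) * a
      eq = solve-∀ ℚ-ring
      eq₁ : ι c * (expTerm u (suc k) + expTerm u (suc k)) ≡ ι k₀ * expTerm u (suc k)
      eq₁ = trans (eq (ι c) (expTerm u (suc k))) (cong (_* expTerm u (suc k)) (sym (ι-+ c c)))

    -- Halving would give a factor 2^(-j). The weaker 1/(j + 1) passes through the induction because
    -- j + 2 ≤ 2 (j + 1), and it is the form that `archimedean-*` can make small.
    decay : ∀ {u} → 0ℚ ≤ u → u ≤ ι c → ∀ j → ι (suc j) * expTerm u (j ℕ.+ k₀) ≤ expTerm (ι c) k₀
    decay {u} 0≤u u≤c zero = ℚ.≤-trans (ℚ.≤-reflexive (ℚ.*-identityˡ _)) (expTerm-mono 0≤u u≤c k₀)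
    decay {u} 0≤u u≤c (suc j) = ℚ.≤-trans {ι (suc (suc j)) * a'} {ι (suc j) * expTerm u (j ℕ.+ k₀)}
      (by (0≤ι j ⊗ a≥0 ⊕ diff (*-monoˡ (0≤ι (suc j)) (halving 0≤u u≤c (j ℕ.+ k₀) (ℕₚ.m≤n⇒m≤1+n (ℕₚ.m≤n+m k₀ j)))))
        (eq (ι (suc j)) (ι (suc (suc j))) (ι j) a' (expTerm u (j ℕ.+ k₀)) (ι-suc j) (ι-suc (suc j))))
      (decay 0≤u u≤c j)
      where
      a' = expTerm u (suc (j ℕ.+ k₀))
      a≥0 : 0ℚ ≤ a'
      a≥0 = 0≤expTerm 0≤u (suc j ℕ.+ k₀)
      eq : ∀ j₁ j₂ j a b → j₁ ≡ 1ℚ + j → j₂ ≡ 1ℚ + j₁ → j₁ * b ≡ j₂ * a + (j * a + (j₁ * b - j₁ * (a + a)))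
      eq _ _ j a b refl refl = solve (j ∷ a ∷ b ∷ []) ℚ-ring

    -- Each term is at least twice the next, so adding the last term to the partial sum once more
    -- gives a nonincreasing sequence. The tail after m is therefore at most the term at m.
    telescope : ∀ {u} → 0ℚ ≤ u → u ≤ ι c → ∀ {m n} → k₀ ℕ.≤ m → m ℕ.≤′ n → expSum u n + expTerm u n ≤ expSum u m + expTerm u m
    telescope 0≤u u≤c k₀≤m (ℕ.≤′-reflexive refl) = ℚ.≤-refl
    telescope {u} 0≤u u≤c {m} k₀≤m (ℕ.≤′-step {n} m≤n) = ℚ.≤-trans
      (by (diff (halving 0≤u u≤c n (ℕₚ.m≤n⇒m≤1+n (ℕₚ.≤-trans k₀≤m (ℕₚ.≤′⇒≤ m≤n))))) (eq (expSum u n) (expTerm u n) (expTerm u (suc n))))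
      (telescope 0≤u u≤c k₀≤m m≤n)
      where
      eq : ∀ s a t → s + a ≡ s + t + t + (a - (t + t))
      eq = solve-∀ ℚ-ring

    term-small : ∀ {u ε} j → 0ℚ ≤ u → u ≤ ι c → 0ℚ ≤ ε → expTerm (ι c) k₀ ≤ ε * ι j → ∀ i → j ℕ.≤ i → expTerm u (i ℕ.+ k₀) ≤ ε
    term-small {u} {ε} j 0≤u u≤c 0≤ε h i j≤i = cancelˡ {expTerm u (i ℕ.+ k₀)} {ε} {ι (suc i)} (0<1+ι i) bound
      where
      bound : ι (suc i) * expTerm u (i ℕ.+ k₀) ≤ ι (suc i) * ε
      bound = ℚ.≤-trans (decay 0≤u u≤c i) (ℚ.≤-trans h
        (ℚ.≤-trans (*-monoˡ {ι j} {ι (suc i)} {ε} 0≤ε (ι-mono (ℕₚ.m≤n⇒m≤1+n j≤i))) (ℚ.≤-reflexive (ℚ.*-comm ε (ι (suc i))))))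

  expSum-tail-ι : ∀ {ε} → 0ℚ < ε → ∃[ K ] ∀ {u m n} → 0ℚ ≤ u → u ≤ ι c → K ℕ.≤ m → m ℕ.≤ n → expSum u n ≤ expSum u m + ε
  expSum-tail-ι {ε} 0<ε = j ℕ.+ k₀ , tail
    where
    j : ℕ
    j = proj₁ (archimedean-* 0<ε (expTerm (ι c) k₀))
    eq : ∀ s a s' a' e → s' + e ≡ s + (s' + a' - (s + a) + (e - a') + a)
    eq = solve-∀ ℚ-ring
    tail : ∀ {u m n} → 0ℚ ≤ u → u ≤ ι c → j ℕ.+ k₀ ℕ.≤ m → m ℕ.≤ n → expSum u n ≤ expSum u m + ε
    tail {u} {m} {n} 0≤u u≤c K≤m m≤n =
      by (diff (telescope 0≤u u≤c k₀≤m (ℕₚ.≤⇒≤′ m≤n)) ⊕ diff small ⊕ 0≤expTerm 0≤u n)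
         (eq (expSum u n) (expTerm u n) (expSum u m) (expTerm u m) ε)
      where
      k₀≤m : k₀ ℕ.≤ m
      k₀≤m = ℕₚ.≤-trans (ℕₚ.m≤n+m k₀ j) K≤m
      j≤ : j ℕ.≤ m ℕ.∸ k₀
      j≤ = ℕₚ.≤-trans (ℕₚ.≤-reflexive (sym (ℕₚ.m+n∸n≡m j k₀))) (ℕₚ.∸-monoˡ-≤ k₀ K≤m)
      small : expTerm u m ≤ ε
      small = subst (λ k → expTerm u k ≤ ε) (ℕₚ.m∸n+n≡m k₀≤m)
        (term-small j 0≤u u≤c (ℚ.<⇒≤ 0<ε) (proj₂ (archimedean-* 0<ε (expTerm (ι c) k₀))) (m ℕ.∸ k₀) j≤)

expSum-tail : ∀ B {ε} → 0ℚ < ε → ∃[ K ] ∀ {u m n} → 0ℚ ≤ u → u ≤ B → K ℕ.≤ m → m ℕ.≤ n → expSum u n ≤ expSum u m + ε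
expSum-tail B 0<ε = let (b , B≤b) = archimedean B; (K , h) = expSum-tail-ι b 0<ε in
  K , λ 0≤u u≤B → h 0≤u (ℚ.≤-trans u≤B (ℚ.≤-trans B≤b (ι-mono (ℕₚ.n≤1+n b))))

-- Eventual properties, and bounds on an argument read off its exponential

Eventually : (ℕ → Set) → Set
Eventually P = ∃[ K ] ∀ n → K ℕ.≤ n → P n

infixr 5 _⊓_
_⊓_ : ∀ {P Q} → Eventually P → Eventually Q → Eventually (λ n → P n × Q n)
(K , p) ⊓ (L , q) = K ℕ.⊔ L , λ n h → p n (ℕₚ.≤-trans (ℕₚ.m≤m⊔n K L) h) , q n (ℕₚ.≤-trans (ℕₚ.m≤n⊔m K L) h)

ev-map : ∀ {P Q} → (∀ n → P n → Q n) → Eventually P → Eventually Q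
ev-map f (K , p) = K , λ n h → f n (p n h)

½ : ℚ
½ = + 1 / 2

-- Contrapositive: a small argument has a small exponential. The range 0 ≤ z < δ is excluded by the
-- geometric bound. For z = -y < 0, E(-y) ≤ E(-y) E(y) ≤ 1 + E(y)² - E(2y), and E(y)² exceeds E(2y)
-- by at most a tail of the series at 2y. That tail is small uniformly only for bounded y, hence the
-- lower bound -B.
expSum-sign : ∀ {z : Seq} {B δ} → 0ℚ < δ → δ ≤ ½ → Eventually (λ n → - B ≤ z n) →
  Eventually (λ n → 1ℚ + (δ + δ) ≤ expSum (z n) n) → Eventually (λ n → δ ≤ z n)
expSum-sign {z} {B} {δ} 0<δ δ≤½ bounded large =
  ev-map (λ n (b , l , K≤n) → go n b l K≤n) (bounded ⊓ large ⊓ (proj₁ tail , λ _ h → h))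
  where
  0≤δ = ℚ.<⇒≤ 0<δ
  tail = expSum-tail (B + B) 0<δ
  1+2δ>1+δ : ¬ (1ℚ + (δ + δ) ≤ 1ℚ + δ)
  1+2δ>1+δ h = <⇒≱ 0<δ (by (diff h) (eq δ))
    where
    eq : ∀ d → 0ℚ ≡ d + (1ℚ + d - (1ℚ + (d + d)))
    eq = solve-∀ ℚ-ring
  go : ∀ n → - B ≤ z n → 1ℚ + (δ + δ) ≤ expSum (z n) n → proj₁ tail ℕ.≤ n → δ ≤ z n
  go n -B≤z l K≤n with δ ℚ.≤? z n | 0ℚ ℚ.≤? z n
  ... | yes h | _ = h
  -- Here (1 + 2δ)(1 - z) ≤ 1, so z ≥ 2δ/(1 + 2δ), which is at least δ because δ ≤ 1/2.
  ... | no δ≰z | yes 0≤z = ⊥-elim (<⇒≱ z<δ (cancelˡ (ℚ.<-≤-trans (ℚ.positive⁻¹ 1ℚ) (by (0≤δ ⊕ 0≤δ) refl))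
      (by (diff (ℚ.≤-trans (*-monoʳ (diff z≤1) l) (expSum-geometric 0≤z z≤1 n)) ⊕ 2δ ⊗ diff δ≤½) (eq δ (z n)))))
    where
    z<δ = ℚ.≰⇒> δ≰z
    2δ : 0ℚ ≤ δ + δ
    2δ = 0≤δ ⊕ 0≤δ
    z≤1 : z n ≤ 1ℚ
    z≤1 = ℚ.≤-trans (ℚ.<⇒≤ z<δ) (ℚ.≤-trans δ≤½ (by (0≤/ 1 1) refl))
    eq : ∀ d z → (1ℚ + (d + d)) * z ≡ (1ℚ + (d + d)) * d + (1ℚ - (1ℚ + (d + d)) * (1ℚ - z) + (d + d) * (½ - d))
    eq = solve-∀ ℚ-ring
  ... | no _ | no 0≰z = ⊥-elim (1+2δ>1+δ (ℚ.≤-trans l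
      (by (diff (expSum-neg-* 0≤y n) ⊕ diff (expSum-double 0≤y n) ⊕ diff (proj₂ tail (0≤y ⊕ 0≤y) (ℚ.+-mono-≤ y≤B y≤B) K≤n (ℕₚ.m≤m+n n n))
            ⊕ (ℚ.≤-trans (0≤1 ⊕ 0≤δ ⊕ 0≤δ) (ℚ.≤-trans (ℚ.≤-reflexive (ℚ.+-assoc 1ℚ δ δ)) l) ⊗ diff (1≤expSum 0≤y n)))
          (eq (expSum (- y) n) (expSum y n) (expSum (y + y) n) (expSum (y + y) (n ℕ.+ n)) δ (expSum (z n) n) (cong (λ x → expSum x n) neg-y)))))
    where
    y = - z n
    neg-y : - y ≡ z n
    neg-y = neg-involutive (z n)
      where
      neg-involutive : ∀ x → - (- x) ≡ x
      neg-involutive = solve-∀ ℚ-ring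
    0≤y : 0ℚ ≤ y
    0≤y = ℚ.neg-antimono-≤ (ℚ.<⇒≤ (ℚ.≰⇒> 0≰z))
    y≤B : y ≤ B
    y≤B = by (diff -B≤z) (eq B (z n))
      where
      eq : ∀ B z → B ≡ - z + (z - (- B))
      eq = solve-∀ ℚ-ring
    eq : ∀ m e e₂ e₄ d z → m ≡ z →
      1ℚ + d ≡ z + (1ℚ + (e * e - e₂) - m * e + (e₄ - e * e) + (e₂ + d - e₄) + z * (e - 1ℚ))
    eq m e e₂ e₄ d _ refl = solve (m ∷ e ∷ e₂ ∷ e₄ ∷ d ∷ []) ℚ-ring

exp1-≥ : ∀ n → 3 ℕ.≤ n → + 8 / 3 ≤ expSum 1ℚ n
exp1-≥ n 3≤n = ℚ.≤-trans (ℚ.≤ᵇ⇒≤ {+ 8 / 3} {expSum 1ℚ 3} _) (expSum-mono-index {1ℚ} 0≤1 {3} {n} 3≤n)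

-- Raising E_n(β) s ≤ 1 + ε to the power d gives 25 t² s^d ≤ (1 + ε)^d, and dε ≤ 1/25 keeps (1 +
-- ε)^d below 25/24. Squaring E_m(x) doubles the index, hence n ≥ 2m.
exp-growth : ∀ {β x s ε t} d m n → 0ℚ ≤ β → 0ℚ ≤ x → 0ℚ ≤ s → 0ℚ ≤ ε → 0ℚ ≤ t →
  expSum β n * s ≤ 1ℚ + ε → x + x ≤ ι d * β → m ℕ.+ m ℕ.≤ n → ι 5 * t ≤ expSum x m →
  ι 25 * (ι d * ε) ≤ 1ℚ → ι 24 * (t * t) * s ^ d ≤ 1ℚ
exp-growth {β} {x} {s} {ε} {t} d m n 0≤β 0≤x 0≤s 0≤ε 0≤t Es≤ 2x≤ 2m≤n 5t≤E dε≤ =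
  ℚ.≤-trans (by (diff (*-monoʳ 0≤c scaled) ⊕ (0≤/ 1 0 ⊗ (0≤t ⊗ 0≤t) ⊗ 0≤^ 0≤s d) ⊗ diff dε≤)
    (eq t (s ^ d) (ι d * ε) ((1ℚ + ε) ^ d)))
  (bernoulli-≤ 0≤ε d)
  where
  0≤c : 0ℚ ≤ 1ℚ - ι d * ε
  0≤c = by (0≤/ 24 24 ⊕ 0≤/ 1 24 ⊗ diff dε≤) (eq' (ι d * ε))
    where
    eq' : ∀ z → 1ℚ - z ≡ 0ℚ + (+ 24 / 25 + + 1 / 25 * (1ℚ - ι 25 * z))
    eq' = solve-∀ ℚ-ring
  scaled : ι 25 * (t * t) * s ^ d ≤ (1ℚ + ε) ^ d
  scaled = ℚ.≤-trans (*-monoʳ (0≤^ 0≤s d) (ℚ.≤-trans (ℚ.≤-reflexive (eq₁ t))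
     (ℚ.≤-trans (*-mono (0≤/ 5 0 ⊗ 0≤t) (ℚ.≤-trans 0≤1 (1≤expSum 0≤x m)) 5t≤E 5t≤E)
     (ℚ.≤-trans (expSum-double 0≤x m) (ℚ.≤-trans (expSum-mono-index (0≤x ⊕ 0≤x) 2m≤n)
     (ℚ.≤-trans (expSum-mono (0≤x ⊕ 0≤x) 2x≤ n) (expSum-*-≤ 0≤β d n)))))))
     (ℚ.≤-trans (ℚ.≤-reflexive (sym (^-distrib-* (expSum β n) s d)))
       (^-mono (ℚ.≤-trans 0≤1 (1≤expSum 0≤β n) ⊗ 0≤s) Es≤ d))
    where
    eq₁ : ∀ t → ι 25 * (t * t) ≡ ι 5 * t * (ι 5 * t)
    eq₁ = solve-∀ ℚ-ring
  eq : ∀ t q z w → w * (1ℚ - z) ≡ ι 24 * (t * t) * q + (w * (1ℚ - z) - ι 25 * (t * t) * q * (1ℚ - z) + ι 1 * (t * t) * q * (1ℚ - ι 25 * z))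
  eq = solve-∀ ℚ-ring

-- Linear programming duality over ℚ

∑-mono : ∀ {n} {f g : Fin n → ℚ} → (∀ i → f i ≤ g i) → ∑ f ≤ ∑ g
∑-mono {zero}  f≤g = ℚ.≤-refl
∑-mono {suc n} f≤g = ℚ.+-mono-≤ (f≤g zero) (∑-mono (f≤g ∘ suc))

0≤∑ : ∀ {n} {f : Fin n → ℚ} → (∀ i → 0ℚ ≤ f i) → 0ℚ ≤ ∑ f
0≤∑ {zero}  0≤f = ℚ.≤-refl
0≤∑ {suc n} 0≤f = 0≤f zero ⊕ 0≤∑ (0≤f ∘ suc)

∑-zero : ∀ {n} {f : Fin n → ℚ} → (∀ i → f i ≡ 0ℚ) → ∑ f ≡ 0ℚ
∑-zero {zero}  f≡0 = refl
∑-zero {suc n} f≡0 = trans (cong₂ _+_ (f≡0 zero) (∑-zero (f≡0 ∘ suc))) refl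

∑-splitAt : ∀ m {n} (f : Fin (m ℕ.+ n) → ℚ) → ∑ f ≡ ∑ (λ i → f (i ↑ˡ n)) + ∑ (λ j → f (m ↑ʳ j))
∑-splitAt zero    f = sym (ℚ.+-identityˡ _)
∑-splitAt (suc m) f = trans (cong (λ ζ → f zero + ζ) (∑-splitAt m (f ∘ suc))) (sym (ℚ.+-assoc (f zero) _ _))

∑-exchange : ∀ {m n} (u : Fin m → ℚ) (M : Fin m → Fin n → ℚ) (v : Fin n → ℚ) →
  ∑ (λ i → u i * ∑ (λ j → M i j * v j)) ≡ ∑ (λ j → ∑ (λ i → u i * M i j) * v j)
∑-exchange u M v = trans (∑-cong (λ i → *-distribˡ-sum (u i) (λ j → M i j * v j)))
  (trans (∑-comm (λ i j → u i * (M i j * v j)))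
  (∑-cong (λ j → trans (∑-cong (λ i → sym (ℚ.*-assoc (u i) (M i j) (v j)))) (sym (*-distribʳ-sum (v j) (λ i → u i * M i j))))))

Constraint : ℕ → Set
Constraint n = (Fin n → ℚ) × ℚ

dot : ∀ {n} → (Fin n → ℚ) → (Fin n → ℚ) → ℚ
dot a x = ∑ (λ i → a i * x i)

Satisfies : ∀ {n} → (Fin n → ℚ) → Constraint n → Set
Satisfies x (a , b) = dot a x ≤ b

infixl 6 _⊞_
infixl 7 _⊠_
_⊞_ : ∀ {n} → Constraint n → Constraint n → Constraint n
(a , b) ⊞ (a' , b') = (λ i → a i + a' i) , b + b'

_⊠_ : ∀ {n} → ℚ → Constraint n → Constraint n
k ⊠ (a , b) = (λ i → k * a i) , k * b

-- Nonnegative combinations are kept as derivations; numerical multipliers are read off once, in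
-- `multipliers`.
data Cone {n} (Cs : List (Constraint n)) : Constraint n → Set where
  gen   : ∀ {c} → c ∈ₗ Cs → Cone Cs c
  add   : ∀ {c c'} → Cone Cs c → Cone Cs c' → Cone Cs (c ⊞ c')
  scale : ∀ {k c} → 0ℚ ≤ k → Cone Cs c → Cone Cs (k ⊠ c)

-- Fourier–Motzkin elimination of the variable 0, for constraints on
-- nonnegative variables.
module Elimination {n} (Cs : List (Constraint (suc n))) where
  head₀ : Constraint (suc n) → ℚ
  head₀ (a , _) = a zero

  tail₀ : Constraint (suc n) → Constraint n
  tail₀ (a , b) = a ∘ suc , b

  combine : Constraint (suc n) → Constraint (suc n) → Constraint n
  combine c c' = tail₀ ((- head₀ c') ⊠ c ⊞ head₀ c ⊠ c')

  NonNeg? = λ c → 0ℚ ℚ.≤? head₀ c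
  Pos?    = λ c → 0ℚ ℚ.<? head₀ c
  Neg?    = λ c → head₀ c ℚ.<? 0ℚ

  nonnegs poss negs : List (Constraint (suc n))
  nonnegs = List.filter NonNeg? Cs
  poss    = List.filter Pos? Cs
  negs    = List.filter Neg? Cs

  -- Dropping a nonnegative leading coefficient amounts to combining the constraint with -x₀ ≤ 0. In
  -- this way the nonnegativity of the variables enters without being listed among the constraints.
  eliminate : List (Constraint n)
  eliminate = List.map tail₀ nonnegs List.++ List.cartesianProductWith combine poss negs

  -- The leading coefficient may stay positive: on nonnegative variables a certificate needs
  -- nonnegative coefficients, not vanishing ones.
  lift-cone : ∀ {c} → Cone eliminate c → ∃[ c' ] (0ℚ ≤ head₀ c' × tail₀ c' ≡ c × Cone Cs c')
  lift-cone (gen c∈) with ∈-++⁻ (List.map tail₀ nonnegs) c∈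
  ... | inj₁ c∈map = let (c' , c'∈ , eq) = ∈-map⁻ tail₀ c∈map; (c'∈Cs , 0≤) = ∈-filter⁻ NonNeg? c'∈ in
    c' , 0≤ , sym eq , gen c'∈Cs
  ... | inj₂ c∈prod with ∈-cartesianProductWith⁻ combine poss negs c∈prod
  ... | p , q , p∈ , q∈ , eq = let (p∈Cs , 0<p) = ∈-filter⁻ Pos? p∈; (q∈Cs , q<0) = ∈-filter⁻ Neg? q∈ in
    (- head₀ q) ⊠ p ⊞ head₀ p ⊠ q , ℚ.≤-reflexive (cancel (head₀ p) (head₀ q)) , sym eq ,
    add (scale (ℚ.neg-antimono-≤ (ℚ.<⇒≤ q<0)) (gen p∈Cs)) (scale (ℚ.<⇒≤ 0<p) (gen q∈Cs))
    where
    cancel : ∀ p q → 0ℚ ≡ - q * p + p * q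
    cancel = solve-∀ ℚ-ring
  lift-cone (add u v) with lift-cone u | lift-cone v
  ... | c , 0≤c , refl , C | d , 0≤d , refl , D = c ⊞ d , 0≤c ⊕ 0≤d , refl , add C D
  lift-cone (scale {k} 0≤k u) with lift-cone u
  ... | c , 0≤c , refl , C = k ⊠ c , 0≤k ⊗ 0≤c , refl , scale 0≤k C

  module _ (x : Fin n → ℚ) (sat : ∀ {c} → c ∈ₗ eliminate → Satisfies x c) where
    slack : Constraint (suc n) → ℚ
    slack c = proj₂ c - dot (proj₁ c ∘ suc) x

    -- x₀ is the running maximum of 0 and of the lower bounds slack q / q₀.
    above : ∀ (qs : List (Constraint (suc n))) → (∀ {q} → q ∈ₗ qs → q ∈ₗ negs) →
      ∃[ x₀ ] (0ℚ ≤ x₀ × (∀ {q} → q ∈ₗ qs → head₀ q * x₀ ≤ slack q) × (∀ {p} → p ∈ₗ poss → head₀ p * x₀ ≤ slack p))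
    above [] _ = 0ℚ , ℚ.≤-refl , (λ ()) , λ {p} p∈ → let (p∈Cs , 0<p) = ∈-filter⁻ Pos? {xs = Cs} p∈ in
      ℚ.≤-trans (ℚ.≤-reflexive (ℚ.*-zeroʳ (head₀ p)))
        (diff (sat (∈-++⁺ˡ (∈-map⁺ tail₀ (∈-filter⁺ NonNeg? p∈Cs (ℚ.<⇒≤ 0<p))))))
    above (q ∷ qs) ⊆negs with above qs (⊆negs ∘ there)
    ... | x₀ , 0≤x₀ , lo , hi with (head₀ q * x₀) ℚ.≤? slack q
    ... | yes h = x₀ , 0≤x₀ , (λ { (here refl) → h ; (there q∈) → lo q∈ }) , hi
    ... | no ¬h = y , ℚ.≤-trans 0≤x₀ x₀≤y , (λ { (here refl) → ℚ.≤-reflexive qy≡ ; {q'} (there q'∈) →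
                    ℚ.≤-trans (neg-mono {head₀ q'} (proj₂ (∈-filter⁻ Neg? {xs = Cs} (⊆negs (there q'∈)))) x₀≤y) (lo q'∈) }) , hi'
      where
      r = - head₀ q
      q<0 : head₀ q < 0ℚ
      q<0 = proj₂ (∈-filter⁻ Neg? {xs = Cs} (⊆negs (here refl)))
      0<r : 0ℚ < r
      0<r = ℚ.neg-antimono-< q<0
      y = - slack q * recip r
      ry≡ : r * y ≡ - slack q
      ry≡ = trans (eq r (slack q) (recip r)) (trans (cong (_* (- slack q)) (recip-inverse 0<r)) (ℚ.*-identityˡ _))
        where
        eq : ∀ r s i → r * (- s * i) ≡ r * i * (- s)
        eq = solve-∀ ℚ-ring
      qy≡ : head₀ q * y ≡ slack q
      qy≡ = trans (eq (head₀ q) y) (trans (cong -_ ry≡) (eq' (slack q)))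
        where
        eq : ∀ q y → q * y ≡ - (- q * y)
        eq = solve-∀ ℚ-ring
        eq' : ∀ s → - (- s) ≡ s
        eq' = solve-∀ ℚ-ring
      neg-mono : ∀ {a u v} → a < 0ℚ → u ≤ v → a * v ≤ a * u
      neg-mono {a} {u} {v} a<0 u≤v = by (ℚ.neg-antimono-≤ (ℚ.<⇒≤ a<0) ⊗ diff u≤v) (eq a u v)
        where
        eq : ∀ a u v → a * u ≡ a * v + - a * (v - u)
        eq = solve-∀ ℚ-ring
      x₀≤y : x₀ ≤ y
      x₀≤y = cancelˡ 0<r (ℚ.≤-trans (by (diff (ℚ.<⇒≤ (ℚ.≰⇒> ¬h))) (eq (head₀ q) x₀ (slack q))) (ℚ.≤-reflexive (sym ry≡)))
        where
        eq : ∀ q x s → - s ≡ - q * x + (q * x - s)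
        eq = solve-∀ ℚ-ring
      -- The upper bound from p survives raising x₀ to y because the combination of p with q belongs
      -- to `eliminate`.
      hi' : ∀ {p} → p ∈ₗ poss → head₀ p * y ≤ slack p
      hi' {p} p∈ = cancelˡ 0<r (by (diff (sat (∈-++⁺ʳ (List.map tail₀ nonnegs) (∈-cartesianProductWith⁺ combine p∈ (⊆negs (here refl))))))
        (trans (eq (head₀ p) r (proj₂ p) (dot (proj₁ p ∘ suc) x) (proj₂ q) (dot (proj₁ q ∘ suc) x) y ry≡)
          (cong (λ z → r * (head₀ p * y) + (r * proj₂ p + head₀ p * proj₂ q - z)) (sym (dot-combine p q)))))
        where
        eq : ∀ p r b d b' d' y → r * y ≡ - (b' - d') → r * (b - d) ≡ r * (p * y) + (r * b + p * b' - (r * d + p * d'))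
        eq p r b d b' d' y h = trans (eq₁ p r b d b' d') (trans (cong (λ z → p * z + (r * b + p * b' - (r * d + p * d'))) (sym h)) (eq₂ p r y _))
          where
          eq₁ : ∀ p r b d b' d' → r * (b - d) ≡ p * (- (b' - d')) + (r * b + p * b' - (r * d + p * d'))
          eq₁ = solve-∀ ℚ-ring
          eq₂ : ∀ p r y z → p * (r * y) + z ≡ r * (p * y) + z
          eq₂ = solve-∀ ℚ-ring
        dot-combine : ∀ p q → dot (proj₁ (combine p q)) x ≡ (- head₀ q) * dot (proj₁ p ∘ suc) x + head₀ p * dot (proj₁ q ∘ suc) x
        dot-combine p q = trans (∑-cong (λ i → eq₃ (- head₀ q) (head₀ p) (proj₁ p (suc i)) (proj₁ q (suc i)) (x i)))
          (trans (∑-distrib-+ (λ i → - head₀ q * (proj₁ p (suc i) * x i)) (λ i → head₀ p * (proj₁ q (suc i) * x i))) (sym (cong₂ _+_ (*-distribˡ-sum (- head₀ q) (λ i → proj₁ p (suc i) * x i)) (*-distribˡ-sum (head₀ p) (λ i → proj₁ q (suc i) * x i)))))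
          where
          eq₃ : ∀ r p a b x → (r * a + p * b) * x ≡ r * (a * x) + p * (b * x)
          eq₃ = solve-∀ ℚ-ring

    extend : ∃[ x₀ ] (0ℚ ≤ x₀ × (∀ {c} → c ∈ₗ Cs → head₀ c * x₀ + dot (proj₁ c ∘ suc) x ≤ proj₂ c))
    extend with above negs id
    ... | x₀ , 0≤x₀ , lo , hi = x₀ , 0≤x₀ , λ {c} c∈ → unslack c (bound c c∈)
      where
      unslack : ∀ c → head₀ c * x₀ ≤ slack c → head₀ c * x₀ + dot (proj₁ c ∘ suc) x ≤ proj₂ c
      unslack c h = by (diff h) (eq (head₀ c * x₀) (proj₂ c) (dot (proj₁ c ∘ suc) x))
        where
        eq : ∀ h b d → b ≡ h + d + (b - d - h)
        eq = solve-∀ ℚ-ring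
      bound : ∀ c → c ∈ₗ Cs → head₀ c * x₀ ≤ slack c
      bound c c∈ with head₀ c ℚ.<? 0ℚ | 0ℚ ℚ.<? head₀ c
      ... | yes c<0 | _ = lo (∈-filter⁺ Neg? c∈ c<0)
      ... | no _ | yes 0<c = hi (∈-filter⁺ Pos? c∈ 0<c)
      ... | no c≮0 | no 0≮c = ℚ.≤-trans (ℚ.≤-reflexive (trans (cong (_* x₀) (ℚ.≤-antisym (ℚ.≮⇒≥ 0≮c) (ℚ.≮⇒≥ c≮0))) (ℚ.*-zeroˡ x₀)))
        (diff (sat (∈-++⁺ˡ (∈-map⁺ tail₀ (∈-filter⁺ NonNeg? c∈ (ℚ.≮⇒≥ c≮0))))))

-- The second alternative certifies infeasibility: a nonnegative form would have to be bounded by a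
-- negative number. With no variables left, a constraint only states the sign of its bound.
farkas : ∀ {n} (Cs : List (Constraint n)) →
  (∃[ x ] ((∀ i → 0ℚ ≤ x i) × (∀ {c} → c ∈ₗ Cs → Satisfies x c))) ⊎
  (∃[ c ] ((∀ i → 0ℚ ≤ proj₁ c i) × proj₂ c < 0ℚ × Cone Cs c))
farkas {zero} []  = inj₁ ((λ ()) , (λ ()) , λ ())
farkas {zero} (c ∷ Cs) with proj₂ c ℚ.<? 0ℚ | farkas Cs
... | yes b<0 | _ = inj₂ (c , (λ ()) , b<0 , gen (here refl))
... | no b≮0 | inj₁ (x , 0≤x , sat) = inj₁ (x , 0≤x , λ { (here refl) → ℚ.≮⇒≥ b≮0 ; (there c∈) → sat c∈ })
... | no _ | inj₂ (d , 0≤d , b<0 , D) = inj₂ (d , 0≤d , b<0 , weaken D)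
  where
  weaken : ∀ {d} → Cone Cs d → Cone (c ∷ Cs) d
  weaken (gen d∈)      = gen (there d∈)
  weaken (add u v)     = add (weaken u) (weaken v)
  weaken (scale 0≤k u) = scale 0≤k (weaken u)
farkas {suc n} Cs with farkas (Elimination.eliminate Cs)
... | inj₁ (x , 0≤x , sat) = let (x₀ , 0≤x₀ , h) = Elimination.extend Cs x sat in
  inj₁ ((λ { zero → x₀ ; (suc i) → x i }) , (λ { zero → 0≤x₀ ; (suc i) → 0≤x i }) , h)
... | inj₂ (c , 0≤c , b<0 , C) with Elimination.lift-cone Cs C
... | c' , 0≤c' , refl , C' = inj₂ (c' , (λ { zero → 0≤c' ; (suc i) → 0≤c i }) , b<0 , C')

δ : ∀ {n} → Fin n → Fin n → ℚ
δ zero    zero    = 1ℚ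
δ zero    (suc _) = 0ℚ
δ (suc _) zero    = 0ℚ
δ (suc i) (suc j) = δ i j

0≤δ : ∀ {n} (i j : Fin n) → 0ℚ ≤ δ i j
0≤δ zero    zero    = 0≤1
0≤δ zero    (suc _) = ℚ.≤-refl
0≤δ (suc _) zero    = ℚ.≤-refl
0≤δ (suc i) (suc j) = 0≤δ i j

∑-δ : ∀ {n} i (f : Fin n → ℚ) → ∑ (λ j → δ i j * f j) ≡ f i
∑-δ zero    f = trans (cong₂ _+_ (ℚ.*-identityˡ (f zero)) (∑-zero (λ j → ℚ.*-zeroˡ (f (suc j))))) (ℚ.+-identityʳ _)
∑-δ (suc i) f = trans (cong₂ _+_ (ℚ.*-zeroˡ (f zero)) (∑-δ i (f ∘ suc))) (ℚ.+-identityˡ _)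

module Duality {m n} (M : Fin m → Fin n → ℚ) (b : Fin m → ℚ) (c : Fin n → ℚ)
  (0≤c : ∀ j → 0ℚ ≤ c j) (x⁰ : Fin n → ℚ) (0≤x⁰ : ∀ j → 0ℚ ≤ x⁰ j) (Mx⁰≥b : ∀ i → b i ≤ ∑ (λ j → M i j * x⁰ j)) where

  infix 5 _∣_
  _∣_ : (Fin n → ℚ) → (Fin m → ℚ) → Fin (n ℕ.+ m) → ℚ
  (α ∣ β) = [ α , β ]′ ∘ splitAt n

  primal : Fin m → Constraint (n ℕ.+ m)
  primal i = ((λ j → - M i j) ∣ (λ _ → 0ℚ)) , - b i

  dual : Fin n → Constraint (n ℕ.+ m)
  dual j = ((λ _ → 0ℚ) ∣ (λ i → M i j)) , c j

  gap : Constraint (n ℕ.+ m)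
  gap = (c ∣ (λ i → - b i)) , 0ℚ

  -- A nonnegative solution is a pair of feasible points without duality gap, so strong duality
  -- turns into the feasibility of a single system.
  system : List (Constraint (n ℕ.+ m))
  system = List.tabulate primal List.++ List.tabulate dual List.++ gap ∷ []

  dot-∣ : ∀ α β x → dot (α ∣ β) x ≡ ∑ (λ j → α j * x (j ↑ˡ m)) + ∑ (λ i → β i * x (n ↑ʳ i))
  dot-∣ α β x = trans (∑-splitAt n (λ k → (α ∣ β) k * x k)) (cong₂ _+_
    (∑-cong (λ j → cong (λ s → [ α , β ]′ s * x (j ↑ˡ m)) (Fin.splitAt-↑ˡ n j m)))
    (∑-cong (λ i → cong (λ s → [ α , β ]′ s * x (n ↑ʳ i)) (Fin.splitAt-↑ʳ n m i))))

  -- A cone element in coordinates: u, v and z multiply the primal constraints, the dual constraints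
  -- and `gap`.
  record Multipliers (d : Constraint (n ℕ.+ m)) : Set where
    field
      u : Fin m → ℚ
      v : Fin n → ℚ
      z : ℚ
      0≤u : ∀ i → 0ℚ ≤ u i
      0≤v : ∀ j → 0ℚ ≤ v j
      0≤z : 0ℚ ≤ z
      left  : ∀ j → proj₁ d (j ↑ˡ m) ≡ z * c j - ∑ (λ i → u i * M i j)
      right : ∀ i → proj₁ d (n ↑ʳ i) ≡ ∑ (λ j → v j * M i j) - z * b i
      bound : proj₂ d ≡ ∑ (λ j → v j * c j) - ∑ (λ i → u i * b i)

  private
    zeroes : ∀ {k} (f : Fin k → ℚ) → ∑ (λ i → 0ℚ * f i) ≡ 0ℚ
    zeroes f = ∑-zero (λ i → ℚ.*-zeroˡ (f i))

    linear : ∀ {k} (u u' f : Fin k → ℚ) → ∑ (λ i → (u i + u' i) * f i) ≡ ∑ (λ i → u i * f i) + ∑ (λ i → u' i * f i)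
    linear u u' f = trans (∑-cong (λ i → ℚ.*-distribʳ-+ (f i) (u i) (u' i))) (∑-distrib-+ (λ i → u i * f i) (λ i → u' i * f i))

    homogeneous : ∀ {k} r (u f : Fin k → ℚ) → ∑ (λ i → r * u i * f i) ≡ r * ∑ (λ i → u i * f i)
    homogeneous r u f = trans (∑-cong (λ i → ℚ.*-assoc r (u i) (f i))) (sym (*-distribˡ-sum r (λ i → u i * f i)))

  multipliers : ∀ {d} → Cone system d → Multipliers d
  multipliers (gen d∈) with ∈-++⁻ (List.tabulate primal) d∈
  multipliers (gen d∈) | inj₁ d∈p with ∈-tabulate⁻ d∈p
  ... | i , refl = record
    { u = δ i ; v = λ _ → 0ℚ ; z = 0ℚ ; 0≤u = 0≤δ i ; 0≤v = λ _ → ℚ.≤-refl ; 0≤z = ℚ.≤-refl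
    ; left  = λ j → trans (cong [ (λ j → - M i j) , (λ _ → 0ℚ) ]′ (Fin.splitAt-↑ˡ n j m))
        (trans (eq (M i j) (c j)) (cong (λ s → 0ℚ * c j - s) (sym (∑-δ i (λ k → M k j)))))
    ; right = λ k → trans (cong [ (λ j → - M i j) , (λ _ → 0ℚ) ]′ (Fin.splitAt-↑ʳ n m k))
        (trans (eq' (b k)) (cong (_- 0ℚ * b k) (sym (zeroes (λ j → M k j)))))
    ; bound = trans (sym (ℚ.+-identityˡ (- b i))) (cong₂ _-_ (sym (zeroes c)) (sym (∑-δ i b)))
    }
    where
    eq : ∀ a c → - a ≡ 0ℚ * c - a
    eq = solve-∀ ℚ-ring
    eq' : ∀ b → 0ℚ ≡ 0ℚ - 0ℚ * b
    eq' = solve-∀ ℚ-ring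
  multipliers (gen d∈) | inj₂ d∈q with ∈-++⁻ (List.tabulate dual) d∈q
  multipliers (gen d∈) | inj₂ d∈q | inj₁ d∈d with ∈-tabulate⁻ d∈d
  ... | j , refl = record
    { u = λ _ → 0ℚ ; v = δ j ; z = 0ℚ ; 0≤u = λ _ → ℚ.≤-refl ; 0≤v = 0≤δ j ; 0≤z = ℚ.≤-refl
    ; left  = λ k → trans (cong [ (λ _ → 0ℚ) , (λ i → M i j) ]′ (Fin.splitAt-↑ˡ n k m))
        (trans (eq' (c k)) (cong (λ s → 0ℚ * c k - s) (sym (zeroes (λ i → M i k)))))
    ; right = λ i → trans (cong [ (λ _ → 0ℚ) , (λ i → M i j) ]′ (Fin.splitAt-↑ʳ n m i))
        (trans (eq (M i j) (b i)) (cong (_- 0ℚ * b i) (sym (∑-δ j (λ k → M i k)))))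
    ; bound = trans (eq'' (c j)) (cong₂ _-_ (sym (∑-δ j c)) (sym (zeroes b)))
    }
    where
    eq : ∀ a c → a ≡ a - 0ℚ * c
    eq = solve-∀ ℚ-ring
    eq' : ∀ c → 0ℚ ≡ 0ℚ * c - 0ℚ
    eq' = solve-∀ ℚ-ring
    eq'' : ∀ c → c ≡ c - 0ℚ
    eq'' = solve-∀ ℚ-ring
  multipliers (gen d∈) | inj₂ d∈q | inj₂ (here refl) = record
    { u = λ _ → 0ℚ ; v = λ _ → 0ℚ ; z = 1ℚ ; 0≤u = λ _ → ℚ.≤-refl ; 0≤v = λ _ → ℚ.≤-refl ; 0≤z = 0≤1
    ; left  = λ k → trans (cong [ c , (λ i → - b i) ]′ (Fin.splitAt-↑ˡ n k m))
        (trans (eq (c k)) (cong (λ s → 1ℚ * c k - s) (sym (zeroes (λ i → M i k)))))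
    ; right = λ i → trans (cong [ c , (λ i → - b i) ]′ (Fin.splitAt-↑ʳ n m i))
        (trans (eq' (b i)) (cong (_- 1ℚ * b i) (sym (zeroes (λ k → M i k)))))
    ; bound = cong₂ _-_ (sym (zeroes c)) (sym (zeroes b))
    }
    where
    eq : ∀ c → c ≡ 1ℚ * c - 0ℚ
    eq = solve-∀ ℚ-ring
    eq' : ∀ c → - c ≡ 0ℚ - 1ℚ * c
    eq' = solve-∀ ℚ-ring
  multipliers (add {d} {d'} C C') = record
    { u = λ i → U.u i + U'.u i ; v = λ j → U.v j + U'.v j ; z = U.z + U'.z
    ; 0≤u = λ i → U.0≤u i ⊕ U'.0≤u i ; 0≤v = λ j → U.0≤v j ⊕ U'.0≤v j ; 0≤z = U.0≤z ⊕ U'.0≤z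
    ; left = λ j → trans (cong₂ _+_ (U.left j) (U'.left j)) (trans (eq U.z U'.z (c j) (S U.u j) (S U'.u j))
        (cong (λ s → (U.z + U'.z) * c j - s) (sym (linear U.u U'.u (λ i → M i j)))))
    ; right = λ i → trans (cong₂ _+_ (U.right i) (U'.right i)) (trans (eq' U.z U'.z (b i) (S' U.v i) (S' U'.v i))
        (cong (λ s → s - (U.z + U'.z) * b i) (sym (linear U.v U'.v (λ j → M i j)))))
    ; bound = trans (cong₂ _+_ U.bound U'.bound) (trans
        (eq'' (∑ (λ j → U.v j * c j)) (∑ (λ i → U.u i * b i)) (∑ (λ j → U'.v j * c j)) (∑ (λ i → U'.u i * b i)))
        (cong₂ _-_ (sym (linear U.v U'.v c)) (sym (linear U.u U'.u b))))
    }
    where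
    module U = Multipliers (multipliers C)
    module U' = Multipliers (multipliers C')
    S : (Fin m → ℚ) → Fin n → ℚ
    S u j = ∑ (λ i → u i * M i j)
    S' : (Fin n → ℚ) → Fin m → ℚ
    S' v i = ∑ (λ j → v j * M i j)
    eq : ∀ z z' c s s' → (z * c - s) + (z' * c - s') ≡ (z + z') * c - (s + s')
    eq = solve-∀ ℚ-ring
    eq' : ∀ z z' c s s' → (s - z * c) + (s' - z' * c) ≡ (s + s') - (z + z') * c
    eq' = solve-∀ ℚ-ring
    eq'' : ∀ a b c d → (a - b) + (c - d) ≡ (a + c) - (b + d)
    eq'' = solve-∀ ℚ-ring
  multipliers (scale {r} 0≤r C) = record
    { u = λ i → r * U.u i ; v = λ j → r * U.v j ; z = r * U.z
    ; 0≤u = λ i → 0≤r ⊗ U.0≤u i ; 0≤v = λ j → 0≤r ⊗ U.0≤v j ; 0≤z = 0≤r ⊗ U.0≤z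
    ; left = λ j → trans (cong (r *_) (U.left j)) (trans (eq r U.z (c j) (∑ (λ i → U.u i * M i j)))
        (cong (λ s → r * U.z * c j - s) (sym (homogeneous r U.u (λ i → M i j)))))
    ; right = λ i → trans (cong (r *_) (U.right i)) (trans (eq' r U.z (b i) (∑ (λ j → U.v j * M i j)))
        (cong (λ s → s - r * U.z * b i) (sym (homogeneous r U.v (λ j → M i j)))))
    ; bound = trans (cong (r *_) U.bound) (trans (eq'' r (∑ (λ j → U.v j * c j)) (∑ (λ i → U.u i * b i)))
        (cong₂ _-_ (sym (homogeneous r U.v c)) (sym (homogeneous r U.u b))))
    }
    where
    module U = Multipliers (multipliers C)
    eq : ∀ r z c s → r * (z * c - s) ≡ r * z * c - r * s
    eq = solve-∀ ℚ-ring
    eq' : ∀ r z c s → r * (s - z * c) ≡ r * s - r * z * c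
    eq' = solve-∀ ℚ-ring
    eq'' : ∀ r a b → r * (a - b) ≡ r * a - r * b
    eq'' = solve-∀ ℚ-ring

  -- Weak duality refutes a Farkas certificate with z > 0; one with z = 0 would be a
  -- ray along which the feasible points x⁰ and 0 contradict each other.
  no-certificate : ∀ d → (∀ k → 0ℚ ≤ proj₁ d k) → proj₂ d < 0ℚ → ¬ Cone system d
  no-certificate d 0≤d d<0 C = <⇒≱ ub>vc ub≤vc
    where
    open Multipliers (multipliers C)
    ub = ∑ (λ i → u i * b i)
    vc = ∑ (λ j → v j * c j)
    uM : Fin n → ℚ
    uM j = ∑ (λ i → u i * M i j)
    ub>vc : vc < ub
    ub>vc = ℚ.≰⇒> λ ub≤vc → <⇒≱ d<0 (ℚ.≤-trans (diff ub≤vc) (ℚ.≤-reflexive (sym bound)))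
    uM≤zc : ∀ j → uM j ≤ z * c j
    uM≤zc j = by (0≤d (j ↑ˡ m)) (trans (eq (uM j) (z * c j)) (cong (λ ζ → uM j + ζ) (sym (left j))))
      where
      eq : ∀ s t → t ≡ s + (t - s)
      eq = solve-∀ ℚ-ring
    zb≤Mv : ∀ i → z * b i ≤ ∑ (λ j → M i j * v j)
    zb≤Mv i = ℚ.≤-trans (by (0≤d (n ↑ʳ i)) (trans (eq (z * b i) (∑ (λ j → v j * M i j))) (cong (λ ζ → z * b i + ζ) (sym (right i)))))
      (ℚ.≤-reflexive (∑-cong (λ j → ℚ.*-comm (v j) (M i j))))
      where
      eq : ∀ s t → t ≡ s + (t - s)
      eq = solve-∀ ℚ-ring
    ub≤vc : ub ≤ vc
    ub≤vc with 0ℚ ℚ.<? z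
    ... | yes 0<z = cancelˡ 0<z (ℚ.≤-trans (ℚ.≤-reflexive (trans (*-distribˡ-sum z (λ i → u i * b i)) (∑-cong (λ i → eq z (u i) (b i)))))
        (ℚ.≤-trans (∑-mono (λ i → *-monoˡ (0≤u i) (zb≤Mv i)))
        (ℚ.≤-trans (ℚ.≤-reflexive (∑-exchange u M v))
        (ℚ.≤-trans (∑-mono (λ j → *-monoʳ (0≤v j) (uM≤zc j)))
        (ℚ.≤-reflexive (trans (∑-cong (λ j → eq' z (c j) (v j))) (sym (*-distribˡ-sum z (λ j → v j * c j)))))))))
      where
      eq : ∀ z u b → z * (u * b) ≡ u * (z * b)
      eq = solve-∀ ℚ-ring
      eq' : ∀ z c v → z * c * v ≡ z * (v * c)
      eq' = solve-∀ ℚ-ring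
    ... | no 0≮z = ℚ.≤-trans (∑-mono (λ i → *-monoˡ (0≤u i) (Mx⁰≥b i)))
        (ℚ.≤-trans (ℚ.≤-reflexive (∑-exchange u M x⁰))
        (ℚ.≤-trans (∑-mono (λ j → ℚ.≤-trans (*-monoʳ (0≤x⁰ j) (uM≤0 j)) (ℚ.≤-reflexive (ℚ.*-zeroˡ (x⁰ j)))))
        (ℚ.≤-trans (ℚ.≤-reflexive (∑-zero {f = λ (_ : Fin n) → 0ℚ} (λ _ → refl))) (0≤∑ (λ j → 0≤v j ⊗ 0≤c j)))))
      where
      uM≤0 : ∀ j → uM j ≤ 0ℚ
      uM≤0 j = ℚ.≤-trans (uM≤zc j) (ℚ.≤-trans (*-monoʳ (0≤c j) (ℚ.≮⇒≥ 0≮z)) (ℚ.≤-reflexive (ℚ.*-zeroˡ (c j))))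

  strong-duality : Σ (Fin n → ℚ) λ x → Σ (Fin m → ℚ) λ y → ((∀ j → 0ℚ ≤ x j) × (∀ i → 0ℚ ≤ y i) ×
    (∀ i → b i ≤ ∑ (λ j → M i j * x j)) × (∀ j → ∑ (λ i → M i j * y i) ≤ c j) ×
    ∑ (λ j → c j * x j) ≤ ∑ (λ i → b i * y i))
  strong-duality with farkas system
  ... | inj₂ (d , 0≤d , d<0 , C) = ⊥-elim (no-certificate d 0≤d d<0 C)
  ... | inj₁ (x , 0≤x , sat) = (λ j → x (j ↑ˡ m)) , (λ i → x (n ↑ʳ i)) , (λ j → 0≤x (j ↑ˡ m)) , (λ i → 0≤x (n ↑ʳ i)) ,
    (λ i → by (diff (sat (∈-++⁺ˡ (∈-tabulate⁺ i)))) (eq i)) ,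
    (λ j → ℚ.≤-trans (ℚ.≤-reflexive (sym (trans (dot-∣ (λ _ → 0ℚ) (λ i → M i j) x) (trans (cong (_+ ∑ (λ i → M i j * x (n ↑ʳ i))) (zeroes (λ j → x (j ↑ˡ m)))) (ℚ.+-identityˡ _)))))
      (sat (∈-++⁺ʳ (List.tabulate primal) (∈-++⁺ˡ (∈-tabulate⁺ j))))) ,
    by (diff (sat (∈-++⁺ʳ (List.tabulate primal) (∈-++⁺ʳ (List.tabulate dual) (here refl))))) eq'
    where
    neg-sum : ∀ {k} (f g : Fin k → ℚ) → ∑ (λ i → - f i * g i) ≡ - ∑ (λ i → f i * g i)
    neg-sum f g = trans (∑-cong (λ i → sym (lin (f i) (g i)))) (trans (sym (*-distribˡ-sum (- 1ℚ) (λ i → f i * g i))) (lin' (∑ (λ i → f i * g i))))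
      where
      lin : ∀ f g → - 1ℚ * (f * g) ≡ - f * g
      lin = solve-∀ ℚ-ring
      lin' : ∀ s → - 1ℚ * s ≡ - s
      lin' = solve-∀ ℚ-ring
    eq : ∀ i → ∑ (λ j → M i j * x (j ↑ˡ m)) ≡ b i + (- b i - dot ((λ j → - M i j) ∣ (λ _ → 0ℚ)) x)
    eq i = trans (lin (∑ (λ j → M i j * x (j ↑ˡ m))) (b i)) (cong (λ s → b i + (- b i - s)) (sym (trans (dot-∣ (λ j → - M i j) (λ _ → 0ℚ) x)
      (trans (cong₂ _+_ (neg-sum (M i) (λ j → x (j ↑ˡ m))) (zeroes (λ k → x (n ↑ʳ k)))) (ℚ.+-identityʳ _)))))
      where
      lin : ∀ s b → s ≡ b + (- b - (- s))
      lin = solve-∀ ℚ-ring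
    eq' : ∑ (λ i → b i * x (n ↑ʳ i)) ≡ ∑ (λ j → c j * x (j ↑ˡ m)) + (0ℚ - dot (c ∣ (λ i → - b i)) x)
    eq' = trans (lin (∑ (λ i → b i * x (n ↑ʳ i))) (∑ (λ j → c j * x (j ↑ˡ m)))) (cong (λ s → ∑ (λ j → c j * x (j ↑ˡ m)) + (0ℚ - s))
      (sym (trans (dot-∣ c (λ i → - b i) x) (cong (λ ζ → ∑ (λ j → c j * x (j ↑ˡ m)) + ζ) (neg-sum b (λ i → x (n ↑ʳ i)))))))
      where
      lin : ∀ s t → s ≡ t + (0ℚ - (t + - s))
      lin = solve-∀ ℚ-ring

-- Fractional colourings

ind : ∀ {a} {P : Set a} → Dec P → ℚ
ind (yes _) = 1ℚ
ind (no _)  = 0ℚ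

0≤ind : ∀ {a} {P : Set a} (d : Dec P) → 0ℚ ≤ ind d
0≤ind (yes _) = 0≤1
0≤ind (no _)  = ℚ.≤-refl

ind≤1 : ∀ {a} {P : Set a} (d : Dec P) → ind d ≤ 1ℚ
ind≤1 (yes _) = ℚ.≤-refl
ind≤1 (no _)  = 0≤1

ind-yes : ∀ {a} {P : Set a} (d : Dec P) → P → ind d ≡ 1ℚ
ind-yes (yes _) _ = refl
ind-yes (no ¬p) p = contradiction p ¬p

ind-no : ∀ {a} {P : Set a} (d : Dec P) → ¬ P → ind d ≡ 0ℚ
ind-no (yes p) ¬p = contradiction p ¬p
ind-no (no _) _ = refl

ind-× : ∀ {a b c} {P : Set a} {Q : Set b} {R : Set c} (p : Dec P) (q : Dec Q) (r : Dec R) →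
  (R → P × Q) → (P → Q → R) → ind r ≡ ind p * ind q
ind-× (yes p) (yes q) r to from = ind-yes r (from p q)
ind-× (yes _) (no ¬q) r to from = ind-no r (¬q ∘ proj₂ ∘ to)
ind-× (no ¬p) q       r to from = trans (ind-no r (¬p ∘ proj₁ ∘ to)) (sym (ℚ.*-zeroˡ (ind q)))

term≤∑ : ∀ {n} {f : Fin n → ℚ} → (∀ i → 0ℚ ≤ f i) → ∀ i → f i ≤ ∑ f
term≤∑ {suc n} {f} 0≤f zero    = by (0≤∑ (0≤f ∘ suc)) refl
term≤∑ {suc n} {f} 0≤f (suc i) = ℚ.≤-trans (term≤∑ (0≤f ∘ suc) i) (by (0≤f zero) (ℚ.+-comm (f zero) (∑ (f ∘ suc))))

-- Subsets are numbered by `Fin (2^ N)` so that they can index the variables of a linear program.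
-- Doubling by addition lets `splitAt` separate the sets without and with the first element, in the
-- order of `subsets`.
2^ : ℕ → ℕ
2^ zero    = 1
2^ (suc N) = 2^ N ℕ.+ 2^ N

subset : ∀ N → Fin (2^ N) → Subset N
subset zero    _ = Vec.[]
subset (suc N) j = [ (λ i → outside Vec.∷ subset N i) , (λ i → inside Vec.∷ subset N i) ]′ (splitAt (2^ N) j)

index : ∀ {N} → Subset N → Fin (2^ N)
index Vec.[]                  = zero
index {suc N} (outside Vec.∷ S) = index S ↑ˡ 2^ N
index {suc N} (inside  Vec.∷ S) = 2^ N ↑ʳ index S

subset-index : ∀ {N} (S : Subset N) → subset N (index S) ≡ S
subset-index Vec.[] = refl
subset-index {suc N} (outside Vec.∷ S) rewrite Fin.splitAt-↑ˡ (2^ N) (index S) (2^ N) = cong (outside Vec.∷_) (subset-index S)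
subset-index {suc N} (inside  Vec.∷ S) rewrite Fin.splitAt-↑ʳ (2^ N) (2^ N) (index S) = cong (inside Vec.∷_) (subset-index S)

index-subset : ∀ N j → index (subset N j) ≡ j
index-subset zero zero = refl
index-subset (suc N) j with splitAt (2^ N) j in eq
... | inj₁ i = trans (cong (_↑ˡ 2^ N) (index-subset N i)) (Fin.splitAt⁻¹-↑ˡ eq)
... | inj₂ i = trans (cong (2^ N ↑ʳ_) (index-subset N i)) (Fin.splitAt⁻¹-↑ʳ eq)

sumℚ-++ : ∀ xs ys → sumℚ (xs List.++ ys) ≡ sumℚ xs + sumℚ ys
sumℚ-++ []       ys = sym (ℚ.+-identityˡ _)
sumℚ-++ (x ∷ xs) ys = trans (cong (λ ζ → x + ζ) (sumℚ-++ xs ys)) (sym (ℚ.+-assoc x (sumℚ xs) (sumℚ ys)))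

sumℚ-subsets-suc : ∀ {N} (f : Subset (suc N) → ℚ) → sumℚ (List.map f (subsets (suc N))) ≡
  sumℚ (List.map (f ∘ (outside Vec.∷_)) (subsets N)) + sumℚ (List.map (f ∘ (inside Vec.∷_)) (subsets N))
sumℚ-subsets-suc {N} f = trans (cong sumℚ (List.map-++ f (List.map (outside Vec.∷_) (subsets N)) _))
  (trans (sumℚ-++ (List.map f (List.map (outside Vec.∷_) (subsets N))) _)
  (sym (cong₂ (λ xs ys → sumℚ xs + sumℚ ys) (List.map-∘ (subsets N)) (List.map-∘ (subsets N)))))

∑ₛ : ∀ {N} → (Subset N → ℚ) → ℚ
∑ₛ {N} f = ∑ (f ∘ subset N)

sumℚ-subsets : ∀ {N} (f : Subset N → ℚ) → sumℚ (List.map f (subsets N)) ≡ ∑ₛ f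
sumℚ-subsets {zero}  f = refl
sumℚ-subsets {suc N} f = trans (sumℚ-subsets-suc f) (trans (cong₂ _+_
    (trans (sumℚ-subsets (f ∘ (outside Vec.∷_))) (∑-cong (λ j → cong (f ∘ [ (λ i → outside Vec.∷ subset N i) , (λ i → inside Vec.∷ subset N i) ]′) (sym (Fin.splitAt-↑ˡ (2^ N) j (2^ N))))))
    (trans (sumℚ-subsets (f ∘ (inside Vec.∷_))) (∑-cong (λ j → cong (f ∘ [ (λ i → outside Vec.∷ subset N i) , (λ i → inside Vec.∷ subset N i) ]′) (sym (Fin.splitAt-↑ʳ (2^ N) (2^ N) j))))))
  (sym (∑-splitAt (2^ N) (f ∘ subset (suc N)))))

sumℚ-filter : ∀ {a p} {A : Set a} {P : A → Set p} (P? : ∀ x → Dec (P x)) (f : A → ℚ) xs →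
  sumℚ (List.map f (List.filter P? xs)) ≡ sumℚ (List.map (λ x → ind (P? x) * f x) xs)
sumℚ-filter P? f [] = refl
sumℚ-filter P? f (x ∷ xs) with P? x
... | yes _ = cong₂ _+_ (sym (ℚ.*-identityˡ (f x))) (sumℚ-filter P? f xs)
... | no _  = trans (sumℚ-filter P? f xs) (sym (trans (cong (_+ sumℚ (List.map (λ x → ind (P? x) * f x) xs)) (ℚ.*-zeroˡ (f x))) (ℚ.+-identityˡ _)))

weight : (Fin N → ℚ) → Subset N → ℚ
weight y S = ∑ (λ v → ind (v ∈? S) * y v)

cover≡ : ∀ (w : Subset N → ℚ) v → cover w v ≡ ∑ₛ (λ S → ind (v ∈? S) * w S)
cover≡ {N} w v = trans (sumℚ-filter (v ∈?_) w (subsets N)) (sumℚ-subsets (λ S → ind (v ∈? S) * w S))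

∑-cover : ∀ (w : Subset N → ℚ) y → ∑ (λ v → cover w v * y v) ≡ ∑ₛ (λ S → w S * weight y S)
∑-cover {N} w y = trans (∑-cong (λ v → trans (cong (_* y v) (cover≡ w v)) (*-distribʳ-sum (y v) (λ j → ind (v ∈? subset N j) * w (subset N j)))))
  (trans (∑-comm (λ v j → ind (v ∈? subset N j) * w (subset N j) * y v))
  (∑-cong (λ j → trans (∑-cong (λ v → eq (ind (v ∈? subset N j)) (w (subset N j)) (y v))) (sym (*-distribˡ-sum (w (subset N j)) (λ v → ind (v ∈? subset N j) * y v))))))
  where
  eq : ∀ i w y → i * w * y ≡ w * (i * y)
  eq = solve-∀ ℚ-ring

independent? : ∀ (G : Graph N) S → Dec (Independent G S)
independent? G S = (S ⊆? V G) ×-dec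
  map′ (λ h {i} {j} → h i j) (λ h i j → h {i} {j})
    (Fin.all? λ i → Fin.all? λ j → (i ∈? S) →-dec ((j ∈? S) →-dec ¬? (adj? G i j)))

-- Double counting of class weights: every vertex of G is covered at least once, and every class
-- that is used carries weight at most k.
weak-duality : ∀ {G : Graph N} {w y k} → IsFractionalColouring G w → (∀ v → 0ℚ ≤ y v) →
  (∀ S → Independent G S → weight y S ≤ k) → weight y (V G) ≤ k * total w
weak-duality {N} {G} {w} {y} {k} col 0≤y y≤k = ℚ.≤-trans (∑-mono covered)
  (ℚ.≤-trans (ℚ.≤-reflexive (∑-cover w y))
  (ℚ.≤-trans (∑-mono (λ j → bounded (subset N j)))
  (ℚ.≤-reflexive (trans (sym (*-distribˡ-sum k (w ∘ subset N))) (cong (k *_) (sym (sumℚ-subsets w)))))))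
  where
  open IsFractionalColouring col
  0≤cover : ∀ v → 0ℚ ≤ cover w v
  0≤cover v = ℚ.≤-trans (0≤∑ (λ j → 0≤ind (v ∈? subset N j) ⊗ nonneg (subset N j))) (ℚ.≤-reflexive (sym (cover≡ w v)))
  covered : ∀ v → ind (v ∈? V G) * y v ≤ cover w v * y v
  covered v with v ∈? V G
  ... | yes v∈ = *-monoʳ (0≤y v) (covers v v∈)
  ... | no _   = *-monoʳ (0≤y v) (0≤cover v)
  bounded : ∀ S → w S * weight y S ≤ k * w S
  bounded S with w S ℚ.≟ 0ℚ
  ... | yes w≡0 = ℚ.≤-reflexive (trans (cong (_* weight y S) w≡0) (trans (ℚ.*-zeroˡ (weight y S)) (sym (trans (cong (k *_) w≡0) (ℚ.*-zeroʳ k)))))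
  ... | no w≢0 = ℚ.≤-trans (*-monoˡ (nonneg S) (y≤k S (support S w≢0))) (ℚ.≤-reflexive (ℚ.*-comm (w S) k))

-- Two colourings multiply: intersections of their classes have weight at most k.
weak-duality₂ : ∀ {G H : Graph N} {w w' y k} → V G ≡ V H → IsFractionalColouring G w → IsFractionalColouring H w' →
  (∀ v → 0ℚ ≤ y v) → (∀ A B → Independent G A → Independent H B → weight y (A ∩ B) ≤ k) →
  weight y (V G) ≤ k * total w * total w'
weak-duality₂ {N} {G} {H} {w} {w'} {y} {k} VG≡VH col col' 0≤y y≤k = ℚ.≤-trans (∑-mono covered)
  (ℚ.≤-trans (ℚ.≤-reflexive (cong (weight y') VG≡VH)) (weak-duality col' 0≤y' bounded))
  where
  open IsFractionalColouring col
  y' : Fin N → ℚ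
  y' v = cover w v * y v
  0≤cover : ∀ v → 0ℚ ≤ cover w v
  0≤cover v = ℚ.≤-trans (0≤∑ (λ j → 0≤ind (v ∈? subset N j) ⊗ nonneg (subset N j))) (ℚ.≤-reflexive (sym (cover≡ w v)))
  0≤y' : ∀ v → 0ℚ ≤ y' v
  0≤y' v = 0≤cover v ⊗ 0≤y v
  covered : ∀ v → ind (v ∈? V G) * y v ≤ ind (v ∈? V G) * y' v
  covered v with v ∈? V G
  ... | yes v∈ = *-monoˡ 0≤1 (ℚ.≤-trans (ℚ.≤-reflexive (sym (ℚ.*-identityˡ (y v)))) (*-monoʳ (0≤y v) (covers v v∈)))
  ... | no _   = ℚ.≤-reflexive (trans (ℚ.*-zeroˡ (y v)) (sym (ℚ.*-zeroˡ (y' v))))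
  restrict : Subset N → Fin N → ℚ
  restrict B v = ind (v ∈? B) * y v
  weight-∩ : ∀ A B → weight (restrict B) A ≡ weight y (A ∩ B)
  weight-∩ A B = ∑-cong (λ v → trans (sym (ℚ.*-assoc (ind (v ∈? A)) (ind (v ∈? B)) (y v)))
    (cong (_* y v) (sym (ind-× (v ∈? A) (v ∈? B) (v ∈? (A ∩ B)) (x∈p∩q⁻ A B) (λ a b → x∈p∩q⁺ (a , b))))))
  bounded : ∀ B → Independent H B → weight y' B ≤ k * total w
  bounded B indB = ℚ.≤-trans (ℚ.≤-reflexive (trans (∑-cong (λ v → eq (ind (v ∈? B)) (cover w v) (y v))) (∑-cover w (restrict B))))
    (ℚ.≤-trans (∑-mono (λ j → class (subset N j)))
    (ℚ.≤-reflexive (trans (sym (*-distribˡ-sum k (w ∘ subset N))) (cong (k *_) (sym (sumℚ-subsets w))))))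
    where
    eq : ∀ i c y → i * (c * y) ≡ c * (i * y)
    eq = solve-∀ ℚ-ring
    class : ∀ A → w A * weight (restrict B) A ≤ k * w A
    class A with w A ℚ.≟ 0ℚ
    ... | yes w≡0 = ℚ.≤-reflexive (trans (cong (_* weight (restrict B) A) w≡0) (trans (ℚ.*-zeroˡ (weight (restrict B) A)) (sym (trans (cong (k *_) w≡0) (ℚ.*-zeroʳ k)))))
    ... | no w≢0 = ℚ.≤-trans (*-monoˡ (nonneg A) (ℚ.≤-trans (ℚ.≤-reflexive (weight-∩ A B)) (y≤k A B (support A w≢0) indB))) (ℚ.≤-reflexive (ℚ.*-comm (w A) k))

record OptimalPair (G : Graph N) : Set where
  field
    w           : Subset N → ℚ
    y           : Fin N → ℚ
    colouring   : IsFractionalColouring G w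
    0≤y         : ∀ v → 0ℚ ≤ y v
    independent : ∀ S → Independent G S → weight y S ≤ 1ℚ
    optimal     : total w ≤ weight y (V G)

optimal-pair : (G : Graph N) → OptimalPair G
optimal-pair {N} G = record
  { w = w ; y = y ; 0≤y = 0≤y
  ; colouring = record
    { nonneg  = λ S → 0≤ind (independent? G S) ⊗ 0≤x (index S)
    ; support = λ S w≢0 → supported S w≢0
    ; covers  = λ v v∈ → ℚ.≤-trans (ℚ.≤-reflexive (sym (ind-yes (v ∈? V G) v∈))) (ℚ.≤-trans (feasible v)
        (ℚ.≤-reflexive (trans (∑-cong (λ j → trans (ℚ.*-assoc (ind (v ∈? subset N j)) (ind (independent? G (subset N j))) (x j)) (cong (ind (v ∈? subset N j) *_) (sym (w-subset j))))) (sym (cover≡ w v)))))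
    }
  ; independent = λ S indS → ℚ.≤-trans (ℚ.≤-reflexive (∑-cong (λ v → cong (_* y v) (sym (trans (cong (λ A → ind (v ∈? A) * ind (independent? G A)) (subset-index S))
        (trans (cong (ind (v ∈? S) *_) (ind-yes (independent? G S) indS)) (ℚ.*-identityʳ (ind (v ∈? S))))))))) (dual (index S))
  ; optimal = ℚ.≤-trans (ℚ.≤-reflexive (sumℚ-subsets w)) (ℚ.≤-trans (∑-mono (λ j → ℚ.≤-trans (ℚ.≤-reflexive (w-subset j)) (*-monoʳ (0≤x j) (ind≤1 (independent? G (subset N j)))))) strong)
  }
  where
  -- Columns of dependent sets are zero, so x may be positive on such sets. Masking x by the
  -- indicator, as `w` does, leaves all covers unchanged and does not increase the total.
  M : Fin N → Fin (2^ N) → ℚ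
  M v j = ind (v ∈? subset N j) * ind (independent? G (subset N j))
  0≤M : ∀ v j → 0ℚ ≤ M v j
  0≤M v j = 0≤ind (v ∈? subset N j) ⊗ 0≤ind (independent? G (subset N j))
  singleton : ∀ {v} → v ∈ V G → Independent G ⁅ v ⁆
  singleton {v} v∈ = (λ i∈ → subst (_∈ V G) (sym (x∈⁅y⁆⇒x≡y v i∈)) v∈) ,
    λ {i} {j} i∈ j∈ adj → adj-irrefl G (subst₂ (Adj G) (x∈⁅y⁆⇒x≡y v i∈) (x∈⁅y⁆⇒x≡y v j∈) adj)
  -- Weight 1 on every set is feasible already because of the singletons.
  primal-feasible : ∀ v → ind (v ∈? V G) ≤ ∑ (λ j → M v j * 1ℚ)
  primal-feasible v with v ∈? V G
  ... | no _   = 0≤∑ (λ j → 0≤M v j ⊗ 0≤1)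
  ... | yes v∈ = ℚ.≤-trans (ℚ.≤-reflexive (sym at-v)) (term≤∑ (λ j → 0≤M v j ⊗ 0≤1) (index ⁅ v ⁆))
    where
    at-v : M v (index ⁅ v ⁆) * 1ℚ ≡ 1ℚ
    at-v = trans (ℚ.*-identityʳ _) (trans (cong (λ A → ind (v ∈? A) * ind (independent? G A)) (subset-index ⁅ v ⁆))
      (trans (cong₂ _*_ (ind-yes (v ∈? ⁅ v ⁆) (x∈⁅x⁆ v)) (ind-yes (independent? G ⁅ v ⁆) (singleton v∈))) refl))
  solution = Duality.strong-duality M (λ v → ind (v ∈? V G)) (λ _ → 1ℚ) (λ _ → 0≤1) (λ _ → 1ℚ) (λ _ → 0≤1) primal-feasible
  x : Fin (2^ N) → ℚ
  x = proj₁ solution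
  y : Fin N → ℚ
  y = proj₁ (proj₂ solution)
  0≤x = proj₁ (proj₂ (proj₂ solution))
  0≤y = proj₁ (proj₂ (proj₂ (proj₂ solution)))
  feasible = proj₁ (proj₂ (proj₂ (proj₂ (proj₂ solution))))
  dual = proj₁ (proj₂ (proj₂ (proj₂ (proj₂ (proj₂ solution)))))
  w : Subset N → ℚ
  w S = ind (independent? G S) * x (index S)
  w-subset : ∀ j → w (subset N j) ≡ ind (independent? G (subset N j)) * x j
  w-subset j = cong (λ i → ind (independent? G (subset N j)) * x i) (index-subset N j)
  strong : ∑ (λ j → 1ℚ * x j) ≤ weight y (V G)
  strong = proj₂ (proj₂ (proj₂ (proj₂ (proj₂ (proj₂ solution)))))
  supported : ∀ S → w S ≢ 0ℚ → Independent G S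
  supported S w≢0 with independent? G S
  ... | yes indS = indS
  ... | no _     = contradiction (ℚ.*-zeroˡ (x (index S))) w≢0

χf-exists : (G : Graph N) → ∃[ q ] Isχf G q
χf-exists G = total w , (w , colouring , refl) , λ { q (w' , col , refl) →
  ℚ.≤-trans optimal (ℚ.≤-trans (weak-duality col 0≤y independent) (ℚ.≤-reflexive (ℚ.*-identityˡ _))) }
  where open OptimalPair (optimal-pair G)

-- The dual solution is cut down to V(G), so that its sum over all of Fin N is t as well; the
-- ordering by weight used later runs over all of Fin N.
χf-weight : ∀ {G : Graph N} {t} → Isχf G t →
  Σ (Fin N → ℚ) λ y → (∀ v → 0ℚ ≤ y v) × (∀ S → Independent G S → weight y S ≤ 1ℚ) × weight y (V G) ≡ t × ∑ y ≡ t
χf-weight {G = G} {t} ((w' , col , refl) , minimal) = y′ , (λ v → 0≤ind (v ∈? V G) ⊗ 0≤y v) ,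
  (λ S indS → ℚ.≤-trans (∑-mono (λ v → *-monoˡ (0≤ind (v ∈? S)) (restricted v))) (independent S indS)) ,
  trans (∑-cong (λ v → idempotent v)) sum≡t , sum≡t
  where
  open OptimalPair (optimal-pair G)
  y′ = λ v → ind (v ∈? V G) * y v
  restricted : ∀ v → ind (v ∈? V G) * y v ≤ y v
  restricted v = ℚ.≤-trans (*-monoʳ (0≤y v) (ind≤1 (v ∈? V G))) (ℚ.≤-reflexive (ℚ.*-identityˡ (y v)))
  idempotent : ∀ v → ind (v ∈? V G) * y′ v ≡ y′ v
  idempotent v with v ∈? V G
  ... | yes _ = ℚ.*-identityˡ (1ℚ * y v)
  ... | no _  = trans (ℚ.*-zeroˡ (0ℚ * y v)) (sym (ℚ.*-zeroˡ (y v)))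
  sum≡t : weight y (V G) ≡ t
  sum≡t = ℚ.≤-antisym (ℚ.≤-trans (weak-duality col 0≤y independent) (ℚ.≤-reflexive (ℚ.*-identityˡ t)))
    (ℚ.≤-trans (minimal (total w) (w , colouring , refl)) optimal)

-- Random edge sets

^-antitone : ∀ {x} → 0ℚ ≤ x → x ≤ 1ℚ → ∀ {m n} → m ℕ.≤ n → x ^ n ≤ x ^ m
^-antitone 0≤x x≤1 {n = zero} z≤n = ℚ.≤-refl
^-antitone {x} 0≤x x≤1 {n = suc n} z≤n = ℚ.≤-trans (*-monoʳ (0≤^ 0≤x n) x≤1) (ℚ.≤-trans (ℚ.≤-reflexive (ℚ.*-identityˡ (x ^ n))) (^-antitone 0≤x x≤1 {n = n} z≤n))
^-antitone 0≤x x≤1 (s≤s m≤n) = *-monoˡ 0≤x (^-antitone 0≤x x≤1 m≤n)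

^-monotone : ∀ {x} → 1ℚ ≤ x → ∀ {m n} → m ℕ.≤ n → x ^ m ≤ x ^ n
^-monotone {x} 1≤x {n = zero} z≤n = ℚ.≤-refl
^-monotone {x} 1≤x {n = suc n} z≤n = *-mono 0≤1 (0≤^ (ℚ.≤-trans 0≤1 1≤x) n) 1≤x (^-monotone 1≤x {n = n} z≤n)
^-monotone 1≤x (s≤s m≤n) = *-monoˡ (ℚ.≤-trans 0≤1 1≤x) (^-monotone 1≤x m≤n)

∑ₛ-suc : (f : Subset (suc N) → ℚ) → ∑ₛ f ≡ ∑ₛ (f ∘ (outside Vec.∷_)) + ∑ₛ (f ∘ (inside Vec.∷_))
∑ₛ-suc f = trans (sym (sumℚ-subsets f)) (trans (sumℚ-subsets-suc f)
  (cong₂ _+_ (sumℚ-subsets (f ∘ (outside Vec.∷_))) (sumℚ-subsets (f ∘ (inside Vec.∷_)))))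

ℙ : ∀ {m} → ℚ → (Subset m → Bool) → ℚ
ℙ p D = ∑ₛ (λ ω → if D ω then bernoulli p ω else 0ℚ)

prob≡ℙ : ∀ {m} (p : Seq) (D : Subset m → Bool) n → prob p D n ≡ ℙ (p n) D
prob≡ℙ p D n = sumℚ-subsets (λ ω → if D ω then bernoulli (p n) ω else 0ℚ)

0≤bernoulli : ∀ {m p} → 0ℚ ≤ p → p ≤ 1ℚ → (ω : Subset m) → 0ℚ ≤ bernoulli p ω
0≤bernoulli 0≤p p≤1 Vec.[]              = 0≤1
0≤bernoulli 0≤p p≤1 (inside  Vec.∷ ω) = 0≤p ⊗ 0≤bernoulli 0≤p p≤1 ω
0≤bernoulli 0≤p p≤1 (outside Vec.∷ ω) = diff p≤1 ⊗ 0≤bernoulli 0≤p p≤1 ω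

avoids : ∀ {m} → Subset m → Subset m → Bool
avoids Vec.[]              Vec.[]              = true
avoids (inside Vec.∷ B)  (inside Vec.∷ ω)  = false
avoids (inside Vec.∷ B)  (outside Vec.∷ ω) = avoids B ω
avoids (outside Vec.∷ B) (_ Vec.∷ ω)       = avoids B ω

disjoint⇒avoids : ∀ {m} (B ω : Subset m) → (∀ {k} → k ∈ B → k ∉ ω) → avoids B ω ≡ true
disjoint⇒avoids Vec.[] Vec.[] _ = refl
disjoint⇒avoids (inside Vec.∷ B)  (inside Vec.∷ ω)  h = contradiction Vec.here (h Vec.here)
disjoint⇒avoids (inside Vec.∷ B)  (outside Vec.∷ ω) h = disjoint⇒avoids B ω (λ k∈B k∈ω → h (Vec.there k∈B) (Vec.there k∈ω))
disjoint⇒avoids (outside Vec.∷ B) (_ Vec.∷ ω)       h = disjoint⇒avoids B ω (λ k∈B k∈ω → h (Vec.there k∈B) (Vec.there k∈ω))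

if-scale : ∀ b c x → (if b then c * x else 0ℚ) ≡ c * (if b then x else 0ℚ)
if-scale true  c x = refl
if-scale false c x = sym (ℚ.*-zeroʳ c)

ℙ-scale : ∀ {m} c (D : Subset m → Bool) p → ∑ₛ (λ ω → if D ω then c * bernoulli p ω else 0ℚ) ≡ c * ℙ p D
ℙ-scale {m} c D p = trans (∑-cong (λ j → if-scale (D (subset m j)) c (bernoulli p (subset m j)))) (sym (*-distribˡ-sum c (λ j → if D (subset m j) then bernoulli p (subset m j) else 0ℚ)))

-- Each index in B contributes the factor 1 - p, every other index (1 - p) + p = 1.
ℙ-avoids : ∀ {m} p (B : Subset m) → ℙ p (avoids B) ≡ (1ℚ - p) ^ Subset.∣ B ∣
ℙ-avoids p Vec.[] = refl
ℙ-avoids {suc m} p (inside Vec.∷ B) = trans (∑ₛ-suc {m} (λ ω → if avoids (inside Vec.∷ B) ω then bernoulli p ω else 0ℚ)) (trans (cong₂ _+_ (ℙ-scale (1ℚ - p) (avoids B) p) (∑-zero {2^ m} (λ _ → refl)))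
  (trans (ℚ.+-identityʳ _) (cong ((1ℚ - p) *_) (ℙ-avoids p B))))
ℙ-avoids {suc m} p (outside Vec.∷ B) = trans (∑ₛ-suc {m} (λ ω → if avoids (outside Vec.∷ B) ω then bernoulli p ω else 0ℚ)) (trans (cong₂ _+_ (ℙ-scale (1ℚ - p) (avoids B) p) (ℙ-scale p (avoids B) p))
  (trans (eq p (ℙ p (avoids B))) (ℙ-avoids p B)))
  where
  eq : ∀ p x → (1ℚ - p) * x + p * x ≡ x
  eq = solve-∀ ℚ-ring

∑-<⇒∃< : ∀ {n} {f g : Fin n → ℚ} → ∑ f < ∑ g → ∃[ i ] f i < g i
∑-<⇒∃< {n} {f} {g} f<g with Fin.any? (λ i → f i ℚ.<? g i)
... | yes h = h
... | no ¬h = contradiction (∑-mono (λ i → ℚ.≮⇒≥ (λ fi<gi → ¬h (i , fi<gi)))) (<⇒≱ f<g)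

-- First moments: at some ω the weighted count of bad events is below the contribution of `D`. That
-- contribution is then positive, so `D` holds at ω, and one bad event with c i ≥ 1 would already
-- outweigh it. The coefficients c select, as indicators, the events that count.
ℙ-witness : ∀ {n m} {p} {D : Subset m → Bool} (E : Fin n → Subset m → Bool) (c : Fin n → ℚ) → 0ℚ ≤ p → p ≤ 1ℚ → (∀ i → 0ℚ ≤ c i) →
  ∑ (λ i → c i * ℙ p (E i)) < ℙ p D → ∃[ ω ] (T (D ω) × (∀ i → 1ℚ ≤ c i → E i ω ≡ false))
ℙ-witness {n} {m} {p} {D} E c 0≤p p≤1 0≤c small = ω , proj₁ good , proj₂ good
  where
  χ : (Subset m → Bool) → Subset m → ℚ
  χ A ω = if A ω then bernoulli p ω else 0ℚ
  0≤χ : ∀ A ω → 0ℚ ≤ χ A ω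
  0≤χ A ω with A ω
  ... | true  = 0≤bernoulli 0≤p p≤1 ω
  ... | false = ℚ.≤-refl
  swapped : ∑ (λ i → c i * ℙ p (E i)) ≡ ∑ₛ (λ ω → ∑ (λ i → c i * χ (E i) ω))
  swapped = trans (∑-cong (λ i → *-distribˡ-sum (c i) (χ (E i) ∘ subset m))) (∑-comm (λ i j → c i * χ (E i) (subset m j)))
  found = ∑-<⇒∃< (ℚ.≤-<-trans (ℚ.≤-reflexive (sym swapped)) small)
  ω = subset m (proj₁ found)
  rare : ∑ (λ i → c i * χ (E i) ω) < χ D ω
  rare = proj₂ found
  χ-true : ∀ A → A ω ≡ true → χ A ω ≡ bernoulli p ω
  χ-true A eq rewrite eq = refl
  χ≤ : ∀ A → χ A ω ≤ bernoulli p ω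
  χ≤ A with A ω
  ... | true  = ℚ.≤-refl
  ... | false = 0≤bernoulli 0≤p p≤1 ω
  good : T (D ω) × (∀ i → 1ℚ ≤ c i → E i ω ≡ false)
  good = inD , λ i 1≤c → not-true (E i ω) λ eq → <⇒≱ rare
    (ℚ.≤-trans (χ≤ D) (ℚ.≤-trans (ℚ.≤-reflexive (trans (sym (ℚ.*-identityˡ _)) (cong (1ℚ *_) (sym (χ-true (E i) eq)))))
      (ℚ.≤-trans (*-monoʳ (0≤χ (E i) ω) 1≤c) (term≤∑ (λ i → 0≤c i ⊗ 0≤χ (E i) ω) i))))
    where
    not-true : ∀ b → ¬ (b ≡ true) → b ≡ false
    not-true true  h = contradiction refl h
    not-true false _ = refl
    inD : T (D ω)
    inD with D ω | rare
    ... | true  | _ = _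
    ... | false | h = contradiction (0≤∑ (λ i → 0≤c i ⊗ 0≤χ (E i) ω)) (<⇒≱ h)

ind-⇔ : ∀ {a b} {A : Set a} {B : Set b} (p : Dec A) (q : Dec B) → (A → B) → (B → A) → ind p ≡ ind q
ind-⇔ (yes a) q f g = sym (ind-yes q (f a))
ind-⇔ (no ¬a) q f g = sym (ind-no q (¬a ∘ g))

-- The binomial theorem as a sum over subsets: each element of P contributes 1 or x.
∑ₛ-⊆ : ∀ x (P : Subset N) → ∑ₛ (λ S → ind (S ⊆? P) * x ^ Subset.∣ S ∣) ≡ (1ℚ + x) ^ Subset.∣ P ∣
∑ₛ-⊆ x Vec.[] = refl
∑ₛ-⊆ {suc N} x (outside Vec.∷ P) = trans (∑ₛ-suc {N} (λ S → ind (S ⊆? (outside Vec.∷ P)) * x ^ Subset.∣ S ∣))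
  (trans (cong₂ _+_ without with′) (ℚ.+-identityʳ ((1ℚ + x) ^ Subset.∣ P ∣)))
  where
  without : ∑ₛ (λ S → ind ((outside Vec.∷ S) ⊆? (outside Vec.∷ P)) * x ^ Subset.∣ S ∣) ≡ (1ℚ + x) ^ Subset.∣ P ∣
  without = trans (∑-cong {2^ N} (λ j → cong (_* x ^ Subset.∣ subset N j ∣)
    (ind-⇔ ((outside Vec.∷ subset N j) ⊆? (outside Vec.∷ P)) (subset N j ⊆? P) Subsetₚ.drop-∷-⊆ Subsetₚ.out⊆))) (∑ₛ-⊆ x P)
  with′ : ∑ₛ (λ S → ind ((inside Vec.∷ S) ⊆? (outside Vec.∷ P)) * (x * x ^ Subset.∣ S ∣)) ≡ 0ℚ
  with′ = ∑-zero {2^ N} (λ j → trans (cong (_* (x * x ^ Subset.∣ subset N j ∣))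
    (ind-no ((inside Vec.∷ subset N j) ⊆? (outside Vec.∷ P)) λ h → case h Vec.here of λ ())) (ℚ.*-zeroˡ (x * x ^ Subset.∣ subset N j ∣)))
∑ₛ-⊆ {suc N} x (inside Vec.∷ P) = trans (∑ₛ-suc {N} (λ S → ind (S ⊆? (inside Vec.∷ P)) * x ^ Subset.∣ S ∣))
  (trans (cong₂ _+_ without with′) (eq x ((1ℚ + x) ^ Subset.∣ P ∣)))
  where
  swap : ∀ i x y → i * (x * y) ≡ x * (i * y)
  swap = solve-∀ ℚ-ring
  eq : ∀ x y → y + x * y ≡ (1ℚ + x) * y
  eq = solve-∀ ℚ-ring
  without : ∑ₛ (λ S → ind ((outside Vec.∷ S) ⊆? (inside Vec.∷ P)) * x ^ Subset.∣ S ∣) ≡ (1ℚ + x) ^ Subset.∣ P ∣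
  without = trans (∑-cong {2^ N} (λ j → cong (_* x ^ Subset.∣ subset N j ∣)
    (ind-⇔ ((outside Vec.∷ subset N j) ⊆? (inside Vec.∷ P)) (subset N j ⊆? P) Subsetₚ.drop-∷-⊆ Subsetₚ.out⊆))) (∑ₛ-⊆ x P)
  with′ : ∑ₛ (λ S → ind ((inside Vec.∷ S) ⊆? (inside Vec.∷ P)) * (x * x ^ Subset.∣ S ∣)) ≡ x * (1ℚ + x) ^ Subset.∣ P ∣
  with′ = trans (∑-cong {2^ N} (λ j → trans (cong (_* (x * x ^ Subset.∣ subset N j ∣))
      (ind-⇔ ((inside Vec.∷ subset N j) ⊆? (inside Vec.∷ P)) (subset N j ⊆? P) Subsetₚ.drop-∷-⊆ Subsetₚ.in⊆in)) (swap (ind (subset N j ⊆? P)) x (x ^ Subset.∣ subset N j ∣))))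
    (trans (sym (*-distribˡ-sum x (λ j → ind (subset N j ⊆? P) * x ^ Subset.∣ subset N j ∣))) (cong (x *_) (∑ₛ-⊆ x P)))

∑-geometric : ∀ n {a} → 0ℚ ≤ a → a ≤ ½ → ∑ {n} (λ i → a ^ suc (Fin.toℕ i)) ≤ a + a
∑-geometric zero    0≤a a≤½ = 0≤a ⊕ 0≤a
∑-geometric (suc n) {a} 0≤a a≤½ = ℚ.≤-trans (ℚ.≤-reflexive (cong (λ ζ → a * 1ℚ + ζ) (sym (*-distribˡ-sum {n} a (λ i → a ^ suc (Fin.toℕ i))))))
  (by (diff (*-monoˡ 0≤a (∑-geometric n 0≤a a≤½)) ⊕ (0≤a ⊕ 0≤a) ⊗ diff a≤½) (eq a (∑ {n} (λ i → a ^ suc (Fin.toℕ i)))))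
  where
  eq : ∀ a s → a + a ≡ (a * 1ℚ + a * s) + (a * (a + a) - a * s + (a + a) * (½ - a))
  eq = solve-∀ ℚ-ring

-- Since |P m| ≤ m T, the number of m-subsets of P m is at most (1+x)^(mT) / x^m,
-- which is at most (4T)^m for x = 1/(2T).
∑ₛ-dense : ∀ {T₀ q} (P : ℕ → Subset N) → (∀ m → Subset.∣ P m ∣ ℕ.≤ m ℕ.* suc T₀) → 0ℚ ≤ q → ι 4 * ι (suc T₀) * q ≤ ½ →
  ∑ₛ (λ S → ind ((1 ℕₚ.≤? Subset.∣ S ∣) ×-dec (S ⊆? P Subset.∣ S ∣)) * q ^ Subset.∣ S ∣) ≤ ι 8 * ι (suc T₀) * q
∑ₛ-dense {N} {T₀} {q} P ∣P∣≤ 0≤q a≤½ = ℚ.≤-trans (∑-mono {2^ N} (λ j → single (subset N j)))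
  (ℚ.≤-trans (ℚ.≤-reflexive (∑-comm (spread ∘ subset N)))
  (ℚ.≤-trans (∑-mono {N} perSize)
  (ℚ.≤-trans (∑-geometric N 0≤a a≤½) (ℚ.≤-reflexive (eq (ι (suc T₀)) q)))))
  where
  T' = suc T₀
  a = ι 4 * ι T' * q
  0≤a : 0ℚ ≤ a
  0≤a = 0≤ι 4 ⊗ 0≤ι T' ⊗ 0≤q
  u = ι 2 * ι T'
  0<u : 0ℚ < u
  0<u = *-pos (0<1+ι 1) (0<1+ι T₀)
  x = recip u
  0≤x = 0≤recip 0<u
  0≤qu : 0ℚ ≤ q * u
  0≤qu = 0≤q ⊗ ℚ.<⇒≤ 0<u
  eq : ∀ T q → ι 4 * T * q + ι 4 * T * q ≡ ι 8 * T * q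
  eq = solve-∀ ℚ-ring
  q≡ : x * (q * u) ≡ q
  q≡ = trans (lin x q u) (trans (cong (q *_) (recip-inverse 0<u)) (ℚ.*-identityʳ q))
    where
    lin : ∀ x q u → x * (q * u) ≡ q * (u * x)
    lin = solve-∀ ℚ-ring
  -- The restriction to sets of size m is relaxed to the factor x^|S| x^(-m), with u = 1/x, which
  -- equals 1 when |S| = m. The other summands are nonnegative, and the sum over all S ⊆ P m becomes
  -- a binomial sum.
  spread : Subset N → Fin N → ℚ
  spread S i = ind (S ⊆? P (suc (Fin.toℕ i))) * x ^ Subset.∣ S ∣ * (q * u) ^ suc (Fin.toℕ i)
  single : ∀ S → ind ((1 ℕₚ.≤? Subset.∣ S ∣) ×-dec (S ⊆? P Subset.∣ S ∣)) * q ^ Subset.∣ S ∣ ≤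
    ∑ (spread S)
  single S with (1 ℕₚ.≤? Subset.∣ S ∣) ×-dec (S ⊆? P Subset.∣ S ∣)
  ... | no _ = ℚ.≤-trans (ℚ.≤-reflexive (ℚ.*-zeroˡ (q ^ Subset.∣ S ∣))) (0≤∑ {N} {spread S} (λ i → 0≤ind (S ⊆? P (suc (Fin.toℕ i))) ⊗ 0≤^ 0≤x Subset.∣ S ∣ ⊗ 0≤^ 0≤qu (suc (Fin.toℕ i))))
  ... | yes (1≤∣S∣ , S⊆P) = ℚ.≤-trans (ℚ.≤-reflexive (sym at-size)) (term≤∑ {N} {spread S} (λ i → 0≤ind (S ⊆? P (suc (Fin.toℕ i))) ⊗ 0≤^ 0≤x Subset.∣ S ∣ ⊗ 0≤^ 0≤qu (suc (Fin.toℕ i))) i)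
    where
    k = Subset.∣ S ∣
    suc-pred-k : suc (ℕ.pred k) ≡ k
    suc-pred-k = ℕₚ.m+[n∸m]≡n {1} {k} 1≤∣S∣
    i : Fin N
    i = Fin.fromℕ< {ℕ.pred k} (ℕₚ.≤-trans (ℕₚ.≤-reflexive suc-pred-k) (Subsetₚ.∣p∣≤n S))
    toℕ-i : suc (Fin.toℕ i) ≡ k
    toℕ-i = trans (cong suc (Fin.toℕ-fromℕ< _)) suc-pred-k
    at-size : ind (S ⊆? P (suc (Fin.toℕ i))) * x ^ k * (q * u) ^ suc (Fin.toℕ i) ≡ 1ℚ * q ^ k
    at-size = trans (cong (λ m → ind (S ⊆? P m) * x ^ k * (q * u) ^ m) toℕ-i)
      (trans (ℚ.*-assoc (ind (S ⊆? P k)) (x ^ k) ((q * u) ^ k)) (cong₂ _*_ (ind-yes (S ⊆? P k) S⊆P) (trans (sym (^-distrib-* x (q * u) k)) (cong (_^ k) q≡))))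
  1+x≤ : (1ℚ + x) ^ T' ≤ ι 2
  1+x≤ = by (0≤ι 2 ⊗ diff (bernoulli-≤ 0≤x T')) (lin ((1ℚ + x) ^ T') (ι T' * x) half)
    where
    half : ι 2 * (ι T' * x) ≡ 1ℚ
    half = trans (sym (ℚ.*-assoc (ι 2) (ι T') x)) (recip-inverse 0<u)
    lin : ∀ w z → ι 2 * z ≡ 1ℚ → ι 2 ≡ w + ι 2 * (1ℚ - w * (1ℚ - z))
    lin w z h = sym (trans (e₁ w z) (trans (cong (λ h → ι 2 + w * (h - 1ℚ)) h) (e₂ w)))
      where
      e₁ : ∀ w z → w + ι 2 * (1ℚ - w * (1ℚ - z)) ≡ ι 2 + w * (ι 2 * z - 1ℚ)
      e₁ = solve-∀ ℚ-ring
      e₂ : ∀ w → ι 2 + w * (1ℚ - 1ℚ) ≡ ι 2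
      e₂ = solve-∀ ℚ-ring
  perSize : ∀ i → ∑ₛ (λ S → ind (S ⊆? P (suc (Fin.toℕ i))) * x ^ Subset.∣ S ∣ * (q * u) ^ suc (Fin.toℕ i)) ≤ a ^ suc (Fin.toℕ i)
  perSize i = ℚ.≤-trans (ℚ.≤-reflexive (trans (sym (*-distribʳ-sum ((q * u) ^ m) (λ j → ind (subset N j ⊆? P m) * x ^ Subset.∣ subset N j ∣))) (cong (_* (q * u) ^ m) (∑ₛ-⊆ x (P m)))))
    (ℚ.≤-trans (*-monoʳ (0≤^ 0≤qu m) (ℚ.≤-trans (^-monotone {1ℚ + x} (by 0≤x refl) (∣P∣≤ m))
      (ℚ.≤-trans (ℚ.≤-reflexive (^-* (1ℚ + x) m T')) (^-mono (0≤^ (0≤1 ⊕ 0≤x) T') 1+x≤ m))))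
    (ℚ.≤-reflexive (trans (sym (^-distrib-* (ι 2) (q * u) m)) (cong (_^ m) (lin q (ι T'))))))
    where
    m = suc (Fin.toℕ i)
    lin : ∀ q T → ι 2 * (q * (ι 2 * T)) ≡ ι 4 * T * q
    lin = solve-∀ ℚ-ring

-- Peeling sparse and light vertices

⟪_⟫ : ∀ {p} {P : Fin N → Set p} → (∀ v → Dec (P v)) → Subset N
⟪ P? ⟫ = Vec.tabulate (does ∘ P?)

∈-⟪⟫⁺ : ∀ {p} {P : Fin N → Set p} (P? : ∀ v → Dec (P v)) {v} → P v → v ∈ ⟪ P? ⟫
∈-⟪⟫⁺ P? {v} pv = Vec.lookup⇒[]= v _ (trans (Vec.lookup∘tabulate (does ∘ P?) v) (holds (P? v)))
  where
  holds : ∀ d → does d ≡ true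
  holds (yes _) = refl
  holds (no ¬p) = contradiction pv ¬p

∈-⟪⟫⁻ : ∀ {p} {P : Fin N → Set p} (P? : ∀ v → Dec (P v)) {v} → v ∈ ⟪ P? ⟫ → P v
∈-⟪⟫⁻ P? {v} v∈ = holds (P? v) (trans (sym (Vec.lookup∘tabulate (does ∘ P?) v)) (Vec.[]=⇒lookup v∈))
  where
  holds : ∀ d → does d ≡ true → _
  holds (yes p) _ = p

ind-⟪⟫ : ∀ {p} {P : Fin N → Set p} (P? : ∀ v → Dec (P v)) v → ind (v ∈? ⟪ P? ⟫) ≡ ind (P? v)
ind-⟪⟫ P? v = ind-⇔ (v ∈? ⟪ P? ⟫) (P? v) (∈-⟪⟫⁻ P?) (∈-⟪⟫⁺ P?)

ι-cancel : ∀ {m n} → ι m ≤ ι n → m ℕ.≤ n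
ι-cancel {m} {n} h with m ℕₚ.≤? n
... | yes m≤n = m≤n
... | no m≰n = contradiction (ℚ.≤-trans (ι-mono (ℕₚ.≰⇒> m≰n)) h) (<⇒≱ (ℚ.<-≤-trans (ℚ.≤-<-trans (ℚ.≤-reflexive (sym (ℚ.+-identityˡ (ι n)))) (ℚ.+-monoˡ-< (ι n) (ℚ.positive⁻¹ 1ℚ))) (ℚ.≤-reflexive (sym (ι-suc n)))))

ι∣∣ : (S : Subset N) → ι Subset.∣ S ∣ ≡ ∑ (λ v → ind (v ∈? S))
ι∣∣ Vec.[] = refl
ι∣∣ (inside Vec.∷ S) = trans (ι-suc Subset.∣ S ∣) (cong (λ ζ → 1ℚ + ζ) (trans (ι∣∣ S)
  (∑-cong λ v → sym (ind-⇔ (suc v ∈? (inside Vec.∷ S)) (v ∈? S) Subsetₚ.drop-there Vec.there))))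
ι∣∣ (outside Vec.∷ S) = trans (ι∣∣ S) (trans (∑-cong λ v → sym (ind-⇔ (suc v ∈? (outside Vec.∷ S)) (v ∈? S) Subsetₚ.drop-there Vec.there)) (sym (ℚ.+-identityˡ _)))

δ-refl : (v : Fin N) → δ v v ≡ 1ℚ
δ-refl zero    = refl
δ-refl (suc v) = δ-refl v

δ-≢ : {u v : Fin N} → u ≢ v → δ u v ≡ 0ℚ
δ-≢ {u = zero}  {zero}  u≢v = contradiction refl u≢v
δ-≢ {u = zero}  {suc v} u≢v = refl
δ-≢ {u = suc u} {zero}  u≢v = refl
δ-≢ {u = suc u} {suc v} u≢v = δ-≢ (u≢v ∘ cong suc)

infixl 5 _∖_
remove? : (S : Subset N) (v : Fin N) → ∀ u → Dec (u ∈ S × u ≢ v)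
remove? S v u = (u ∈? S) ×-dec ¬? (u Fin.≟ v)

_∖_ : Subset N → Fin N → Subset N
S ∖ v = ⟪ remove? S v ⟫

∖-⊆ : ∀ (S : Subset N) v → (S ∖ v) ⊆ S
∖-⊆ S v = proj₁ ∘ ∈-⟪⟫⁻ (remove? S v)

∖-∌ : ∀ (S : Subset N) v → v ∉ (S ∖ v)
∖-∌ S v v∈ = proj₂ (∈-⟪⟫⁻ (remove? S v) v∈) refl

∖-∋ : ∀ (S : Subset N) {u v} → u ∈ S → u ≢ v → u ∈ (S ∖ v)
∖-∋ S {u} {v} u∈ u≢v = ∈-⟪⟫⁺ (remove? S v) (u∈ , u≢v)

∣∖∣< : ∀ (S : Subset N) {v} → v ∈ S → Subset.∣ S ∖ v ∣ ℕ.< Subset.∣ S ∣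
∣∖∣< S {v} v∈ = Subsetₚ.p⊂q⇒∣p∣<∣q∣ (∖-⊆ S v , v , v∈ , ∖-∌ S v)

weight-∖ : ∀ {y : Fin N → ℚ} → (∀ v → 0ℚ ≤ y v) → ∀ S v → weight y S ≤ weight y (S ∖ v) + y v
weight-∖ {y = y} 0≤y S v = ℚ.≤-trans (∑-mono pointwise)
  (ℚ.≤-reflexive (trans (∑-distrib-+ (λ u → ind (u ∈? (S ∖ v)) * y u) (λ u → δ v u * y u)) (cong (λ ζ → weight y (S ∖ v) + ζ) (∑-δ v y))))
  where
  pointwise : ∀ u → ind (u ∈? S) * y u ≤ ind (u ∈? (S ∖ v)) * y u + δ v u * y u
  pointwise u with u Fin.≟ v
  ... | yes refl = ℚ.≤-trans (*-monoʳ (0≤y u) (ind≤1 (u ∈? S))) (by (0≤ind (u ∈? (S ∖ u)) ⊗ 0≤y u)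
    (trans (cong (λ d → ind (u ∈? (S ∖ u)) * y u + d * y u) (δ-refl u)) (ℚ.+-comm (ind (u ∈? (S ∖ u)) * y u) (1ℚ * y u))))
  ... | no u≢v = by (0≤δ v u ⊗ 0≤y u) (cong (λ i → i * y u + δ v u * y u)
    (ind-⇔ (u ∈? (S ∖ v)) (u ∈? S) (∖-⊆ S v) (λ u∈ → ∖-∋ S u∈ u≢v)))

∣∣≤length : ∀ (S : Subset N) xs → (∀ {v} → v ∈ S → v ∈ₗ xs) → Subset.∣ S ∣ ℕ.≤ List.length xs
∣∣≤length S xs S⊆xs = ι-cancel (ℚ.≤-trans (ℚ.≤-reflexive (trans (ι∣∣ S) (∑-cong (λ v → sym (ℚ.*-identityʳ (ind (v ∈? S))))))) (go S xs S⊆xs))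
  where
  go : ∀ (S : Subset N) xs → (∀ {v} → v ∈ S → v ∈ₗ xs) → weight (λ _ → 1ℚ) S ≤ ι List.length xs
  go S [] S⊆xs = ℚ.≤-reflexive (∑-zero (λ v → trans (cong (_* 1ℚ) (ind-no (v ∈? S) (λ v∈ → case S⊆xs v∈ of λ ()))) refl))
  go S (x ∷ xs) S⊆xs = ℚ.≤-trans (weight-∖ (λ _ → 0≤1) S x) (ℚ.≤-trans (ℚ.+-monoˡ-≤ 1ℚ (go (S ∖ x) xs rest))
    (ℚ.≤-reflexive (trans (ℚ.+-comm (ι List.length xs) 1ℚ) (sym (ι-suc (List.length xs))))))
    where
    rest : ∀ {v} → v ∈ (S ∖ x) → v ∈ₗ xs
    rest {v} v∈ with S⊆xs (∖-⊆ S x v∈)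
    ... | here refl = contradiction v∈ (∖-∌ S x)
    ... | there v∈xs = v∈xs

injection⇒≤∣∣ : ∀ {k} (S : Subset N) (g : Fin k → Fin N) → (∀ {c c'} → g c ≡ g c' → c ≡ c') → (∀ c → g c ∈ S) → k ℕ.≤ Subset.∣ S ∣
injection⇒≤∣∣ {k = zero}  S g inj g∈ = z≤n
injection⇒≤∣∣ {k = suc k} S g inj g∈ = ℕₚ.≤-trans (s≤s (injection⇒≤∣∣ (S ∖ g zero) (g ∘ suc) (Fin.suc-injective ∘ inj)
  (λ c → ∖-∋ S (g∈ (suc c)) (λ eq → case inj eq of λ ())))) (∣∖∣< S (g∈ zero))

∑≤ι : ∀ {n} {f : Fin n → ℚ} → (∀ i → f i ≤ 1ℚ) → ∑ f ≤ ι n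
∑≤ι {zero}  _ = ℚ.≤-refl
∑≤ι {suc n} f≤1 = ℚ.≤-trans (ℚ.+-mono-≤ (f≤1 zero) (∑≤ι (f≤1 ∘ suc))) (ℚ.≤-reflexive (sym (ι-suc n)))

neighbours : Graph N → Fin N → Subset N
neighbours G v = ⟪ adj? G v ⟫

-- Repeatedly delete from I a vertex outside P ∣ I ∣, or one with fewer than D
-- neighbours left.  The former weigh at most cost in total; the latter, taken in
-- reverse order, are greedily coloured with D colours, so they weigh at most D.
-- If anything survives, it is a Core.
module Peeling {N} (G : Graph N) (y : Fin N → ℚ) (0≤y : ∀ v → 0ℚ ≤ y v)
  (y≤1 : ∀ S → Independent G S → weight y S ≤ 1ℚ) (D : ℕ)
  (P : ℕ → Subset N) (cost : ℕ → ℚ) (0≤cost : 0ℚ ≤ cost 0) (cost-mono : ∀ m → cost m ≤ cost (suc m))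
  (cost-step : ∀ m v → v ∉ P (suc m) → cost m + y v ≤ cost (suc m)) where

  Core : Subset N → Set
  Core I = 1 ℕ.≤ Subset.∣ I ∣ × I ⊆ P Subset.∣ I ∣ × (∀ v → v ∈ I → D ℕ.≤ Subset.∣ I ∩ neighbours G v ∣)

  HasCore : Subset N → Set
  HasCore I = ∃[ I′ ] (I′ ⊆ I × Core I′)

  -- The classes need not exhaust I; the light vertices lie in none of them and are paid for by c.
  record Peeled (I : Subset N) (c : ℚ) : Set where
    field
      class       : Fin D → Subset N
      independent : ∀ k → Independent G (class k)
      class⊆      : ∀ k → class k ⊆ I
      disjoint    : ∀ {k k' u} → u ∈ class k → u ∈ class k' → k ≡ k'
      weight≤     : weight y I ≤ ∑ (λ k → weight y (class k)) + c

  peeled-weaken : ∀ {I c c'} → c ≤ c' → Peeled I c → Peeled I c'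
  peeled-weaken c≤c' p = record
    { class = class ; independent = independent ; class⊆ = class⊆ ; disjoint = disjoint
    ; weight≤ = ℚ.≤-trans weight≤ (ℚ.+-monoʳ-≤ (∑ (λ k → weight y (class k))) c≤c') }
    where open Peeled p

  peel-light : ∀ {I v c c'} → c + y v ≤ c' → Peeled (I ∖ v) c → Peeled I c'
  peel-light {I} {v} {c} {c'} c+y≤c' p = record
    { class = class ; independent = independent ; class⊆ = λ k → ∖-⊆ I v ∘ class⊆ k ; disjoint = disjoint
    ; weight≤ = ℚ.≤-trans (weight-∖ 0≤y I v) (ℚ.≤-trans (ℚ.+-monoˡ-≤ (y v) weight≤)
        (ℚ.≤-trans (ℚ.≤-reflexive (ℚ.+-assoc (∑ (λ k → weight y (class k))) c (y v))) (ℚ.+-monoʳ-≤ (∑ (λ k → weight y (class k))) c+y≤c'))) }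
    where open Peeled p

  peel-sparse : ∀ {I v c} → v ∈ V G → v ∈ I → ¬ (D ℕ.≤ Subset.∣ I ∩ neighbours G v ∣) → Peeled (I ∖ v) c → Peeled I c
  peel-sparse {I} {v} {c} v∈V v∈I sparse p = record
    { class = class' ; independent = independent' ; class⊆ = class⊆' ; disjoint = disjoint'
    ; weight≤ = ℚ.≤-trans (weight-∖ 0≤y I v) (ℚ.≤-trans (ℚ.+-monoˡ-≤ (y v) weight≤)
        (by (diff heavier) (eq (∑ (λ k → weight y (class k))) c (y v) (∑ (λ k → weight y (class' k)))))) }
    where
    open Peeled p
    eq : ∀ s c y s' → s' + c ≡ (s + c + y) + (s' - (s + y))
    eq = solve-∀ ℚ-ring
    blocked? : ∀ k → Dec (∃[ u ] (u ∈ class k × Adj G v u))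
    blocked? k = Fin.any? (λ u → (u ∈? class k) ×-dec adj? G v u)
    -- If each class contained a neighbour of v, disjointness would make these D distinct neighbours
    -- of v in I.
    free : ∃[ k ] ¬ (∃[ u ] (u ∈ class k × Adj G v u))
    free with Fin.all? blocked?
    ... | no ¬all = Fin.¬∀⟶∃¬ D _ blocked? ¬all
    ... | yes all = contradiction (injection⇒≤∣∣ (I ∩ neighbours G v) (proj₁ ∘ all)
          (λ {k} {k'} eq → disjoint (proj₁ (proj₂ (all k))) (subst (_∈ class k') (sym eq) (proj₁ (proj₂ (all k')))))
          (λ k → x∈p∩q⁺ (∖-⊆ I v (class⊆ k (proj₁ (proj₂ (all k)))) , ∈-⟪⟫⁺ (adj? G v) (proj₂ (proj₂ (all k)))))) sparse
    k₀ : Fin D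
    k₀ = proj₁ free
    class'? : ∀ k u → Dec (u ∈ class k ⊎ (u ≡ v × k ≡ k₀))
    class'? k u = (u ∈? class k) ⊎-dec ((u Fin.≟ v) ×-dec (k Fin.≟ k₀))
    class' : Fin D → Subset N
    class' k = ⟪ class'? k ⟫
    v∉ : ∀ k → v ∉ class k
    v∉ k v∈ = ∖-∌ I v (class⊆ k v∈)
    class⊆' : ∀ k → class' k ⊆ I
    class⊆' k u∈ with ∈-⟪⟫⁻ (class'? k) u∈
    ... | inj₁ u∈k        = ∖-⊆ I v (class⊆ k u∈k)
    ... | inj₂ (refl , _) = v∈I
    disjoint' : ∀ {k k' u} → u ∈ class' k → u ∈ class' k' → k ≡ k'
    disjoint' {k} {k'} u∈ u∈' with ∈-⟪⟫⁻ (class'? k) u∈ | ∈-⟪⟫⁻ (class'? k') u∈'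
    ... | inj₁ a          | inj₁ b           = disjoint a b
    ... | inj₁ a          | inj₂ (refl , _)  = contradiction a (v∉ k)
    ... | inj₂ (refl , _) | inj₁ b           = contradiction b (v∉ k')
    ... | inj₂ (_ , lin)    | inj₂ (_ , lin')    = trans lin (sym lin')
    independent' : ∀ k → Independent G (class' k)
    independent' k = inV , nonadjacent
      where
      inV : class' k ⊆ V G
      inV u∈ with ∈-⟪⟫⁻ (class'? k) u∈
      ... | inj₁ u∈k        = proj₁ (independent k) u∈k
      ... | inj₂ (refl , _) = v∈V
      nonadjacent : ∀ {i j} → i ∈ class' k → j ∈ class' k → ¬ Adj G i j
      nonadjacent {i} {j} i∈ j∈ adj with ∈-⟪⟫⁻ (class'? k) i∈ | ∈-⟪⟫⁻ (class'? k) j∈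
      ... | inj₁ a             | inj₁ b             = proj₂ (independent k) a b adj
      ... | inj₁ a             | inj₂ (refl , refl) = proj₂ free (i , a , adj-sym G adj)
      ... | inj₂ (refl , refl) | inj₁ b             = proj₂ free (j , b , adj)
      ... | inj₂ (refl , _)    | inj₂ (refl , _)    = adj-irrefl G adj
    class-weight : ∀ k → weight y (class k) + δ k₀ k * y v ≤ weight y (class' k)
    class-weight k = by-class (k Fin.≟ k₀)
      where
      by-class : Dec (k ≡ k₀) → weight y (class k) + δ k₀ k * y v ≤ weight y (class' k)
      by-class (yes refl) = ℚ.≤-trans (ℚ.≤-reflexive (trans (cong (λ ζ → weight y (class k) + ζ) (trans (cong (_* y v) (δ-refl k)) (trans (ℚ.*-identityˡ (y v)) (sym (∑-δ v y))))) (sym (∑-distrib-+ (λ u → ind (u ∈? class k) * y u) (λ u → δ v u * y u)))))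
          (∑-mono (λ u → pointwise u (u Fin.≟ v)))
        where
        pointwise : ∀ u → Dec (u ≡ v) → ind (u ∈? class k) * y u + δ v u * y u ≤ ind (u ∈? class' k) * y u
        pointwise u (yes refl) = ℚ.≤-reflexive (trans (cong₂ (λ a b → a * y u + b * y u) (ind-no (u ∈? class k) (v∉ k)) (δ-refl u))
            (trans (eq' (y u)) (cong (_* y u) (sym (ind-yes (u ∈? class' k) (∈-⟪⟫⁺ (class'? k) (inj₂ (refl , refl))))))))
          where
          eq' : ∀ y → 0ℚ * y + 1ℚ * y ≡ 1ℚ * y
          eq' = solve-∀ ℚ-ring
        pointwise u (no u≢v) = ℚ.≤-reflexive (trans (cong (λ b → ind (u ∈? class k) * y u + b * y u) (δ-≢ (u≢v ∘ sym)))
            (trans (eq' (ind (u ∈? class k)) (y u)) (cong (_* y u) (ind-⇔ (u ∈? class k) (u ∈? class' k) (λ a → ∈-⟪⟫⁺ (class'? k) (inj₁ a))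
              (λ a → [ id , (λ lin → contradiction (proj₁ lin) u≢v) ]′ (∈-⟪⟫⁻ (class'? k) a))))))
          where
          eq' : ∀ i y → i * y + 0ℚ * y ≡ i * y
          eq' = solve-∀ ℚ-ring
      by-class (no k≢k₀) = ℚ.≤-trans (ℚ.≤-reflexive (trans (cong (λ b → weight y (class k) + b * y v) (δ-≢ (k≢k₀ ∘ sym))) (trans (cong (λ ζ → weight y (class k) + ζ) (ℚ.*-zeroˡ (y v))) (ℚ.+-identityʳ _))))
          (∑-mono (λ u → ℚ.≤-reflexive (cong (_* y u) (ind-⇔ (u ∈? class k) (u ∈? class' k) (λ a → ∈-⟪⟫⁺ (class'? k) (inj₁ a))
              (λ a → [ id , (λ lin → contradiction (proj₂ lin) k≢k₀) ]′ (∈-⟪⟫⁻ (class'? k) a))))))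
    heavier : ∑ (λ k → weight y (class k)) + y v ≤ ∑ (λ k → weight y (class' k))
    heavier = ℚ.≤-trans (ℚ.≤-reflexive (trans (cong (λ ζ → ∑ (λ k → weight y (class k)) + ζ) (sym (∑-δ k₀ (λ _ → y v)))) (sym (∑-distrib-+ (λ k → weight y (class k)) (λ k → δ k₀ k * y v))))) (∑-mono class-weight)

  readd : ∀ I v {c c'} → (Peeled (I ∖ v) c → Peeled I c') → HasCore (I ∖ v) ⊎ Peeled (I ∖ v) c → HasCore I ⊎ Peeled I c'
  readd I v f (inj₁ (I′ , I′⊆ , core)) = inj₁ (I′ , (λ u∈ → ∖-⊆ I v (I′⊆ u∈)) , core)
  readd I v f (inj₂ p)                 = inj₂ (f p)

  -- The induction is on a bound m for the size of I. A light vertex is deleted only when I has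
  -- exactly that size, so each size is charged at most once, which is what `cost` provides for.
  peel : ∀ m I → Subset.∣ I ∣ ℕ.≤ m → I ⊆ V G → HasCore I ⊎ Peeled I (cost m)
  peel zero I ∣I∣≤0 I⊆V = inj₂ (record
    { class = λ _ → Subset.⊥ ; independent = λ _ → (λ u∈ → contradiction u∈ Subsetₚ.∉⊥) , (λ u∈ → contradiction u∈ Subsetₚ.∉⊥)
    ; class⊆ = λ _ u∈ → contradiction u∈ Subsetₚ.∉⊥ ; disjoint = λ u∈ → contradiction u∈ Subsetₚ.∉⊥
    ; weight≤ = ℚ.≤-trans (ℚ.≤-reflexive (∑-zero (λ v → trans (cong (_* y v) (ind-no (v ∈? I) (λ v∈ → ℕₚ.n≮0 (ℕₚ.<-≤-trans (∣∖∣< I v∈) ∣I∣≤0)))) (ℚ.*-zeroˡ (y v)))))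
        (0≤∑ {D} (λ _ → 0≤∑ {N} (λ v → 0≤ind (v ∈? Subset.⊥) ⊗ 0≤y v)) ⊕ 0≤cost) })
  peel (suc m) I ∣I∣≤ I⊆V with ℕₚ.m≤n⇒m<n∨m≡n ∣I∣≤
  ... | inj₁ (s≤s ∣I∣≤m) = [ inj₁ , inj₂ ∘ peeled-weaken (cost-mono m) ]′ (peel m I ∣I∣≤m I⊆V)
  ... | inj₂ ∣I∣≡ with Fin.any? (λ v → (v ∈? I) ×-dec ¬? (v ∈? P (suc m)))
  ...   | yes (v , v∈ , v∉P) = readd I v (peel-light (cost-step m v v∉P))
          (peel m (I ∖ v) (ℕₚ.≤-pred (ℕₚ.<-≤-trans (∣∖∣< I v∈) ∣I∣≤)) (I⊆V ∘ ∖-⊆ I v))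
  ...   | no ¬light with Fin.any? (λ v → (v ∈? I) ×-dec ¬? (D ℕₚ.≤? Subset.∣ I ∩ neighbours G v ∣))
  ...     | yes (v , v∈ , sparse) = readd I v (peeled-weaken (cost-mono m) ∘ peel-sparse (I⊆V v∈) v∈ sparse)
            (peel m (I ∖ v) (ℕₚ.≤-pred (ℕₚ.<-≤-trans (∣∖∣< I v∈) ∣I∣≤)) (I⊆V ∘ ∖-⊆ I v))
  ...     | no ¬sparse = inj₁ (I , id , subst (1 ℕ.≤_) (sym ∣I∣≡) (s≤s z≤n) ,
            (λ {v} v∈ → subst (λ k → v ∈ P k) (sym ∣I∣≡) (decidable-stable (v ∈? P (suc m)) (λ v∉ → ¬light (v , v∈ , v∉)))) ,
            (λ v v∈ → decidable-stable (D ℕₚ.≤? Subset.∣ I ∩ neighbours G v ∣) (λ h → ¬sparse (v , v∈ , h))))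

  heavy⇒core : ∀ I → I ⊆ V G → ι D + cost N < weight y I → HasCore I
  heavy⇒core I I⊆V heavy with peel N I (Subsetₚ.∣p∣≤n I) I⊆V
  ... | inj₁ core = core
  ... | inj₂ p = contradiction (ℚ.≤-trans weight≤ (ℚ.+-monoˡ-≤ (cost N) (∑≤ι (λ k → y≤1 (class k) (independent k))))) (<⇒≱ heavy)
    where open Peeled p

-- Vertices in decreasing order of weight

sumℚ-tabulate : ∀ {n} (f : Fin n → ℚ) → sumℚ (List.map f (List.allFin n)) ≡ ∑ f
sumℚ-tabulate f = trans (cong sumℚ (List.map-tabulate id f)) (go f)
  where
  go : ∀ {n} (f : Fin n → ℚ) → sumℚ (List.tabulate f) ≡ ∑ f
  go {zero}  f = refl
  go {suc n} f = cong (λ ζ → f zero + ζ) (go (f ∘ suc))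

-- The default 0 keeps a decreasing sequence of nonnegative weights decreasing past its end, so
-- positions m T beyond the last vertex are harmless.
at : List ℚ → ℕ → ℚ
at []       _       = 0ℚ
at (x ∷ _)  zero    = x
at (_ ∷ xs) (suc i) = at xs i

module Prefixes {N} (y : Fin N → ℚ) (0≤y : ∀ v → 0ℚ ≤ y v) (T : ℕ) where
  order : DecTotalOrder 0ℓ 0ℓ 0ℓ
  -- Negation turns the ascending sort into one by decreasing weight.
  order = On.decTotalOrder ℚ.≤-decTotalOrder (λ v → - y v)

  vertices : List (Fin N)
  vertices = Sort.sort order (List.allFin N)

  z : ℕ → ℚ
  z = at (List.map y vertices)

  prefix? : ∀ m v → Dec (v ∈ₗ List.take (m ℕ.* T) vertices)
  prefix? m v = any? (v Fin.≟_) (List.take (m ℕ.* T) vertices)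

  prefix : ℕ → Subset N
  prefix m = ⟪ prefix? m ⟫

  ∣prefix∣≤ : ∀ m → Subset.∣ prefix m ∣ ℕ.≤ m ℕ.* T
  ∣prefix∣≤ m = ℕₚ.≤-trans (∣∣≤length (prefix m) _ (∈-⟪⟫⁻ (prefix? m)))
    (ℕₚ.≤-trans (ℕₚ.≤-reflexive (List.length-take (m ℕ.* T) vertices)) (ℕₚ.m⊓n≤m (m ℕ.* T) _))

  0≤at : ∀ xs i → 0ℚ ≤ at (List.map y xs) i
  0≤at []       _       = ℚ.≤-refl
  0≤at (x ∷ xs) zero    = 0≤y x
  0≤at (_ ∷ xs) (suc i) = 0≤at xs i

  _≽_ : Fin N → Fin N → Set
  u ≽ v = - y u ≤ - y v

  head≥ : ∀ {x xs v} → Linked _≽_ (x ∷ xs) → v ∈ₗ x ∷ xs → y v ≤ y x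
  head≥ _ (here refl) = ℚ.≤-refl
  head≥ {x} {w ∷ _} (x≽w Linked.∷ sorted) (there v∈) = ℚ.≤-trans (head≥ sorted v∈) (by (diff x≽w) (eq (y w) (y x)))
    where
    eq : ∀ w x → x ≡ w + (- w - (- x))
    eq = solve-∀ ℚ-ring

  drop≤at : ∀ xs i {v} → Linked _≽_ xs → v ∈ₗ List.drop i xs → y v ≤ at (List.map y xs) i
  drop≤at (x ∷ xs)     zero    sorted       v∈ = head≥ sorted v∈
  drop≤at (x ∷ w ∷ xs) (suc i) (_ Linked.∷ sorted) v∈ = drop≤at (w ∷ xs) i sorted v∈
  drop≤at (x ∷ [])     (suc zero)    _ ()
  drop≤at (x ∷ [])     (suc (suc i)) _ ()

  at-antitone : ∀ xs i → Linked _≽_ xs → at (List.map y xs) (suc i) ≤ at (List.map y xs) i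
  at-antitone []           i       sorted       = ℚ.≤-refl
  at-antitone (x ∷ [])     zero    sorted       = 0≤y x
  at-antitone (x ∷ [])     (suc i) sorted       = ℚ.≤-refl
  at-antitone (x ∷ w ∷ xs) zero    sorted       = head≥ sorted (there (here refl))
  at-antitone (x ∷ w ∷ xs) (suc i) (_ Linked.∷ sorted) = at-antitone (w ∷ xs) i sorted

  sorted : Linked _≽_ vertices
  sorted = Sort.sort-↗ order (List.allFin N)

  outside-prefix : ∀ m v → v ∉ prefix m → y v ≤ z (m ℕ.* T)
  outside-prefix m v v∉ with ∈-++⁻ (List.take (m ℕ.* T) vertices) (subst (v ∈ₗ_) (sym (List.take++drop≡id (m ℕ.* T) vertices))
    (∈-resp-↭ (↭-sym (Sort.sort-↭ order (List.allFin N))) (∈-allFin v)))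
  ... | inj₁ v∈take = contradiction (∈-⟪⟫⁺ (prefix? m) v∈take) v∉
  ... | inj₂ v∈drop = drop≤at vertices (m ℕ.* T) sorted v∈drop

  -- Positions count from 0, so `z (m T)` is the largest weight outside the prefix of length m T,
  -- and it is at most the average of the T weights just before it. These blocks are disjoint for
  -- different m; hence T times the cost never exceeds the total weight, however large m is.
  cost : ℕ → ℚ
  cost zero    = 0ℚ
  cost (suc m) = cost m + z (suc m ℕ.* T)

  cost-mono : ∀ m → cost m ≤ cost (suc m)
  cost-mono m = by (0≤at vertices (suc m ℕ.* T)) refl

  cost-step : ∀ m v → v ∉ prefix (suc m) → cost m + y v ≤ cost (suc m)
  cost-step m v v∉ = ℚ.+-monoʳ-≤ (cost m) (outside-prefix (suc m) v v∉)

  partial : ℕ → ℚ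
  partial zero    = 0ℚ
  partial (suc k) = partial k + z k

  partial-block : ∀ k j → partial k + ι j * z (j ℕ.+ k) ≤ partial (j ℕ.+ k)
  partial-block k zero    = ℚ.≤-reflexive (trans (cong (λ ζ → partial k + ζ) (ℚ.*-zeroˡ (z k))) (ℚ.+-identityʳ _))
  partial-block k (suc j) = by (diff (partial-block k j) ⊕ (0≤1 ⊕ 0≤ι j) ⊗ diff (at-antitone vertices (j ℕ.+ k) sorted))
    (trans (eq (partial k) (partial (j ℕ.+ k)) (z (j ℕ.+ k)) (z (suc (j ℕ.+ k))) (ι j))
      (cong (λ c → partial k + c * z (suc (j ℕ.+ k)) + (partial (j ℕ.+ k) - (partial k + ι j * z (j ℕ.+ k)) + (1ℚ + ι j) * (z (j ℕ.+ k) - z (suc (j ℕ.+ k))))) (sym (ι-suc j))))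
    where
    eq : ∀ p q a b j → q + a ≡ p + (1ℚ + j) * b + (q - (p + j * a) + (1ℚ + j) * (a - b))
    eq = solve-∀ ℚ-ring

  cost-partial : ∀ m → ι T * cost m ≤ partial (m ℕ.* T)
  cost-partial zero    = ℚ.≤-reflexive (ℚ.*-zeroʳ (ι T))
  cost-partial (suc m) = ℚ.≤-trans (ℚ.≤-reflexive (ℚ.*-distribˡ-+ (ι T) (cost m) _))
    (ℚ.≤-trans (ℚ.+-monoˡ-≤ _ (cost-partial m)) (partial-block (m ℕ.* T) T))

  partial≤ : ∀ k → partial k ≤ sumℚ (List.map y vertices)
  partial≤ k = ℚ.≤-trans (ℚ.≤-reflexive (take-sum k)) (take≤ vertices k)
    where
    take-suc : ∀ xs k → sumℚ (List.take (suc k) xs) ≡ sumℚ (List.take k xs) + at xs k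
    take-suc []       zero    = refl
    take-suc []       (suc k) = refl
    take-suc (x ∷ xs) zero    = ℚ.+-comm x 0ℚ
    take-suc (x ∷ xs) (suc k) = trans (cong (λ ζ → x + ζ) (take-suc xs k)) (sym (ℚ.+-assoc x _ _))
    take-sum : ∀ k → partial k ≡ sumℚ (List.take k (List.map y vertices))
    take-sum zero    = refl
    take-sum (suc k) = trans (cong (_+ z k) (take-sum k)) (sym (take-suc (List.map y vertices) k))
    0≤sum : ∀ xs → 0ℚ ≤ sumℚ (List.map y xs)
    0≤sum []       = ℚ.≤-refl
    0≤sum (x ∷ xs) = 0≤y x ⊕ 0≤sum xs
    take≤ : ∀ xs k → sumℚ (List.take k (List.map y xs)) ≤ sumℚ (List.map y xs)
    take≤ xs       zero    = 0≤sum xs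
    take≤ []       (suc k) = ℚ.≤-refl
    take≤ (x ∷ xs) (suc k) = ℚ.+-monoʳ-≤ (y x) (take≤ xs k)

  sum-vertices : sumℚ (List.map y vertices) ≡ ∑ y
  sum-vertices = trans (permute (Sort.sort-↭ order (List.allFin N))) (sumℚ-tabulate y)
    where
    permute : ∀ {xs ys} → xs ↭ ys → sumℚ (List.map y xs) ≡ sumℚ (List.map y ys)
    permute ↭.refl         = refl
    permute (↭.prep x p)   = cong (λ ζ → y x + ζ) (permute p)
    permute (↭.swap u v p) = trans (cong (λ s → y u + (y v + s)) (permute p)) (eq (y u) (y v) _)
      where
      eq : ∀ a b s → a + (b + s) ≡ b + (a + s)
      eq = solve-∀ ℚ-ring
    permute (↭.trans p q)  = trans (permute p) (permute q)

  cost≤ : ∀ m → ι T * cost m ≤ ∑ y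
  cost≤ m = ℚ.≤-trans (cost-partial m) (ℚ.≤-trans (partial≤ (m ℕ.* T)) (ℚ.≤-reflexive sum-vertices))

-- Edges inside a vertex set

∑-lookup : ∀ {a} {A : Set a} (f : A → ℚ) (xs : List A) → ∑ (λ k → f (List.lookup xs k)) ≡ sumℚ (List.map f xs)
∑-lookup f []       = refl
∑-lookup f (x ∷ xs) = cong (λ ζ → f x + ζ) (∑-lookup f xs)

sumℚ-cartesianProduct : ∀ {a b} {A : Set a} {B : Set b} (f : A × B → ℚ) xs ys →
  sumℚ (List.map f (List.cartesianProduct xs ys)) ≡ sumℚ (List.map (λ x → sumℚ (List.map (λ y → f (x , y)) ys)) xs)
sumℚ-cartesianProduct f []       ys = refl
sumℚ-cartesianProduct f (x ∷ xs) ys = trans (cong sumℚ (List.map-++ f (List.map (x ,_) ys) _))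
  (trans (sumℚ-++ (List.map f (List.map (x ,_) ys)) _) (cong₂ _+_ (cong sumℚ (sym (List.map-∘ ys))) (sumℚ-cartesianProduct f xs ys)))

module Edges {N} (G : Graph N) where
  edge : Fin (List.length (edges G)) → Fin N × Fin N
  edge = List.lookup (edges G)

  within? : ∀ S k → Dec (proj₁ (edge k) ∈ S × proj₂ (edge k) ∈ S)
  within? S k = (proj₁ (edge k) ∈? S) ×-dec (proj₂ (edge k) ∈? S)

  within : Subset N → Outcome G
  within S = ⟪ within? S ⟫

  edge-adj : ∀ k → Adj G (proj₁ (edge k)) (proj₂ (edge k))
  edge-adj k = proj₂ (proj₂ (∈-filter⁻ (λ (i , j) → (i Fin.<? j) ×-dec adj? G i j) {xs = List.cartesianProduct (List.allFin N) (List.allFin N)} (∈-lookup {xs = edges G} k)))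

  independent⇒avoids : ∀ {S ω} → Independent (retain G ω) S → avoids (within S) ω ≡ true
  independent⇒avoids {S} {ω} (_ , indS) = disjoint⇒avoids (within S) ω λ {k} k∈S k∈ω →
    let (i∈ , j∈) = ∈-⟪⟫⁻ (within? S) k∈S in indS i∈ j∈ (edge-adj k , k , k∈ω , inj₁ refl)

  -- The degree sum runs over ordered pairs, whereas `edges` lists each edge once with i < j;
  -- splitting by the order of the endpoints gives two equal halves. This is why cores are required
  -- to have minimum degree 2d.
  handshake : ∀ S d → (∀ v → v ∈ S → d ℕ.+ d ℕ.≤ Subset.∣ S ∩ neighbours G v ∣) → d ℕ.* Subset.∣ S ∣ ℕ.≤ Subset.∣ within S ∣
  handshake S d min-degree = ι-cancel (cancelˡ (0<1+ι 1) (ℚ.≤-trans (ℚ.≤-reflexive lhs) (ℚ.≤-trans (∑-mono degree≥) (ℚ.≤-reflexive (trans split (cong (ι 2 *_) (sym edges≡)))))))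
    where
    a : Fin N → Fin N → ℚ
    a v u = ind (v ∈? S) * (ind (u ∈? S) * ind (adj? G v u))
    a-sym : ∀ v u → a v u ≡ a u v
    a-sym v u = trans (eq (ind (v ∈? S)) (ind (u ∈? S)) (ind (adj? G v u))) (cong (λ i → ind (u ∈? S) * (ind (v ∈? S) * i)) (ind-⇔ (adj? G v u) (adj? G u v) (adj-sym G) (adj-sym G)))
      where
      eq : ∀ x y z → x * (y * z) ≡ y * (x * z)
      eq = solve-∀ ℚ-ring
    a-irrefl : ∀ v → a v v ≡ 0ℚ
    a-irrefl v = trans (cong (λ i → ind (v ∈? S) * (ind (v ∈? S) * i)) (ind-no (adj? G v v) (adj-irrefl G))) (eq (ind (v ∈? S)))
      where
      eq : ∀ x → x * (x * 0ℚ) ≡ 0ℚ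
      eq = solve-∀ ℚ-ring
    ordered : Fin N → Fin N → ℚ
    ordered v u = ind (v Fin.<? u) * a v u
    half = ∑ (λ v → ∑ (λ u → ordered v u))
    lhs : ι 2 * ι (d ℕ.* Subset.∣ S ∣) ≡ ∑ (λ v → ind (v ∈? S) * (ι d + ι d))
    lhs = trans (cong (ι 2 *_) (trans (ι-* d Subset.∣ S ∣) (cong (ι d *_) (ι∣∣ S)))) (trans (eq (ι d) (∑ (λ v → ind (v ∈? S)))) (*-distribʳ-sum (ι d + ι d) (λ v → ind (v ∈? S))))
      where
      eq : ∀ d s → ι 2 * (d * s) ≡ s * (d + d)
      eq = solve-∀ ℚ-ring
    degree≥ : ∀ v → ind (v ∈? S) * (ι d + ι d) ≤ ∑ (a v)
    degree≥ v with v ∈? S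
    ... | no _   = ℚ.≤-trans (ℚ.≤-reflexive (ℚ.*-zeroˡ (ι d + ι d))) (0≤∑ (λ u → ℚ.≤-refl ⊗ (0≤ind (u ∈? S) ⊗ 0≤ind (adj? G v u))))
    ... | yes v∈ = ℚ.≤-trans (ℚ.≤-reflexive (trans (ℚ.*-identityˡ _) (sym (ι-+ d d)))) (ℚ.≤-trans (ι-mono (min-degree v v∈))
      (ℚ.≤-reflexive (trans (ι∣∣ (S ∩ neighbours G v)) (∑-cong λ u → trans
        (ind-× (u ∈? S) (adj? G v u) (u ∈? (S ∩ neighbours G v)) (λ h → let (p , q) = x∈p∩q⁻ S (neighbours G v) h in p , ∈-⟪⟫⁻ (adj? G v) q) (λ p q → x∈p∩q⁺ (p , ∈-⟪⟫⁺ (adj? G v) q)))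
        (sym (ℚ.*-identityˡ _))))))
    split : ∑ (λ v → ∑ (a v)) ≡ ι 2 * half
    split = trans (∑-cong (λ v → trans (∑-cong (λ u → pointwise v u)) (∑-distrib-+ (ordered v) (λ u → ordered u v)))) (trans (∑-distrib-+ (λ v → ∑ (ordered v)) (λ v → ∑ (λ u → ordered u v)))
      (trans (cong (λ ζ → half + ζ) (∑-comm (λ v u → ordered u v))) (eq half)))
      where
      eq : ∀ h → h + h ≡ ι 2 * h
      eq = solve-∀ ℚ-ring
      pointwise : ∀ v u → a v u ≡ ordered v u + ordered u v
      pointwise v u with v Fin.<? u | u Fin.<? v
      ... | yes v<u | yes u<v = contradiction u<v (ℕₚ.<-asym v<u)
      ... | yes _   | no _    = trans (sym (ℚ.*-identityˡ (a v u))) (trans (sym (ℚ.+-identityʳ _)) (cong (λ ζ → 1ℚ * a v u + ζ) (sym (ℚ.*-zeroˡ (a u v)))))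
      ... | no _    | yes _   = trans (a-sym v u) (trans (sym (ℚ.*-identityˡ (a u v))) (trans (sym (ℚ.+-identityˡ _)) (cong (_+ 1ℚ * a u v) (sym (ℚ.*-zeroˡ (a v u))))))
      ... | no v≮u  | no u≮v  with Fin.toℕ-injective (ℕₚ.≤-antisym (ℕₚ.≮⇒≥ u≮v) (ℕₚ.≮⇒≥ v≮u))
      ...   | refl = trans (a-irrefl v) (sym (trans (cong₂ _+_ (ℚ.*-zeroˡ (a v v)) (ℚ.*-zeroˡ (a v v))) refl))
    edges≡ : ι Subset.∣ within S ∣ ≡ half
    edges≡ = trans (ι∣∣ (within S)) (trans (∑-cong (ind-⟪⟫ (within? S)))
      (trans (∑-lookup (λ (i , j) → ind ((i ∈? S) ×-dec (j ∈? S))) (edges G))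
      (trans (sumℚ-filter (λ (i , j) → (i Fin.<? j) ×-dec adj? G i j) _ (List.cartesianProduct (List.allFin N) (List.allFin N)))
      (trans (sumℚ-cartesianProduct _ (List.allFin N) (List.allFin N))
      (trans (sumℚ-tabulate (λ i → sumℚ (List.map (counted i) (List.allFin N)))) (∑-cong (λ i → trans (sumℚ-tabulate (counted i)) (∑-cong (λ j → pointwise i j)))))))))
      where
      counted : Fin N → Fin N → ℚ
      counted i j = ind ((i Fin.<? j) ×-dec adj? G i j) * ind ((i ∈? S) ×-dec (j ∈? S))
      pointwise : ∀ i j → counted i j ≡ ordered i j
      pointwise i j = trans (cong₂ _*_ (ind-× (i Fin.<? j) (adj? G i j) ((i Fin.<? j) ×-dec adj? G i j) id _,_) (ind-× (i ∈? S) (j ∈? S) ((i ∈? S) ×-dec (j ∈? S)) id _,_))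
        (eq (ind (i Fin.<? j)) (ind (adj? G i j)) (ind (i ∈? S)) (ind (j ∈? S)))
        where
        eq : ∀ o a x y → o * a * (x * y) ≡ o * (x * (y * a))
        eq = solve-∀ ℚ-ring

-- The sampled graph

total-nonneg : ∀ {G : Graph N} {w} → IsFractionalColouring G w → 0ℚ ≤ total w
total-nonneg {N} {w = w} col = ℚ.≤-trans (0≤∑ {2^ N} (λ j → IsFractionalColouring.nonneg col (subset N j))) (ℚ.≤-reflexive (sym (sumℚ-subsets w)))

-- Here p is rational, a value of the given sequence at one index, and the two probabilistic
-- hypotheses are cleared of denominators.
module Sampling {N} (G : Graph N) {t p} (d : ℕ) (2≤t : ι 2 ≤ t) (0≤p : 0ℚ ≤ p) (p≤1 : p ≤ 1ℚ)
  (y : Fin N → ℚ) (0≤y : ∀ v → 0ℚ ≤ y v) (y≤1 : ∀ S → Independent G S → weight y S ≤ 1ℚ) (∑y : ∑ y ≡ t)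
  (T₀ : ℕ) (t≤T : t ≤ ι (suc T₀)) (T≤t+1 : ι (suc T₀) ≤ t + 1ℚ) (D : Outcome G → Bool)
  (likely : 1ℚ < ι 2 * t * ℙ p D) (rare : ι 24 * (t * t) * (1ℚ - p) ^ d ≤ 1ℚ) where

  private
    0≤t : 0ℚ ≤ t
    0≤t = ℚ.≤-trans (0≤ι 2) 2≤t
    T′ : ℕ
    T′ = suc T₀
    s q : ℚ
    s = 1ℚ - p
    q = s ^ d
    0≤s : 0ℚ ≤ s
    0≤s = diff p≤1
    s≤1 : s ≤ 1ℚ
    s≤1 = by 0≤p (eq p)
      where
      eq : ∀ p → 1ℚ ≡ 1ℚ - p + p
      eq = solve-∀ ℚ-ring
    0≤q : 0ℚ ≤ q
    0≤q = 0≤^ 0≤s d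

    -- T ≤ t + 1 and t ≥ 2 give 16 T t ≤ 16 t² + 16 t ≤ 24 t².
    16Ttq≤1 : ι 16 * ι T′ * t * q ≤ 1ℚ
    16Ttq≤1 = ℚ.≤-trans (by (0≤ι 16 ⊗ diff T≤t+1 ⊗ 0≤t ⊗ 0≤q ⊕ 0≤ι 8 ⊗ diff 2≤t ⊗ 0≤t ⊗ 0≤q) (eq (ι T′) t q)) rare
      where
      eq : ∀ T t q → ι 24 * (t * t) * q ≡ ι 16 * T * t * q + (ι 16 * (t + 1ℚ - T) * t * q + ι 8 * (t - ι 2) * t * q)
      eq = solve-∀ ℚ-ring

    module P = Prefixes {N} y 0≤y T′
    module Peel = Peeling G y 0≤y y≤1 (d ℕ.+ d) P.prefix P.cost ℚ.≤-refl P.cost-mono P.cost-step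
    module E = Edges G

    cost≤1 : P.cost N ≤ 1ℚ
    cost≤1 = cancelˡ {P.cost N} {1ℚ} {ι T′} (0<1+ι T₀) (ℚ.≤-trans (P.cost≤ N) (ℚ.≤-trans (ℚ.≤-reflexive ∑y) (ℚ.≤-trans t≤T (ℚ.≤-reflexive (sym (ℚ.*-identityʳ (ι T′)))))))

    -- What the union bound keeps of a core: a condition on S alone, free of the outcome, with the
    -- minimum degree replaced by the edge count that it implies.
    Dense : Subset N → Set
    Dense S = (1 ℕ.≤ Subset.∣ S ∣ × S ⊆ P.prefix Subset.∣ S ∣) × d ℕ.* Subset.∣ S ∣ ℕ.≤ Subset.∣ E.within S ∣

    packed? : ∀ S → Dec (1 ℕ.≤ Subset.∣ S ∣ × S ⊆ P.prefix Subset.∣ S ∣)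
    packed? S = (1 ℕₚ.≤? Subset.∣ S ∣) ×-dec (S ⊆? P.prefix Subset.∣ S ∣)

    dense? : ∀ S → Dec (Dense S)
    dense? S = packed? S ×-dec (d ℕ.* Subset.∣ S ∣ ℕₚ.≤? Subset.∣ E.within S ∣)

    core⇒dense : ∀ {S} → Peel.Core S → Dense S
    core⇒dense {S} (1≤ , ⊆P , deg) = (1≤ , ⊆P) , E.handshake S d deg

    dense-rare : ∀ S → ind (dense? S) * ℙ p (avoids (E.within S)) ≤ ind (packed? S) * q ^ Subset.∣ S ∣
    dense-rare S = by-cases (dense? S)
      where
      by-cases : (δ : Dec (Dense S)) → ind δ * ℙ p (avoids (E.within S)) ≤ ind (packed? S) * q ^ Subset.∣ S ∣
      by-cases (no _) = ℚ.≤-trans (ℚ.≤-reflexive (ℚ.*-zeroˡ (ℙ p (avoids (E.within S))))) (0≤ind (packed? S) ⊗ 0≤^ 0≤q Subset.∣ S ∣)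
      by-cases (yes (packed , edges≥)) = ℚ.≤-trans
        (*-monoˡ 0≤1 (ℚ.≤-trans (ℚ.≤-reflexive (ℙ-avoids p (E.within S))) (ℚ.≤-trans (^-antitone 0≤s s≤1 (ℕₚ.≤-trans (ℕₚ.≤-reflexive (ℕₚ.*-comm Subset.∣ S ∣ d)) edges≥))
          (ℚ.≤-reflexive (^-* s Subset.∣ S ∣ d)))))
        (ℚ.≤-reflexive (cong (_* q ^ Subset.∣ S ∣) (sym (ind-yes (packed? S) packed))))

    -- The sum is at most 8 T q, and 2t · 8 T q = 16 T t q ≤ 1 < 2t ℙ(D).
    union-bound : ∑ (λ j → ind (dense? (subset N j)) * ℙ p (avoids (E.within (subset N j)))) < ℙ p D
    union-bound = ℚ.≤-<-trans (ℚ.≤-trans (∑-mono {2^ N} (λ j → dense-rare (subset N j))) (∑ₛ-dense {T₀ = T₀} {q = q} P.prefix P.∣prefix∣≤ 0≤q 4Tq≤½))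
      (ℚ.*-cancelˡ-<-nonNeg (ι 2 * t) {{nonNegative (0≤ι 2 ⊗ 0≤t)}} (ℚ.≤-<-trans (ℚ.≤-trans (ℚ.≤-reflexive (eq (ι T′) t q)) 16Ttq≤1) likely))
      where
      eq : ∀ T t q → ι 2 * t * (ι 8 * T * q) ≡ ι 16 * T * t * q
      eq = solve-∀ ℚ-ring
      4Tq≤½ : ι 4 * ι T′ * q ≤ ½
      4Tq≤½ = by (0≤/ 1 3 ⊗ diff 16Ttq≤1 ⊕ 0≤/ 1 3 ⊕ 0≤ι 4 ⊗ 0≤ι T′ ⊗ 0≤q ⊗ diff 2≤t ⊕ 0≤ι 4 ⊗ 0≤ι T′ ⊗ 0≤q) (eq' (ι T′) t q)
        where
        eq' : ∀ T t q → ½ ≡ ι 4 * T * q + (+ 1 / 4 * (1ℚ - ι 16 * T * t * q) + + 1 / 4 + ι 4 * T * q * (t - ι 2) + ι 4 * T * q)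
        eq' = solve-∀ ℚ-ring

    k : ℚ
    k = ι (d ℕ.+ d) + 1ℚ

  independent-light : ∀ ω → (∀ j → 1ℚ ≤ ind (dense? (subset N j)) → avoids (E.within (subset N j)) ω ≡ false) →
    ∀ S → Independent (retain G ω) S → weight y S ≤ k
  independent-light ω good S (S⊆V , indS) = ℚ.≮⇒≥ λ heavy →
    let (I , I⊆S , core) = Peel.heavy⇒core S S⊆V (ℚ.≤-<-trans (ℚ.+-monoʳ-≤ (ι (d ℕ.+ d)) cost≤1) heavy)
        avoided = E.independent⇒avoids {I} {ω} ((λ v∈ → S⊆V (I⊆S v∈)) , λ i∈ j∈ → indS (I⊆S i∈) (I⊆S j∈))
    in case trans (sym avoided) (not-avoiding I (core⇒dense core)) of λ ()
    where
    not-avoiding : ∀ S → Dense S → avoids (E.within S) ω ≡ false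
    not-avoiding S dense = subst (λ A → avoids (E.within A) ω ≡ false) (subset-index S)
      (good (index S) (ℚ.≤-reflexive (sym (ind-yes (dense? (subset N (index S))) (subst Dense (sym (subset-index S)) dense)))))

  good-outcome : ∃[ ω ] (T (D ω) × (∀ S → Independent (retain G ω) S → weight y S ≤ k))
  good-outcome = let (ω , Dω , good) = ℙ-witness {D = D} (λ j → avoids (E.within (subset N j))) (λ j → ind (dense? (subset N j))) 0≤p p≤1 (λ j → 0≤ind (dense? (subset N j))) union-bound
    in ω , Dω , independent-light ω good

χf-product : ∀ {r} {G X : Graph N} {h k y R} → Ishf r G h → IsSpanningSubgraph X G → 0ℚ ≤ k → (∀ v → 0ℚ ≤ y v) →
  (∀ S → Independent X S → weight y S ≤ k) → ρ≤ r X R →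
  ∃[ q ] (0ℚ ≤ q × fromℚ q ≤ˢ seq R × 0ℚ ≤ h × weight y (V G) ≤ k * h * q)
χf-product {G = G} {X} {h} {k} {y} (_ , maximal) (VX≡VG , _ , X⊆G) 0≤k 0≤y light (q , ((F , (VF≡VX , _) , girth , (w₂ , col₂ , refl) , _) , _) , q≤R)
  with χf-exists (X ∖E F)
... | χ , χH@((w₁ , col₁ , refl) , _) = q , total-nonneg col₂ , q≤R , ℚ.≤-trans (total-nonneg col₁) χ≤h ,
    ℚ.≤-trans (ℚ.≤-reflexive (cong (weight y) (sym VX≡VG))) (ℚ.≤-trans (weak-duality₂ (sym VF≡VX) col₁ col₂ 0≤y light-∩)
      (*-monoʳ (total-nonneg col₂) (*-monoˡ 0≤k χ≤h)))
  where
  χ≤h : total w₁ ≤ h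
  χ≤h = maximal (total w₁) (X ∖E F , ((λ {v} v∈ → subst (v ∈_) VX≡VG v∈) , λ (adj , _) → X⊆G adj) , girth , χH)
  -- Every edge of X lies in F or in X - F, so a set independent in both is independent in X.
  light-∩ : ∀ A B → Independent (X ∖E F) A → Independent F B → weight y (A ∩ B) ≤ k
  light-∩ A B (A⊆V , indA) (_ , indB) = light (A ∩ B) ((λ v∈ → A⊆V (proj₁ (x∈p∩q⁻ A B v∈))) , nonadjacent)
    where
    nonadjacent : ∀ {i j} → i ∈ (A ∩ B) → j ∈ (A ∩ B) → ¬ Adj X i j
    nonadjacent {i} {j} i∈ j∈ adj with adj? F i j
    ... | yes f = indB (proj₂ (x∈p∩q⁻ A B i∈)) (proj₂ (x∈p∩q⁻ A B j∈)) f
    ... | no ¬f = indA (proj₁ (x∈p∩q⁻ A B i∈)) (proj₁ (x∈p∩q⁻ A B j∈)) (adj , ¬f)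

sampling-bound : ∀ {r} (G : Graph N) {t p h} (R : ℝ) (d : ℕ) → Isχf G t → ι 2 ≤ t → 0ℚ ≤ p → p ≤ 1ℚ →
  Ishf r G h → (D : Outcome G → Bool) → (∀ ω → T (D ω) → ρ≤ r (retain G ω) R) →
  1ℚ < ι 2 * t * ℙ p D → ι 24 * (t * t) * (1ℚ - p) ^ d ≤ 1ℚ →
  ∃[ q ] (0ℚ ≤ q × fromℚ q ≤ˢ seq R × 0ℚ ≤ h × t ≤ (ι (d ℕ.+ d) + 1ℚ) * h * q)
sampling-bound {N} {r} G {t} {p} {h} R d χG 2≤t 0≤p p≤1 hG D D⇒ρ likely rare =
  let (y , 0≤y , y≤1 , yV , ∑y) = χf-weight χG
      (T₀ , t≤T , T≤t+1) = positive-ceiling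
      (ω , Dω , light) = Sampling.good-outcome G d 2≤t 0≤p p≤1 y 0≤y y≤1 ∑y T₀ t≤T T≤t+1 D likely rare
      (q , 0≤q , q≤R , 0≤h , bound) = χf-product {G = G} {X = retain G ω} {R = R} hG (refl , id , proj₁) (0≤ι (d ℕ.+ d) ⊕ 0≤1) 0≤y light (D⇒ρ ω Dω)
  in q , 0≤q , q≤R , 0≤h , ℚ.≤-trans (ℚ.≤-reflexive (sym yV)) bound
  where
  positive-ceiling : ∃[ k ] (t ≤ ι (suc k) × ι (suc k) ≤ t + 1ℚ)
  positive-ceiling with ceiling (ℚ.≤-trans (0≤ι 2) 2≤t)
  ... | suc k , h         = k , h
  ... | zero  , (t≤0 , _) = contradiction t≤0 (<⇒≱ (ℚ.<-≤-trans (0<1+ι 1) 2≤t))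

-- Real parameters

x≤∣x∣ : ∀ x → x ≤ ∣ x ∣
x≤∣x∣ x with ℚ.∣p∣≡p∨∣p∣≡-p x
... | inj₁ eq = ℚ.≤-reflexive (sym eq)
... | inj₂ eq = by (ℚ.0≤∣p∣ x ⊕ ℚ.0≤∣p∣ x) (trans eq (trans (lin x) (cong (λ z → x + (z + z)) (sym eq))))
  where
  lin : ∀ x → - x ≡ x + (- x + - x)
  lin = solve-∀ ℚ-ring

∣-∣≤⇒≤ : ∀ {x y ε} → ∣ x - y ∣ ≤ ε → x ≤ y + ε
∣-∣≤⇒≤ {x} {y} {ε} h = by (diff (ℚ.≤-trans (x≤∣x∣ (x - y)) h)) (lin x y ε)
  where
  lin : ∀ x y ε → y + ε ≡ x + (ε - (x - y))
  lin = solve-∀ ℚ-ring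

∣-∣≤⇒≥ : ∀ {x y ε} → ∣ x - y ∣ ≤ ε → y ≤ x + ε
∣-∣≤⇒≥ {x} {y} {ε} h = ∣-∣≤⇒≤ {y} {x} {ε} (ℚ.≤-trans (ℚ.≤-reflexive (trans (sym (ℚ.∣-p∣≡∣p∣ (y - x))) (cong ∣_∣ (lin x y)))) h)
  where
  lin : ∀ x y → - (y - x) ≡ x - y
  lin = solve-∀ ℚ-ring

cauchy-bounded : (x : ℝ) → ∃[ B ] Eventually (λ n → - B ≤ seq x n)
cauchy-bounded x = let (K , h) = isCauchy x 1ℚ (ℚ.positive⁻¹ 1ℚ) in
  1ℚ - seq x K , K , λ n K≤n → by (diff (∣-∣≤⇒≤ {seq x K} {seq x n} (h K n ℕₚ.≤-refl K≤n))) (lin (seq x K) (seq x n))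
  where
  lin : ∀ x y → y ≡ - (1ℚ - x) + (y + 1ℚ - x)
  lin = solve-∀ ℚ-ring

0<½ : 0ℚ < ½
0<½ = ℚ.positive⁻¹ ½

exp-positive : ∀ (z : ℝ) {δ} → 0ℚ < δ → δ ≤ ½ → Eventually (λ n → 1ℚ + (δ + δ) ≤ exp (seq z) n) → Eventually (λ n → δ ≤ seq z n)
exp-positive z 0<δ δ≤½ large = let (B , bounded) = cauchy-bounded z in expSum-sign {B = B} 0<δ δ≤½ bounded large

-- With e ≥ 8/3, 2et exceeds 5t by at least t/3 ≥ 2/3, which covers the tolerance 1/2. Then 5t ≥ 10
-- is ample for the lower bound on the logarithm.
ln-large : ∀ {t} (ℓ : ℝ) → ι 2 ≤ t → IsLn (fromℕˢ 2 *ˢ e *ˢ fromℚ t) ℓ → Eventually (λ n → ι 5 * t ≤ exp (seq ℓ) n × ½ ≤ seq ℓ n)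
ln-large {t} ℓ 2≤t ln = grows ⊓ exp-positive ℓ 0<½ ℚ.≤-refl (ev-map (λ n h → ℚ.≤-trans (by (0≤ι 5 ⊗ diff 2≤t ⊕ 0≤ι 8) (lin₂ t)) h) grows)
  where
  lin₂ : ∀ t → ι 5 * t ≡ 1ℚ + (½ + ½) + (ι 5 * (t - ι 2) + ι 8)
  lin₂ = solve-∀ ℚ-ring
  lin₁ : ∀ t E E₁ → E + ½ ≡ ι 5 * t + ½ + (E + ½ - ι 2 * E₁ * t + (ι 2 * (E₁ - + 8 / 3) * t + (+ 1 / 3 * (t - ι 2) + + 1 / 6)))
  lin₁ = solve-∀ ℚ-ring
  lin₃ : ∀ x y → y ≡ x + (y + ½ - (x + ½))
  lin₃ = solve-∀ ℚ-ring
  0≤t : 0ℚ ≤ t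
  0≤t = ℚ.≤-trans (0≤ι 2) 2≤t
  grows : Eventually (λ n → ι 5 * t ≤ exp (seq ℓ) n)
  grows = ev-map (λ n (close , 3≤n) → by
      (diff (by (diff (∣-∣≤⇒≥ {expSum (seq ℓ n) n} {ι 2 * expSum 1ℚ n * t} close) ⊕ ((0≤ι 2 ⊗ diff (exp1-≥ n 3≤n) ⊗ 0≤t) ⊕ (0≤/ 1 2 ⊗ diff 2≤t ⊕ 0≤/ 1 5))) (lin₁ t (expSum (seq ℓ n) n) (expSum 1ℚ n))))
      (lin₃ (ι 5 * t) (expSum (seq ℓ n) n)))
    (ln ½ 0<½ ⊓ (3 , λ _ h → h))

-- Small enough for 25 d ε ≤ 1; the successor keeps it defined and positive at d = 0.
tolerance : ℕ → ℚ
tolerance d = + 1 / 25 * (+ 1 / suc d)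

0<tolerance : ∀ d → 0ℚ < tolerance d
0<tolerance d = *-pos {+ 1 / 25} {+ 1 / suc d} (ℚ.positive⁻¹ (+ 1 / 25)) (ℚ.positive⁻¹ (+ 1 / suc d) {{ℚ.normalize-pos 1 (suc d)}})

tolerance-≤ : ∀ d → ι 25 * (ι d * tolerance d) ≤ 1ℚ
tolerance-≤ d = by (0≤/ 1 d) (trans (sym (ι-inverse d)) (trans (cong (_* (+ 1 / suc d)) (ι-suc d)) (lin (ι d) (+ 1 / suc d))))
  where
  lin : ∀ k r → (1ℚ + k) * r ≡ ι 25 * (k * (+ 1 / 25 * r)) + r
  lin = solve-∀ ℚ-ring

recip-<⇒1< : ∀ {t x ε} → 0ℚ < t → 0ℚ < ε → 1ℚ * recip (ι 2 * t) + ε ≤ x → 1ℚ < ι 2 * t * x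
recip-<⇒1< {t} {x} {ε} 0<t 0<ε h = ℚ.<-≤-trans
  (ℚ.<-≤-trans (ℚ.≤-<-trans (ℚ.≤-reflexive (sym (ℚ.+-identityʳ 1ℚ))) (ℚ.+-monoʳ-< 1ℚ (*-pos 0<2t 0<ε)))
    (ℚ.≤-reflexive (trans (cong (_+ ι 2 * t * ε) (sym (recip-inverse 0<2t))) (lin (ι 2 * t) (recip (ι 2 * t)) ε))))
  (*-monoˡ (ℚ.<⇒≤ 0<2t) h)
  where
  0<2t : 0ℚ < ι 2 * t
  0<2t = *-pos (0<1+ι 1) 0<t
  lin : ∀ a r ε → a * r + a * ε ≡ a * (1ℚ * r + ε)
  lin = solve-∀ ℚ-ring

-- Since R ≥ 1, the additive error in q ≤ R costs only a slightly larger k.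
absorb : ∀ {t k h q} (R : ℝ) → 1ℚ ≤ k → 0ℚ ≤ h → 0ℚ ≤ q → fromℕˢ 1 ≤ˢ seq R → fromℚ q ≤ˢ seq R → t ≤ k * h * q →
  Eventually (λ n → ½ ≤ seq R n × t ≤ (k + + 1 / 5) * h * seq R n)
absorb {t} {k} {h} {q} R 1≤k 0≤h 0≤q 1≤R q≤R bound = ev-map step (1≤R ½ 0<½ ⊓ q≤R ε 0<ε)
  where
  0<k : 0ℚ < k
  0<k = ℚ.<-≤-trans (ℚ.positive⁻¹ 1ℚ) 1≤k
  -- Then k ε = 1/10, so passing from q to R + ε costs h/10, at most (1/5) h R since R ≥ 1/2.
  ε = + 1 / 10 * recip k
  0<recip : 0ℚ < recip k
  0<recip = ℚ.≰⇒> λ recip≤0 → <⇒≱ (ℚ.positive⁻¹ 1ℚ) (ℚ.≤-trans (ℚ.≤-reflexive (sym (recip-inverse 0<k))) (ℚ.≤-trans (*-monoˡ (ℚ.<⇒≤ 0<k) recip≤0) (ℚ.≤-reflexive (ℚ.*-zeroʳ k))))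
  0<ε : 0ℚ < ε
  0<ε = *-pos (ℚ.positive⁻¹ (+ 1 / 10)) 0<recip
  kε : k * ε ≡ + 1 / 10
  kε = trans (lin k (recip k)) (trans (cong (+ 1 / 10 *_) (recip-inverse 0<k)) (ℚ.*-identityʳ (+ 1 / 10)))
    where
    lin : ∀ k r → k * (+ 1 / 10 * r) ≡ + 1 / 10 * (k * r)
    lin = solve-∀ ℚ-ring
  step : ∀ n → 1ℚ ≤ seq R n + ½ × q ≤ seq R n + ε → ½ ≤ seq R n × t ≤ (k + + 1 / 5) * h * seq R n
  step n (1≤R , q≤R) = ½≤R , ℚ.≤-trans bound (by (ℚ.<⇒≤ 0<k ⊗ 0≤h ⊗ diff q≤R ⊕ 0≤/ 1 4 ⊗ 0≤h ⊗ diff ½≤R) (lin k h q (seq R n) ε kε))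
    where
    ½≤R : ½ ≤ seq R n
    ½≤R = by (diff 1≤R) (lin' (seq R n))
      where
      lin' : ∀ R → R ≡ ½ + (R + ½ - 1ℚ)
      lin' = solve-∀ ℚ-ring
    lin : ∀ k h q R ε → k * ε ≡ + 1 / 10 → (k + + 1 / 5) * h * R ≡ k * h * q + (k * h * (R + ε - q) + + 1 / 5 * h * (R - ½))
    lin k h q R ε kε = trans (lin₁ k h q R) (trans (cong (λ z → k * h * q + (k * h * (R - q) + z * h + + 1 / 5 * h * (R - ½))) (sym kε)) (lin₂ k h q R ε))
      where
      lin₁ : ∀ k h q R → (k + + 1 / 5) * h * R ≡ k * h * q + (k * h * (R - q) + + 1 / 10 * h + + 1 / 5 * h * (R - ½))
      lin₁ = solve-∀ ℚ-ring
      lin₂ : ∀ k h q R ε → k * h * q + (k * h * (R - q) + k * ε * h + + 1 / 5 * h * (R - ½)) ≡ k * h * q + (k * h * (R + ε - q) + + 1 / 5 * h * (R - ½))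
      lin₂ = solve-∀ ℚ-ring

-- The approximations enter only through the fixed indices m and n, which are absent from the
-- conclusion. The number β may be anything with e^β ≤ 1/(1-p) up to ε: close to log(1/(1-p)) for
-- the first bound, p itself for the second.
key-bound : ∀ {r} (G : Graph N) {t h p β x ε ε′} (R : ℝ) (d m n : ℕ) (D : Outcome G → Bool) →
  Isχf G t → ι 2 ≤ t → Ishf r G h → fromℕˢ 1 ≤ˢ seq R → (∀ ω → T (D ω) → ρ≤ r (retain G ω) R) →
  0ℚ ≤ p → p ≤ 1ℚ → 0ℚ < ε′ → 1ℚ * recip (ι 2 * t) + ε′ ≤ ℙ p D →
  0ℚ ≤ β → 0ℚ ≤ x → 0ℚ ≤ ε → expSum β n * (1ℚ - p) ≤ 1ℚ + ε → x + x ≤ ι d * β → m ℕ.+ m ℕ.≤ n → ι 5 * t ≤ expSum x m →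
  ι 25 * (ι d * ε) ≤ 1ℚ →
  0ℚ ≤ h × Eventually (λ n → ½ ≤ seq R n × t ≤ (ι (d ℕ.+ d) + 1ℚ + + 1 / 5) * h * seq R n)
key-bound G {t} {h} {p} R d m n D χG 2≤t hG 1≤R D⇒ρ 0≤p p≤1 0<ε′ likely 0≤β 0≤x 0≤ε Es≤ 2x≤ 2m≤n large small =
  let (q , 0≤q , q≤R , 0≤h , bound) = sampling-bound G R d χG 2≤t 0≤p p≤1 hG D D⇒ρ (recip-<⇒1< 0<t 0<ε′ likely)
        (exp-growth d m n 0≤β 0≤x (diff p≤1) 0≤ε (ℚ.<⇒≤ 0<t) Es≤ 2x≤ 2m≤n large small)
  in 0≤h , absorb R (by (0≤ι (d ℕ.+ d)) (ℚ.+-comm (ι (d ℕ.+ d)) 1ℚ)) 0≤h 0≤q 1≤R q≤R bound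
  where
  0<t : 0ℚ < t
  0<t = ℚ.<-≤-trans (0<1+ι 1) 2≤t

*-recip-≤ : ∀ {x y h} → 0ℚ < x → y ≤ h * x → y * recip x ≤ h
*-recip-≤ {x} {y} {h} 0<x y≤ = cancelˡ {y * recip x} {h} {x} 0<x (ℚ.≤-trans
  (ℚ.≤-reflexive (trans (lin x y (recip x)) (trans (cong (y *_) (recip-inverse 0<x)) (ℚ.*-identityʳ y))))
  (ℚ.≤-trans y≤ (ℚ.≤-reflexive (ℚ.*-comm h x))))
  where
  lin : ∀ x y r → x * (y * r) ≡ y * (x * r)
  lin = solve-∀ ℚ-ring

-- L₀ is the earlier value of the logarithm from which d was chosen, and r = 1/β. Of the reserve 1/4
-- in d, 2/16 pays for L₀ against L and 2/80 for the quotient; the remaining β/10 covers the δ/16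
-- lost between x and ℓ.
log-degree : ∀ {L₀ L ℓ β r δ x d} → 0ℚ ≤ β → 0ℚ ≤ δ → β * r ≡ 1ℚ → ℓ * r ≤ L + + 1 / 80 → L ≤ L₀ + + 1 / 16 → ι 2 * L₀ + + 1 / 4 ≤ d →
  δ ≤ β → x ≤ ℓ + δ * (+ 1 / 32) → x + x ≤ d * β
log-degree {L₀} {L} {ℓ} {β} {r} {δ} {x} {d} 0≤β 0≤δ βr ℓr≤ L≤ d≥ δ≤β x≤ =
  by (diff d≥ ⊗ 0≤β ⊕ 0≤ι 2 ⊗ diff L≤ ⊗ 0≤β ⊕ 0≤ι 2 ⊗ diff ℓr≤ ⊗ 0≤β ⊕ 0≤ι 2 ⊗ diff x≤ ⊕ 0≤/ 1 9 ⊗ diff δ≤β ⊕ 0≤/ 3 79 ⊗ 0≤δ)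
    (trans (lin₁ d β L₀ L ℓ r δ x) (trans (cong (λ z → x + x + (d - (ι 2 * L₀ + + 1 / 4)) * β + ι 2 * (L₀ + + 1 / 16 - L) * β + ι 2 * (L + + 1 / 80 - ℓ * r) * β
      + ι 2 * ℓ * (z - 1ℚ) + ι 2 * (ℓ + δ * (+ 1 / 32) - x) + + 1 / 10 * (β - δ) + + 3 / 80 * δ) βr) (lin₂ d β L₀ L ℓ r δ x)))
  where
  lin₁ : ∀ d β L₀ L ℓ r δ x → d * β ≡ x + x + (d - (ι 2 * L₀ + + 1 / 4)) * β + ι 2 * (L₀ + + 1 / 16 - L) * β + ι 2 * (L + + 1 / 80 - ℓ * r) * β
    + ι 2 * ℓ * (β * r - 1ℚ) + ι 2 * (ℓ + δ * (+ 1 / 32) - x) + + 1 / 10 * (β - δ) + + 3 / 80 * δ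
  lin₁ = solve-∀ ℚ-ring
  lin₂ : ∀ d β L₀ L ℓ r δ x → x + x + (d - (ι 2 * L₀ + + 1 / 4)) * β + ι 2 * (L₀ + + 1 / 16 - L) * β + ι 2 * (L + + 1 / 80 - ℓ * r) * β
    + ι 2 * ℓ * (1ℚ - 1ℚ) + ι 2 * (ℓ + δ * (+ 1 / 32) - x) + + 1 / 10 * (β - δ) + + 3 / 80 * δ
    ≡ x + x + ((d - (ι 2 * L₀ + + 1 / 4)) * β + ι 2 * (L₀ + + 1 / 16 - L) * β + ι 2 * (L + + 1 / 80 - ℓ * r) * β
    + ι 2 * (ℓ + δ * (+ 1 / 32) - x) + + 1 / 10 * (β - δ) + + 3 / 80 * δ)
  lin₂ = solve-∀ ℚ-ring

-- The 4 is used up exactly: 6/5 for the constant next to 2d, 2 · 5/4 for the reserve and the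
-- rounding in d, 4/16 for L₀ against L, and 4/80 because L, only known to be at least -1/80, passes
-- from 4 L to 8 L.
log-constant : ∀ {L₀ L} d → - (+ 1 / 80) ≤ L → L₀ ≤ L + + 1 / 16 → ι d ≤ ι 2 * L₀ + + 1 / 4 + 1ℚ → ι (d ℕ.+ d) + 1ℚ + + 1 / 5 ≤ ι 8 * L + ι 4
log-constant {L₀} {L} d 0≤L L₀≤ d≤ = by (0≤ι 4 ⊗ diff 0≤L ⊕ 0≤ι 4 ⊗ diff L₀≤ ⊕ 0≤ι 2 ⊗ diff d≤)
  (trans (lin (ι d) L₀ L) (cong (λ z → z + 1ℚ + + 1 / 5 + (ι 4 * (L - - (+ 1 / 80)) + ι 4 * (L + + 1 / 16 - L₀) + ι 2 * (ι 2 * L₀ + + 1 / 4 + 1ℚ - ι d))) (sym (ι-+ d d))))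
  where
  lin : ∀ d L₀ L → ι 8 * L + ι 4 ≡ d + d + 1ℚ + + 1 / 5 + (ι 4 * (L - - (+ 1 / 80)) + ι 4 * (L + + 1 / 16 - L₀) + ι 2 * (ι 2 * L₀ + + 1 / 4 + 1ℚ - d))
  lin = solve-∀ ℚ-ring

divide : ∀ {t k h R Q} → 0ℚ ≤ h → ½ ≤ R → 1ℚ ≤ k → k ≤ Q → t ≤ k * h * R → t * recip (R * Q) ≤ h
divide {t} {k} {h} {R} {Q} 0≤h ½≤R 1≤k k≤Q t≤ = *-recip-≤ (*-pos (ℚ.<-≤-trans 0<½ ½≤R) (ℚ.<-≤-trans (ℚ.positive⁻¹ 1ℚ) (ℚ.≤-trans 1≤k k≤Q)))
  (ℚ.≤-trans t≤ (by (0≤h ⊗ ℚ.≤-trans (0≤/ 1 1) ½≤R ⊗ diff k≤Q) (lin k h R Q)))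
  where
  lin : ∀ k h R Q → h * (R * Q) ≡ k * h * R + h * R * (Q - k)
  lin = solve-∀ ℚ-ring

ratio-lower : ∀ {ℓ r L} → ½ ≤ ℓ → 0ℚ ≤ r → ℓ * r ≤ L + + 1 / 80 → - (+ 1 / 80) ≤ L
ratio-lower {ℓ} {r} {L} ½≤ℓ 0≤r ℓr≤ = by (diff ℓr≤ ⊕ ℚ.≤-trans (0≤/ 1 1) ½≤ℓ ⊗ 0≤r) (lin ℓ r L)
  where
  lin : ∀ ℓ r L → L ≡ - (+ 1 / 80) + (L + + 1 / 80 - ℓ * r + ℓ * r)
  lin = solve-∀ ℚ-ring

module _ {p ε₁ ε₂ : ℚ} (0<ε₁ : 0ℚ < ε₁) (0<ε₂ : 0ℚ < ε₂) (ε₁≤p : 0ℚ + ε₁ ≤ p) (p≤1-ε₂ : p + ε₂ ≤ 1ℚ) where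
  0≤p : 0ℚ ≤ p
  0≤p = ℚ.≤-trans (ℚ.<⇒≤ 0<ε₁) (ℚ.≤-trans (ℚ.≤-reflexive (sym (ℚ.+-identityˡ ε₁))) ε₁≤p)

  0<1-p : 0ℚ < 1ℚ - p
  0<1-p = ℚ.<-≤-trans 0<ε₂ (by (diff p≤1-ε₂) (lin p ε₂))
    where
    lin : ∀ p e → 1ℚ - p ≡ e + (1ℚ - (p + e))
    lin = solve-∀ ℚ-ring

  p≤1 : p ≤ 1ℚ
  p≤1 = by (ℚ.<⇒≤ 0<1-p) (lin p)
    where
    lin : ∀ p → 1ℚ ≡ p + (1ℚ - p)
    lin = solve-∀ ℚ-ring

  base : ℚ
  base = 1ℚ * recip (1ℚ - p)

  base-inverse : base * (1ℚ - p) ≡ 1ℚ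
  base-inverse = trans (lin (recip (1ℚ - p)) (1ℚ - p)) (recip-inverse 0<1-p)
    where
    lin : ∀ r s → 1ℚ * r * s ≡ s * r
    lin = solve-∀ ℚ-ring

  1+p≤base : 1ℚ + p ≤ base
  1+p≤base = cancelˡ {1ℚ + p} {base} {1ℚ - p} 0<1-p (by (0≤p ⊗ 0≤p) (trans (ℚ.*-comm (1ℚ - p) base) (trans base-inverse (lin p))))
    where
    lin : ∀ p → 1ℚ ≡ (1ℚ - p) * (1ℚ + p) + p * p
    lin = solve-∀ ℚ-ring

  -- Provides the form that `exp-positive` expects: the base is at least 1 + p ≥ 1 + ε₁, and half of
  -- ε₁ is spent on the approximation. Hence the logarithm of the base stays away from 0.
  base-lower : ∀ {E} → base ≤ E + ε₁ * ½ → 1ℚ + (ε₁ * (+ 1 / 4) + ε₁ * (+ 1 / 4)) ≤ E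
  base-lower {E} close = by (diff close ⊕ diff 1+p≤base ⊕ diff ε₁≤p) (lin E ε₁ base p)
    where
    lin : ∀ E e b p → E ≡ 1ℚ + (e * (+ 1 / 4) + e * (+ 1 / 4)) + (E + e * ½ - b + (b - (1ℚ + p)) + (p - (0ℚ + e)))
    lin = solve-∀ ℚ-ring

  base-upper : ∀ {E ε} → 0ℚ ≤ ε → E ≤ base + ε → E * (1ℚ - p) ≤ 1ℚ + ε
  base-upper {E} {ε} 0≤ε close = by (diff close ⊗ ℚ.<⇒≤ 0<1-p ⊕ 0≤ε ⊗ 0≤p)
    (trans (cong (_+ ε) (sym base-inverse)) (lin E ε base p))
    where
    lin : ∀ E ε b p → b * (1ℚ - p) + ε ≡ E * (1ℚ - p) + ((b + ε - E) * (1ℚ - p) + ε * p)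
    lin = solve-∀ ℚ-ring

-- The bound with the logarithm to base 1/(1-p)

at-index : ∀ {P} → Eventually P → Σ ℕ P
at-index (K , h) = K , h K ℕₚ.≤-refl

from : ∀ K → Eventually (K ℕ.≤_)
from K = K , λ _ h → h

bound-log : ∀ (r : ℕ) {N : ℕ} (G : Graph N) (t : ℚ) (p R : ℝ) → Isχf G t → ι 2 ≤ t →
  fromℕˢ 0 <ˢ seq p → seq p <ˢ fromℕˢ 1 → fromℕˢ 1 ≤ˢ seq R →
  ℙ>[ G , seq p ] (λ Gp → ρ≤ r Gp R) (fromℕˢ 1 /ˢ (fromℕˢ 2 *ˢ fromℚ t)) →
  ∀ (L : ℝ) → IsLog (fromℕˢ 1 /ˢ (fromℕˢ 1 -ˢ seq p)) (fromℕˢ 2 *ˢ e *ˢ fromℚ t) L →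
  ∀ (h : ℚ) → Ishf r G h →
  0ℚ ≤ h × Eventually (λ n → t * recip (seq R n * (ι 8 * seq L n + ι 4)) ≤ h)
bound-log r {N} G t p R χG 2≤t (ε₁ , 0<ε₁ , p>0) (ε₂ , 0<ε₂ , p<1) 1≤R (D , D⇒ρ , ε₃ , 0<ε₃ , likely) L (ℓb , ℓx , lnb , lnx , L≈) h hG =
  choose (at-index (logs ⊓ from (proj₁ L-cauchy)))
  where
  δ′ = ε₁ * (+ 1 / 4)
  0<δ : 0ℚ < δ′
  0<δ = *-pos 0<ε₁ (ℚ.positive⁻¹ (+ 1 / 4))
  p∈01 : Eventually (λ n → 0ℚ + ε₁ ≤ seq p n × seq p n + ε₂ ≤ 1ℚ)
  p∈01 = p>0 ⊓ p<1
  δ≤½ : δ′ ≤ ½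
  δ≤½ = let (n , lo , hi) = at-index p∈01 in
    by (0≤/ 1 3 ⊗ diff lo ⊕ 0≤/ 1 3 ⊗ diff (p≤1 0<ε₁ 0<ε₂ lo hi) ⊕ 0≤/ 1 3) (lin ε₁ (seq p n))
    where
    lin : ∀ e p → ½ ≡ e * (+ 1 / 4) + (+ 1 / 4 * (p - (0ℚ + e)) + + 1 / 4 * (1ℚ - p) + + 1 / 4)
    lin = solve-∀ ℚ-ring
  ℓb-positive : Eventually (λ n → δ′ ≤ seq ℓb n)
  ℓb-positive = exp-positive ℓb 0<δ δ≤½ (ev-map
    (λ n ((lo , hi) , close) → base-lower 0<ε₁ 0<ε₂ lo hi (∣-∣≤⇒≥ {exp (seq ℓb) n} {base 0<ε₁ 0<ε₂ lo hi} close))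
    (p∈01 ⊓ lnb (ε₁ * ½) (*-pos 0<ε₁ 0<½)))
  L-cauchy = isCauchy L (+ 1 / 16) (ℚ.positive⁻¹ (+ 1 / 16))
  ℓx-cauchy = isCauchy ℓx (δ′ * (+ 1 / 32)) (*-pos 0<δ (ℚ.positive⁻¹ (+ 1 / 32)))
  logs : Eventually (λ n → δ′ ≤ seq ℓb n × (ι 5 * t ≤ exp (seq ℓx) n × ½ ≤ seq ℓx n) × ∣ seq L n - seq ℓx n * recip (seq ℓb n) ∣ ≤ + 1 / 80)
  logs = ℓb-positive ⊓ ln-large ℓx 2≤t lnx ⊓ L≈ (+ 1 / 80) (ℚ.positive⁻¹ (+ 1 / 80))
  0≤recip-ℓb : ∀ {n} → δ′ ≤ seq ℓb n → 0ℚ ≤ recip (seq ℓb n)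
  0≤recip-ℓb δ≤ = 0≤recip (ℚ.<-≤-trans 0<δ δ≤)
  L-lower : ∀ n → δ′ ≤ seq ℓb n × (ι 5 * t ≤ exp (seq ℓx) n × ½ ≤ seq ℓx n) × ∣ seq L n - seq ℓx n * recip (seq ℓb n) ∣ ≤ + 1 / 80 → - (+ 1 / 80) ≤ seq L n
  L-lower n (δ≤ , (_ , ½≤) , close) = ratio-lower ½≤ (0≤recip-ℓb δ≤) (∣-∣≤⇒≥ {seq L n} {seq ℓx n * recip (seq ℓb n)} close)

  -- The order of the choices matters: n₀ fixes d, then m fixes a partial sum reaching 5t, and only
  -- then comes n, since its tolerance depends on d and it has to be at least 2m.
  with-degree : ∀ n₀ d → proj₁ L-cauchy ℕ.≤ n₀ → ι 2 * seq L n₀ + + 1 / 4 ≤ ι d → ι d ≤ ι 2 * seq L n₀ + + 1 / 4 + 1ℚ →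
    Σ ℕ (λ m → (ι 5 * t ≤ exp (seq ℓx) m × ½ ≤ seq ℓx m) × proj₁ ℓx-cauchy ℕ.≤ m) →
    0ℚ ≤ h × Eventually (λ n → t * recip (seq R n * (ι 8 * seq L n + ι 4)) ≤ h)
  with-degree n₀ d K≤n₀ d≥ d≤ (m , (large , ½≤x) , K≤m) =
    finish (at-index (logs ⊓ p∈01 ⊓ likely ⊓ lnb (tolerance d) (0<tolerance d) ⊓ from (m ℕ.+ m) ⊓ from n₀ ⊓ from (proj₁ ℓx-cauchy)))
    where
    finish : Σ ℕ (λ n → (δ′ ≤ seq ℓb n × (ι 5 * t ≤ exp (seq ℓx) n × ½ ≤ seq ℓx n) × ∣ seq L n - seq ℓx n * recip (seq ℓb n) ∣ ≤ + 1 / 80) ×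
        (0ℚ + ε₁ ≤ seq p n × seq p n + ε₂ ≤ 1ℚ) × (1ℚ * recip (ι 2 * t) + ε₃ ≤ prob (seq p) D n) ×
        ∣ exp (seq ℓb) n - 1ℚ * recip (1ℚ - seq p n) ∣ ≤ tolerance d × m ℕ.+ m ℕ.≤ n × n₀ ℕ.≤ n × proj₁ ℓx-cauchy ℕ.≤ n) →
      0ℚ ≤ h × Eventually (λ n → t * recip (seq R n * (ι 8 * seq L n + ι 4)) ≤ h)
    finish (n , (δ≤ , _ , close) , (lo , hi) , likely-n , base-close , 2m≤n , n₀≤n , K≤n) =
      let (0≤h , bound) = key-bound G {t} {h} {seq p n} {seq ℓb n} {seq ℓx m} {tolerance d} {ε₃} R d m n D χG 2≤t hG 1≤R D⇒ρ
            (0≤p 0<ε₁ 0<ε₂ lo hi) (p≤1 0<ε₁ 0<ε₂ lo hi) 0<ε₃ (ℚ.≤-trans likely-n (ℚ.≤-reflexive (prob≡ℙ (seq p) D n)))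
            (ℚ.<⇒≤ 0<β) (ℚ.≤-trans (0≤/ 1 1) ½≤x) (ℚ.<⇒≤ (0<tolerance d))
            (base-upper 0<ε₁ 0<ε₂ lo hi (ℚ.<⇒≤ (0<tolerance d)) (∣-∣≤⇒≤ {exp (seq ℓb) n} {base 0<ε₁ 0<ε₂ lo hi} base-close))
            (log-degree {seq L n₀} {seq L n} {seq ℓx n} {seq ℓb n} {recip (seq ℓb n)} {δ′} {seq ℓx m} {ι d} (ℚ.<⇒≤ 0<β) (ℚ.<⇒≤ 0<δ) (recip-inverse 0<β)
              (∣-∣≤⇒≥ {seq L n} {seq ℓx n * recip (seq ℓb n)} close)
              (∣-∣≤⇒≤ {seq L n} {seq L n₀} (proj₂ L-cauchy n n₀ (ℕₚ.≤-trans K≤n₀ n₀≤n) K≤n₀)) d≥ δ≤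
              (∣-∣≤⇒≤ {seq ℓx m} {seq ℓx n} (proj₂ ℓx-cauchy m n K≤m K≤n)))
            2m≤n large (tolerance-≤ d)
      in 0≤h , ev-map (λ n' ((½≤R , t≤) , facts , n₀≤n') → divide {t} {ι (d ℕ.+ d) + 1ℚ + + 1 / 5} {h} {seq R n'} {ι 8 * seq L n' + ι 4} 0≤h ½≤R
            (by (0≤ι (d ℕ.+ d) ⊕ 0≤/ 1 4) (lin (ι (d ℕ.+ d))))
            (log-constant {seq L n₀} {seq L n'} d (L-lower n' facts) (∣-∣≤⇒≤ {seq L n₀} {seq L n'} (proj₂ L-cauchy n₀ n' K≤n₀ (ℕₚ.≤-trans K≤n₀ n₀≤n'))) d≤) t≤)
          (bound ⊓ logs ⊓ from n₀)
      where
      0<β : 0ℚ < seq ℓb n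
      0<β = ℚ.<-≤-trans 0<δ δ≤
      lin : ∀ d → d + 1ℚ + + 1 / 5 ≡ 1ℚ + (d + + 1 / 5)
      lin = solve-∀ ℚ-ring

  choose : Σ ℕ (λ n₀ → (δ′ ≤ seq ℓb n₀ × (ι 5 * t ≤ exp (seq ℓx) n₀ × ½ ≤ seq ℓx n₀) × ∣ seq L n₀ - seq ℓx n₀ * recip (seq ℓb n₀) ∣ ≤ + 1 / 80) × proj₁ L-cauchy ℕ.≤ n₀) →
    0ℚ ≤ h × Eventually (λ n → t * recip (seq R n * (ι 8 * seq L n + ι 4)) ≤ h)
  choose (n₀ , facts , K≤n₀) = let (d , d≥ , d≤) = ceiling 0≤degree in
    with-degree n₀ d K≤n₀ d≥ d≤ (at-index (ln-large ℓx 2≤t lnx ⊓ from (proj₁ ℓx-cauchy)))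
    where
    0≤degree : 0ℚ ≤ ι 2 * seq L n₀ + + 1 / 4
    0≤degree = by (0≤ι 2 ⊗ diff (L-lower n₀ facts) ⊕ 0≤/ 9 39) (lin (seq L n₀))
      where
      lin : ∀ L → ι 2 * L + + 1 / 4 ≡ 0ℚ + (ι 2 * (L - - (+ 1 / 80)) + + 9 / 40)
      lin = solve-∀ ℚ-ring

-- The bound for p ≤ 1/2

linear-degree : ∀ {p₀ p ε x₀ ℓ d} → 0ℚ ≤ d → 0ℚ ≤ p₀ → ε ≤ p₀ → p₀ ≤ p + ε * ½ → x₀ * p₀ ≡ ι 4 * ℓ → x₀ ≤ d → ℓ + ℓ ≤ d * p
linear-degree {p₀} {p} {ε} {x₀} {ℓ} {d} 0≤d 0≤p₀ ε≤p₀ p₀≤ x₀p₀ x₀≤d =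
  -- Since p ≥ p₀ - ε/2 ≥ p₀/2, d p is at least x₀ p₀ / 2 = 2ℓ; the 4 in x₀ pays for this halving.
  by (0≤d ⊗ diff p₀≤ ⊕ 0≤/ 1 1 ⊗ 0≤d ⊗ diff ε≤p₀ ⊕ 0≤/ 1 1 ⊗ diff x₀≤d ⊗ 0≤p₀)
    (trans (lin₁ d p p₀ ε x₀) (trans (cong (λ z → ½ * z + (d * (p + ε * ½ - p₀) + ½ * d * (p₀ - ε) + ½ * (d - x₀) * p₀)) x₀p₀) (lin₂ d p p₀ ε x₀ ℓ)))
  where
  lin₁ : ∀ d p p₀ ε x₀ → d * p ≡ ½ * (x₀ * p₀) + (d * (p + ε * ½ - p₀) + ½ * d * (p₀ - ε) + ½ * (d - x₀) * p₀)
  lin₁ = solve-∀ ℚ-ring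
  lin₂ : ∀ d p p₀ ε x₀ ℓ → ½ * (ι 4 * ℓ) + (d * (p + ε * ½ - p₀) + ½ * d * (p₀ - ε) + ½ * (d - x₀) * p₀) ≡ ℓ + ℓ + (d * (p + ε * ½ - p₀) + ½ * d * (p₀ - ε) + ½ * (d - x₀) * p₀)
  lin₂ = solve-∀ ℚ-ring

-- From p ≤ p₀ + ε/2 ≤ (3/2) p₀ follows 2 p x₀ ≤ 3 x₀ p₀ = 12 ℓ₀ ≤ 12 ℓ + 3. The 3 and the remaining
-- (16/5) p fit into 28 ℓ ≥ 14, which makes 40.
linear-constant : ∀ {p₀ p ε x₀ ℓ₀ ℓ} d → 0ℚ ≤ x₀ → 0ℚ ≤ p → p ≤ 1ℚ → ε ≤ p₀ → p ≤ p₀ + ε * ½ → x₀ * p₀ ≡ ι 4 * ℓ₀ → ι d ≤ x₀ + 1ℚ →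
  ℓ₀ ≤ ℓ + + 1 / 4 → ½ ≤ ℓ → p * (ι (d ℕ.+ d) + 1ℚ + + 1 / 5) ≤ ι 40 * ℓ
linear-constant {p₀} {p} {ε} {x₀} {ℓ₀} {ℓ} d 0≤x₀ 0≤p p≤1 ε≤p₀ p≤ x₀p₀ d≤ ℓ₀≤ ½≤ℓ =
  by (0≤ι 2 ⊗ 0≤p ⊗ diff d≤ ⊕ 0≤ι 2 ⊗ 0≤x₀ ⊗ diff p≤ ⊕ 0≤x₀ ⊗ diff ε≤p₀ ⊕ 0≤/ 16 4 ⊗ diff p≤1 ⊕ 0≤ι 12 ⊗ diff ℓ₀≤ ⊕ 0≤ι 28 ⊗ diff ½≤ℓ ⊕ 0≤/ 39 4)
    (trans (lin₁ (ι d) p p₀ ε x₀ ℓ₀ ℓ) (trans (cong₂ (λ z w → p * (w + 1ℚ + + 1 / 5) + (ι 3 * (ι 4 * ℓ₀ - z)) +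
      (ι 2 * p * (x₀ + 1ℚ - ι d) + ι 2 * x₀ * (p₀ + ε * ½ - p) + x₀ * (p₀ - ε) + + 16 / 5 * (1ℚ - p) + ι 12 * (ℓ + + 1 / 4 - ℓ₀) + ι 28 * (ℓ - ½) + + 39 / 5)) x₀p₀ (sym (ι-+ d d)))
      (lin₂ (ι (d ℕ.+ d)) p ℓ₀ (ι 2 * p * (x₀ + 1ℚ - ι d) + ι 2 * x₀ * (p₀ + ε * ½ - p) + x₀ * (p₀ - ε) + + 16 / 5 * (1ℚ - p) + ι 12 * (ℓ + + 1 / 4 - ℓ₀) + ι 28 * (ℓ - ½) + + 39 / 5))))
  where
  lin₁ : ∀ d p p₀ ε x₀ ℓ₀ ℓ → ι 40 * ℓ ≡ p * (d + d + 1ℚ + + 1 / 5) + (ι 3 * (ι 4 * ℓ₀ - x₀ * p₀)) +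
    (ι 2 * p * (x₀ + 1ℚ - d) + ι 2 * x₀ * (p₀ + ε * ½ - p) + x₀ * (p₀ - ε) + + 16 / 5 * (1ℚ - p) + ι 12 * (ℓ + + 1 / 4 - ℓ₀) + ι 28 * (ℓ - ½) + + 39 / 5)
  lin₁ = solve-∀ ℚ-ring
  lin₂ : ∀ w p ℓ₀ s → p * (w + 1ℚ + + 1 / 5) + (ι 3 * (ι 4 * ℓ₀ - ι 4 * ℓ₀)) + s ≡ p * (w + 1ℚ + + 1 / 5) + s
  lin₂ = solve-∀ ℚ-ring

divide-linear : ∀ {t k h R ℓ p} → 0ℚ ≤ h → ½ ≤ R → ½ ≤ ℓ → 0ℚ ≤ p → p * k ≤ ι 40 * ℓ → t ≤ k * h * R → + 1 / 40 * (p * t * recip (R * ℓ)) ≤ h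
divide-linear {t} {k} {h} {R} {ℓ} {p} 0≤h ½≤R ½≤ℓ 0≤p pk≤ t≤ =
  by (0≤/ 1 39 ⊗ diff (*-recip-≤ {R * ℓ} {p * t} {ι 40 * h} (*-pos (ℚ.<-≤-trans 0<½ ½≤R) (ℚ.<-≤-trans 0<½ ½≤ℓ))
      (by (0≤p ⊗ diff t≤ ⊕ 0≤h ⊗ ℚ.≤-trans (0≤/ 1 1) ½≤R ⊗ diff pk≤) (lin₁ p t k h R ℓ))))
    (lin₂ h (p * t * recip (R * ℓ)))
  where
  lin₁ : ∀ p t k h R ℓ → ι 40 * h * (R * ℓ) ≡ p * t + (p * (k * h * R - t) + h * R * (ι 40 * ℓ - p * k))
  lin₁ = solve-∀ ℚ-ring
  lin₂ : ∀ h z → h ≡ + 1 / 40 * z + + 1 / 40 * (ι 40 * h - z)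
  lin₂ = solve-∀ ℚ-ring

bound-linear : ∀ (r : ℕ) {N : ℕ} (G : Graph N) (t : ℚ) (p R : ℝ) → Isχf G t → ι 2 ≤ t →
  fromℕˢ 0 <ˢ seq p → seq p ≤ˢ (fromℕˢ 1 /ˢ fromℕˢ 2) → fromℕˢ 1 ≤ˢ seq R →
  ℙ>[ G , seq p ] (λ Gp → ρ≤ r Gp R) (fromℕˢ 1 /ˢ (fromℕˢ 2 *ˢ fromℚ t)) →
  ∀ (ℓ : ℝ) → IsLn (fromℕˢ 2 *ˢ e *ˢ fromℚ t) ℓ →
  ∀ (h : ℚ) → Ishf r G h →
  Eventually (λ n → + 1 / 40 * (seq p n * t * recip (seq R n * seq ℓ n)) ≤ h)
bound-linear r {N} G t p R χG 2≤t (ε₁ , 0<ε₁ , p>0) p≤½ 1≤R (D , D⇒ρ , ε₃ , 0<ε₃ , likely) ℓ ln h hG =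
  choose (at-index (regular ⊓ from (proj₁ p-cauchy) ⊓ from (proj₁ ℓ-cauchy)))
  where
  -- The presentation of p stays below 1/2 only up to an error; allowing 1/4 keeps p ≤ 3/4, away
  -- from 1.
  ε₂ = + 1 / 4
  0<ε₂ : 0ℚ < ε₂
  0<ε₂ = ℚ.positive⁻¹ ε₂
  p<1 : Eventually (λ n → seq p n + ε₂ ≤ 1ℚ)
  p<1 = ev-map (λ n h → by (diff h ⊕ 0≤ι 0) (lin (seq p n))) (p≤½ ε₂ 0<ε₂)
    where
    lin : ∀ p → 1ℚ ≡ p + + 1 / 4 + (½ + + 1 / 4 - p + 0ℚ)
    lin = solve-∀ ℚ-ring
  p-cauchy = isCauchy p (ε₁ * ½) (*-pos 0<ε₁ 0<½)
  ℓ-cauchy = isCauchy ℓ ε₂ 0<ε₂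

  Regular : ℕ → Set
  Regular n = (0ℚ + ε₁ ≤ seq p n × seq p n + ε₂ ≤ 1ℚ) × (ι 5 * t ≤ exp (seq ℓ) n × ½ ≤ seq ℓ n)

  regular : Eventually Regular
  regular = (p>0 ⊓ p<1) ⊓ ln-large ℓ 2≤t ln

  choose : Σ ℕ (λ m → Regular m × proj₁ p-cauchy ℕ.≤ m × proj₁ ℓ-cauchy ℕ.≤ m) →
    Eventually (λ n → + 1 / 40 * (seq p n * t * recip (seq R n * seq ℓ n)) ≤ h)
  choose (m , ((lo , hi) , large , ½≤ℓ) , Kp≤m , Kℓ≤m) = let (d , d≥ , d≤) = ceiling 0≤x₀ in
    finish d d≥ d≤ (at-index (regular ⊓ likely ⊓ from m ⊓ from (m ℕ.+ m)))
    where
    ε₁≤p₀ : ε₁ ≤ seq p m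
    ε₁≤p₀ = ℚ.≤-trans (ℚ.≤-reflexive (sym (ℚ.+-identityˡ ε₁))) lo
    0<p₀ : 0ℚ < seq p m
    0<p₀ = ℚ.<-≤-trans 0<ε₁ ε₁≤p₀
    0≤ℓ : 0ℚ ≤ seq ℓ m
    0≤ℓ = ℚ.≤-trans (0≤/ 1 1) ½≤ℓ
    x₀ : ℚ
    x₀ = ι 4 * seq ℓ m * recip (seq p m)
    0≤x₀ : 0ℚ ≤ x₀
    0≤x₀ = 0≤ι 4 ⊗ 0≤ℓ ⊗ 0≤recip 0<p₀
    x₀p₀ : x₀ * seq p m ≡ ι 4 * seq ℓ m
    x₀p₀ = trans (lin (ι 4 * seq ℓ m) (recip (seq p m)) (seq p m)) (trans (cong (ι 4 * seq ℓ m *_) (recip-inverse 0<p₀)) (ℚ.*-identityʳ (ι 4 * seq ℓ m)))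
      where
      lin : ∀ a r p → a * r * p ≡ a * (p * r)
      lin = solve-∀ ℚ-ring

    finish : ∀ d → x₀ ≤ ι d → ι d ≤ x₀ + 1ℚ → Σ ℕ (λ n → Regular n × (1ℚ * recip (ι 2 * t) + ε₃ ≤ prob (seq p) D n) × m ℕ.≤ n × m ℕ.+ m ℕ.≤ n) →
      Eventually (λ n → + 1 / 40 * (seq p n * t * recip (seq R n * seq ℓ n)) ≤ h)
    finish d d≥ d≤ (n , ((lo-n , hi-n) , _) , likely-n , m≤n , 2m≤n) =
      let (0≤h , bound) = key-bound G {t} {h} {seq p n} {seq p n} {seq ℓ m} {0ℚ} {ε₃} R d m n D χG 2≤t hG 1≤R D⇒ρ
            0≤pₙ pₙ≤1 0<ε₃ (ℚ.≤-trans likely-n (ℚ.≤-reflexive (prob≡ℙ (seq p) D n)))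
            -- Here β = p and ε = 0: the partial sums satisfy e^p (1-p) ≤ 1 without any error.
            0≤pₙ 0≤ℓ ℚ.≤-refl (ℚ.≤-trans (expSum-geometric 0≤pₙ pₙ≤1 n) (ℚ.≤-reflexive (sym (ℚ.+-identityʳ 1ℚ))))
            (linear-degree {seq p m} {seq p n} {ε₁} {x₀} {seq ℓ m} {ι d} (0≤ι d) (ℚ.<⇒≤ 0<p₀) ε₁≤p₀
              (∣-∣≤⇒≤ {seq p m} {seq p n} (proj₂ p-cauchy m n Kp≤m (ℕₚ.≤-trans Kp≤m m≤n))) x₀p₀ d≥)
            2m≤n large (ℚ.≤-trans (ℚ.≤-reflexive (lin (ι d))) 0≤1)
      in ev-map (λ n' ((½≤R , t≤) , ((lo' , hi') , (_ , ½≤ℓ')) , m≤n') → divide-linear {t} {ι (d ℕ.+ d) + 1ℚ + + 1 / 5} {h} {seq R n'} {seq ℓ n'} {seq p n'} 0≤h ½≤R ½≤ℓ'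
            (0≤p 0<ε₁ 0<ε₂ lo' hi')
            (linear-constant {seq p m} {seq p n'} {ε₁} {x₀} {seq ℓ m} {seq ℓ n'} d 0≤x₀ (0≤p 0<ε₁ 0<ε₂ lo' hi') (p≤1 0<ε₁ 0<ε₂ lo' hi') ε₁≤p₀
              (∣-∣≤⇒≥ {seq p m} {seq p n'} (proj₂ p-cauchy m n' Kp≤m (ℕₚ.≤-trans Kp≤m m≤n'))) x₀p₀ d≤
              (∣-∣≤⇒≤ {seq ℓ m} {seq ℓ n'} (proj₂ ℓ-cauchy m n' Kℓ≤m (ℕₚ.≤-trans Kℓ≤m m≤n'))) ½≤ℓ') t≤)
          (bound ⊓ regular ⊓ from m)
      where
      0≤pₙ : 0ℚ ≤ seq p n
      0≤pₙ = 0≤p 0<ε₁ 0<ε₂ lo-n hi-n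
      pₙ≤1 : seq p n ≤ 1ℚ
      pₙ≤1 = p≤1 0<ε₁ 0<ε₂ lo-n hi-n
      lin : ∀ d → ι 25 * (d * 0ℚ) ≡ 0ℚ
      lin = solve-∀ ℚ-ring

constant : ℚ → ℝ
constant q = record { seq = fromℚ q ; isCauchy = λ ε 0<ε → 0 , λ _ _ _ _ →
  ℚ.≤-trans (ℚ.≤-reflexive (cong ∣_∣ (ℚ.+-inverseʳ q))) (ℚ.<⇒≤ 0<ε) }

≤-+ε : ∀ {h} {x : Seq} → Eventually (λ n → x n ≤ h) → x ≤ˢ fromℚ h
≤-+ε {h} {x} ev ε 0<ε = ev-map (λ n x≤h → by (diff x≤h ⊕ ℚ.<⇒≤ 0<ε) (lin (x n) h ε)) ev
  where
  lin : ∀ x h ε → h + ε ≡ x + (h - x + ε)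
  lin = solve-∀ ℚ-ring

theorem9p7 : (∀ (r : ℕ) {N : ℕ} (G : Graph N) (t : ℚ) (p R : ℝ) →
    4 ℕ.≤ r →
    Isχf G t → (+ 2 / 1) ℚ.≤ t →
    fromℕˢ 0 <ˢ seq p → seq p <ˢ fromℕˢ 1 →
    fromℕˢ 1 ≤ˢ seq R →
    ℙ>[ G , seq p ] (λ Gp → ρ≤ r Gp R) (fromℕˢ 1 /ˢ (fromℕˢ 2 *ˢ fromℚ t)) →
    ∀ (L : ℝ) →
    IsLog (fromℕˢ 1 /ˢ (fromℕˢ 1 -ˢ seq p)) (fromℕˢ 2 *ˢ e *ˢ fromℚ t) L →
    ∀ (h : ℚ) → Ishf r G h →
    fromℚ t /ˢ (seq R *ˢ (fromℕˢ 8 *ˢ seq L +ˢ fromℕˢ 4)) ≤ˢ fromℚ h)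
    ×
    (Σ ℝ λ c → fromℕˢ 0 <ˢ seq c ×
    (∀ (r : ℕ) {N : ℕ} (G : Graph N) (t : ℚ) (p R : ℝ) →
    4 ℕ.≤ r →
    Isχf G t → (+ 2 / 1) ℚ.≤ t →
    fromℕˢ 0 <ˢ seq p → seq p ≤ˢ (fromℕˢ 1 /ˢ fromℕˢ 2) →
    fromℕˢ 1 ≤ˢ seq R →
    ℙ>[ G , seq p ] (λ Gp → ρ≤ r Gp R) (fromℕˢ 1 /ˢ (fromℕˢ 2 *ˢ fromℚ t)) →
    ∀ (ℓ : ℝ) → IsLn (fromℕˢ 2 *ˢ e *ˢ fromℚ t) ℓ →
    ∀ (h : ℚ) → Ishf r G h →
    seq c *ˢ ((seq p *ˢ fromℚ t) /ˢ (seq R *ˢ seq ℓ)) ≤ˢ fromℚ h))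
theorem9p7 =
  (λ r G t p R _ χG 2≤t p>0 p<1 1≤R likely L log h hG →
    ≤-+ε {h} {fromℚ t /ˢ (seq R *ˢ (fromℕˢ 8 *ˢ seq L +ˢ fromℕˢ 4))} (proj₂ (bound-log r G t p R χG 2≤t p>0 p<1 1≤R likely L log h hG))) ,
  constant (+ 1 / 40) , (+ 1 / 40 , ℚ.positive⁻¹ (+ 1 / 40) , 0 , λ _ _ → ℚ.≤-refl) ,
  λ r G t p R _ χG 2≤t p>0 p≤½ 1≤R likely ℓ ln h hG →
    ≤-+ε {h} {fromℚ (+ 1 / 40) *ˢ ((seq p *ˢ fromℚ t) /ˢ (seq R *ˢ seq ℓ))} (bound-linear r G t p R χG 2≤t p>0 p≤½ 1≤R likely ℓ ln h hG)
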